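{- Let $\mathcal{M}$ be an unbounded graph matroid family. Then $\mathcal{M}$ has the Whitney property if and only if $\mathcal{M}$ has the Lovász-Yemini property.
   Context: All graphs are finite and simple (no loops, no parallel edges), with vertex sets taken from a fixed countably infinite set, and are assumed to have no isolated vertices. A graph matroid family $\mathcal{M}$ assigns to every such graph $G$ a matroid $\mathcal{M}(G)$ on the ground set $E(G)$ such that (i) every graph isomorphism $\varphi:V(G)\to V(H)$ induces, via $uv\mapsto \varphi(u)\varphi(v)$, an isomorphism between $\mathcal{M}(G)$ and $\mathcal{M}(H)$, and (ii) for every subgraph $H$ of $G$, $\mathcal{M}(H)$ is the restriction of $\mathcal{M}(G)$ to $E(H)$. Let $r(G)$ denote the rank of $\mathcal{M}(G)$ and $K_n$ the complete graph on $n$ vertices; $K_V$ is the complete graph on vertex set $V$. $\mathcal{M}$ is unbounded if $r(K_n)$ is unbounded as $n\to\infty$. A graph $G$ is $\mathcal{M}$-rigid if $r(G)=r(K_{V(G)})$. A graph $G$ is $\mathcal{M}$-reconstructible if for every graph $H$ and every matroid isomorphism $\psi:E(G)\to E(H)$ between $\mathcal{M}(G)$ and $\mathcal{M}(H)$, $\psi$ is induced by a graph isomorphism, i.e., there is a graph isomorphism $\varphi:V(G)\to V(H)$ with $\psi(uv)=\varphi(u)\varphi(v)$ for all $uv\in E(G)$. $\mathcal{M}$ has the Whitney property if there is a nonnegative integer $c$ such that every $c$-connected graph is $\mathcal{M}$-reconstructible; $\mathcal{M}$ has the Lovász-Yemini property if there is a nonnegative integer $c$ such that every $c$-connected graph is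 $\mathcal{M}$-rigid. -}

module Defs where

open import Level using (0ℓ)
open import Data.Nat using (ℕ; _<_; _≤_; _+_)
open import Data.Product using (Σ; ∃; ∃-syntax; _×_; _,_; proj₁; proj₂)
open import Data.Sum using (_⊎_)
open import Data.List using (List; map; length)
open import Data.List.Membership.Propositional using (_∈_; _∉_)
open import Data.List.Relation.Binary.Subset.Propositional using (_⊆_)
open import Data.List.Relation.Unary.All using (All)
open import Data.List.Relation.Unary.Unique.Propositional using (Unique)
open import Relation.Binary.PropositionalEquality using (_≡_)
open import Function.Bundles using (_⇔_)

-- Vertices: the fixed countably infinite set ℕ.
-- An edge uv is stored as an ordered pair (u , v) with u < v.
Edge : Set
Edge = ℕ × ℕ

-- A finite simple graph without isolated vertices is given by its
-- (finite) edge set; duplicates in the list are harmless (set semantics).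
record Graph : Set where
  constructor mkGraph
  field
    edges  : List Edge
    simple : All (λ e → proj₁ e < proj₂ e) edges
open Graph public

E : Graph → List Edge
E = edges

Joins : Edge → ℕ → ℕ → Set
Joins e a b = (e ≡ (a , b)) ⊎ (e ≡ (b , a))

InV : Graph → ℕ → Set
InV G u = ∃[ e ] (e ∈ E G × ((proj₁ e ≡ u) ⊎ (proj₂ e ≡ u)))

Adj : Graph → ℕ → ℕ → Set
Adj G u v = ∃[ e ] (e ∈ E G × Joins e u v)

-- Matroid on the finite ground set E, given by its rank function
-- (only values on subsets of E matter; subsets are lists up to membership).
record IsMatroidRank (Gr : List Edge) (r : List Edge → ℕ) : Set where
  field
    ext    : ∀ X Y → X ⊆ Gr → Y ⊆ Gr → X ⊆ Y → Y ⊆ X → r X ≡ r Y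
    bound  : ∀ X → X ⊆ Gr → r X ≤ length X
    mono   : ∀ X Y → Y ⊆ Gr → X ⊆ Y → r X ≤ r Y
    submod : ∀ X Y U I → X ⊆ Gr → Y ⊆ Gr →
             (∀ e → (e ∈ U) ⇔ ((e ∈ X) ⊎ (e ∈ Y))) →
             (∀ e → (e ∈ I) ⇔ ((e ∈ X) × (e ∈ Y))) →
             r U + r I ≤ r X + r Y

record IsGraphIso (G H : Graph) (φ : ℕ → ℕ) : Set where
  field
    maps-into : ∀ u → InV G u → InV H (φ u)
    injective : ∀ u v → InV G u → InV G v → φ u ≡ φ v → u ≡ v
    onto      : ∀ w → InV H w → ∃[ u ] (InV G u × φ u ≡ w)
    adj       : ∀ u v → InV G u → InV G v → Adj G u v ⇔ Adj H (φ u) (φ v)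

InducedBy : Graph → (ℕ → ℕ) → (Edge → Edge) → Set
InducedBy G φ ψ = ∀ e → e ∈ E G → Joins (ψ e) (φ (proj₁ e)) (φ (proj₂ e))

record GraphMatroidFamily : Set where
  field
    rk        : Graph → List Edge → ℕ
    matroid   : ∀ G → IsMatroidRank (E G) (rk G)
    iso-inv   : ∀ G H φ ψ → IsGraphIso G H φ → InducedBy G φ ψ →
                ∀ X → X ⊆ E G → rk H (map ψ X) ≡ rk G X
    restrict  : ∀ G H → E H ⊆ E G → ∀ X → X ⊆ E H → rk H X ≡ rk G X
open GraphMatroidFamily public

module _ (M : GraphMatroidFamily) where

  rank : Graph → ℕ
  rank G = rk M G (E G)

  record IsMatroidIso (G H : Graph) (ψ : Edge → Edge) : Set where
    field
      maps-into : ∀ e → e ∈ E G → ψ e ∈ E H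
      injective : ∀ e f → e ∈ E G → f ∈ E G → ψ e ≡ ψ f → e ≡ f
      onto      : ∀ f → f ∈ E H → ∃[ e ] (e ∈ E G × ψ e ≡ f)
      rank-pres : ∀ X → X ⊆ E G → rk M H (map ψ X) ≡ rk M G X

  Reconstructible : Graph → Set
  Reconstructible G = ∀ H ψ → IsMatroidIso G H ψ →
    ∃[ φ ] (IsGraphIso G H φ × InducedBy G φ ψ)

IsCompleteOn : Graph → Graph → Set
IsCompleteOn K G = ∀ u v → u < v → ((u , v) ∈ E K) ⇔ (InV G u × InV G v)

IsCompleteGraph : Graph → ℕ → Set
IsCompleteGraph K n = ∀ u v → u < v → ((u , v) ∈ E K) ⇔ (v < n)

Rigid : GraphMatroidFamily → Graph → Set
Rigid M G = ∀ K → IsCompleteOn K G → rank M G ≡ rank M K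

Unbounded : GraphMatroidFamily → Set
Unbounded M = ∀ m → ∃[ n ] ∃[ K ] (IsCompleteGraph K n × m < rank M K)

data PathAvoiding (G : Graph) (X : List ℕ) : ℕ → ℕ → Set where
  here : ∀ {u} → InV G u → u ∉ X → PathAvoiding G X u u
  step : ∀ {u w v} → Adj G u w → u ∉ X → PathAvoiding G X w v →
         PathAvoiding G X u v

Connected : ℕ → Graph → Set
Connected c G =
  (∃[ Vs ] (Unique Vs × All (InV G) Vs × c < length Vs)) ×
  (∀ (X : List ℕ) → length X < c → ∀ u v → InV G u → InV G v →
     u ∉ X → v ∉ X → PathAvoiding G X u v)

WhitneyProperty : GraphMatroidFamily → Set
WhitneyProperty M = ∃[ c ] (∀ G → Connected c G → Reconstructible M G)

LovaszYeminiProperty : GraphMatroidFamily → Set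
LovaszYeminiProperty M = ∃[ c ] (∀ G → Connected c G → Rigid M G)

{-# OPTIONS --safe #-}
module Submission where

-- From Whitney to Lovász-Yemini: an edge e joining two vertices of G that G does not span is a
-- coloop of G + e, and so is an edge from G to a new vertex (otherwise K_n would span every larger
-- complete graph).  Hence G + e and G plus a pendant edge have isomorphic matroids.
--
-- From Lovász-Yemini to Whitney: let M(G) ≅ M(H) with G highly connected.  It is enough that G and H
-- have equally many vertices, and that the same holds for G - v: then stars correspond to stars.  H has
-- large minimum degree, so if H is not rigid it has a small separator, hence a highly connected
-- fragment F with small boundary.  If the vertex counts of F and of its counterpart in G agree, then F
-- is reconstructed, and exchanging two inner vertices of F, a symmetry on the H side, is seen to be
-- none on the G side.  So F and its counterpart are again a counterexample, with the roles of the two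
-- graphs exchanged.
--
-- The increments of the rank F n of K_n decrease, from at most c.  When the increment does not change
-- between the sizes involved, deleting vertices of G that meet both sides of the separation lowers
-- r(R) + r(B) - r(E) at each step, R and B being the edge sets of the two sides, while in H this
-- quantity can only change by a bounded amount.  Passing to fragments at most 2c times therefore gives a
-- contradiction.  Nothing is assumed about where the increments become constant: that point is not computable from the family, and the
-- connectivity found depends on c only.

open import Defs
open import Data.Bool using (Bool; true; false)
open import Data.Bool.Properties using () renaming (_≟_ to _≟ᵇ_)
open import Data.Empty using (⊥; ⊥-elim)
open import Data.List using (List; []; _∷_; _++_; map; length; filter; concatMap; deduplicate; cartesianProduct; upTo; take)
open import Data.List.Membership.Propositional using (_∈_; _∉_; find; lose)
open import Data.List.Membership.Propositional.Properties
open import Data.List.Properties using (length-++; length-map; length-filter; length-upTo; length-take; map-id)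
open import Data.List.Relation.Binary.Subset.Propositional using (_⊆_)
open import Data.List.Relation.Unary.All as All using ([]; _∷_)
open import Data.List.Relation.Unary.All.Properties using (all-filter)
open import Data.List.Relation.Unary.AllPairs using ([]; _∷_)
open import Data.List.Relation.Unary.Any using (here; there; any?)
open import Data.List.Relation.Unary.Unique.Propositional using (Unique)
open import Data.List.Relation.Unary.Unique.Propositional.Properties using (filter⁺; upTo⁺; take⁺)
open import Data.Nat using (ℕ; zero; suc; _+_; _*_; _∸_; _⊓_; _≤_; _<_; z≤n; s≤s; _≟_; _<?_; _≤?_)
open import Data.Nat.Properties
open import Data.Nat.Solver using (module +-*-Solver)
open import Data.List.Membership.DecPropositional _≟_ using (_∈?_)
open import Data.List.Relation.Unary.Unique.DecPropositional.Properties _≟_ using (deduplicate-!)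
open import Data.Product using (Σ; ∃-syntax; _×_; _,_; proj₁; proj₂)
open import Data.Product.Properties using (≡-dec)
open import Data.Sum using (_⊎_; inj₁; inj₂; [_,_]′)
open import Function using (_∘_; id; mk⇔; Equivalence)
open import Function.Bundles using (_⇔_)
open import Relation.Binary.PropositionalEquality using (_≡_; _≢_; refl; sym; trans; cong; cong₂; subst; ≢-sym)
open import Relation.Nullary using (¬_; Dec; yes; no; contradiction)
open import Relation.Nullary.Decidable using (_×-dec_; _⊎-dec_; ¬?; does; dec-true; dec-false)
open import Relation.Unary using (Decidable)

-- A matroid isomorphism does not see vertices. It does see ranks, and the rank `F n` is strictly
-- increasing from `n = 1` on, so a rigid graph reveals its number of vertices. This is why
-- everything is reduced to vertex counts. The obstacle is that rigidity is known for one of the two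
-- graphs only, and exchanging their roles changes the size at which the increment of `F` is
-- measured. Hence the claim has two forms, with a lower bound `d` on the increment at the size of
-- the connected graph (`CountsAt`) or at the size of the other one (`CountsBelow`). The other graph
-- is at least as large and increments decrease, so the second form assumes more. A fragment leads
-- from the second form to the first with the same `d`; the excess argument leads from the first
-- form for `suc d` to the second for `d`. Thus each value of `d` costs two passages, and `d` runs
-- from `suc c`, where the assumption is impossible, down to `1`, where every nonempty graph
-- satisfies it.

-- Counting in lists.

module Listing {A : Set} where

  search : {P : A → Set} → Decidable P → (xs : List A) →
           (∃[ x ] (x ∈ xs × P x)) ⊎ (∀ {x} → x ∈ xs → ¬ P x)
  search P? xs with any? P? xs
  ... | yes a = inj₁ (find a)
  ... | no ¬a = inj₂ λ x∈ p → ¬a (lose x∈ p)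

  length-⊆ : {xs ys : List A} → Unique xs → xs ⊆ ys → length xs ≤ length ys
  length-⊆ {[]} u s = z≤n
  length-⊆ {x ∷ xs} (x∉ ∷ u) s with ∈-∃++ (s (here refl))
  ... | as , bs , refl = begin
      suc (length xs)               ≤⟨ s≤s (length-⊆ u s′) ⟩
      suc (length (as ++ bs))       ≡⟨ cong suc (length-++ as) ⟩
      suc (length as + length bs)   ≡⟨ sym (+-suc (length as) (length bs)) ⟩
      length as + suc (length bs)   ≡⟨ sym (length-++ as) ⟩
      length (as ++ x ∷ bs)         ∎
    where
    open ≤-Reasoning
    s′ : xs ⊆ as ++ bs
    s′ {y} y∈ with ∈-++⁻ as (s (there y∈))
    ... | inj₁ p = ∈-++⁺ˡ p
    ... | inj₂ (here refl) = contradiction refl (All.lookup x∉ y∈)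
    ... | inj₂ (there p) = ∈-++⁺ʳ as p

  length-filter-split : {P : A → Set} (P? : Decidable P) (xs : List A) →
    length xs ≡ length (filter P? xs) + length (filter (¬? ∘ P?) xs)
  length-filter-split P? [] = refl
  length-filter-split P? (x ∷ xs) with P? x
  ... | yes _ = cong suc (length-filter-split P? xs)
  ... | no _ = trans (cong suc (length-filter-split P? xs)) (sym (+-suc _ _))

  length-filter-disjoint : {P Q R : A → Set} (P? : Decidable P) (Q? : Decidable Q) (R? : Decidable R) →
    (∀ {x} → P x → Q x → ⊥) → (xs : List A) →
    length (filter R? (filter P? xs)) + length (filter R? (filter Q? xs)) ≤ length (filter R? xs)
  length-filter-disjoint P? Q? R? d [] = z≤n
  length-filter-disjoint P? Q? R? d (x ∷ xs) with P? x | Q? x | R? x in eq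
  ... | yes p | yes q | _ = ⊥-elim (d p q)
  ... | yes p | no q | yes r rewrite eq = s≤s (length-filter-disjoint P? Q? R? d xs)
  ... | yes p | no q | no r rewrite eq = length-filter-disjoint P? Q? R? d xs
  ... | no p | yes q | yes r rewrite eq =
          ≤-trans (≤-reflexive (+-suc _ _)) (s≤s (length-filter-disjoint P? Q? R? d xs))
  ... | no p | yes q | no r rewrite eq = length-filter-disjoint P? Q? R? d xs
  ... | no p | no q | yes r = m≤n⇒m≤1+n (length-filter-disjoint P? Q? R? d xs)
  ... | no p | no q | no r = length-filter-disjoint P? Q? R? d xs

  sumOver : (A → ℕ) → List A → ℕ
  sumOver f [] = 0
  sumOver f (x ∷ xs) = f x + sumOver f xs

  sumOver-+ : (f g h k : A → ℕ) (xs : List A) →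
    (∀ {x} → x ∈ xs → f x + g x ≤ h x + k x) →
    sumOver f xs + sumOver g xs ≤ sumOver h xs + sumOver k xs
  sumOver-+ f g h k [] le = z≤n
  sumOver-+ f g h k (x ∷ xs) le = begin
      (f x + sumOver f xs) + (g x + sumOver g xs) ≡⟨ swap₄ (f x) _ (g x) _ ⟩
      (f x + g x) + (sumOver f xs + sumOver g xs) ≤⟨ +-mono-≤ (le (here refl)) (sumOver-+ f g h k xs (le ∘ there)) ⟩
      (h x + k x) + (sumOver h xs + sumOver k xs) ≡⟨ swap₄ (h x) (k x) _ _ ⟩
      (h x + sumOver h xs) + (k x + sumOver k xs) ∎
    where
    open ≤-Reasoning
    swap₄ : ∀ a b c d → (a + b) + (c + d) ≡ (a + c) + (b + d)
    swap₄ a b c d = trans (+-assoc a b (c + d)) (trans (cong (a +_) (trans (sym (+-assoc b c d))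
      (trans (cong (_+ d) (+-comm b c)) (+-assoc c b d)))) (sym (+-assoc a c (b + d))))

  sumOver-mono : (f g : A → ℕ) (xs : List A) → (∀ {x} → x ∈ xs → f x ≤ g x) →
    sumOver f xs ≤ sumOver g xs
  sumOver-mono f g [] le = z≤n
  sumOver-mono f g (x ∷ xs) le = +-mono-≤ (le (here refl)) (sumOver-mono f g xs (le ∘ there))

  length-concatMap : {B : Set} (h : A → List B) (xs : List A) →
    length (concatMap h xs) ≡ sumOver (length ∘ h) xs
  length-concatMap h [] = refl
  length-concatMap h (x ∷ xs) = trans (length-++ (h x)) (cong (length (h x) +_) (length-concatMap h xs))

  sumOver-filter : {P : A → Set} (P? : Decidable P) (k : ℕ) (f : A → ℕ) (xs : List A) →
    (∀ {x} → P x → f x ≤ k) → (∀ {x} → ¬ P x → f x ≤ 0) →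
    sumOver f xs ≤ k * length (filter P? xs)
  sumOver-filter P? k f [] hp hn = z≤n
  sumOver-filter P? k f (x ∷ xs) hp hn with P? x
  ... | yes p = ≤-trans (+-mono-≤ (hp p) (sumOver-filter P? k f xs hp hn)) (≤-reflexive (sym (*-suc k _)))
  ... | no p = +-mono-≤ (hn p) (sumOver-filter P? k f xs hp hn)

  sumOver-count : {P : A → Set} (P? : Decidable P) (f : A → ℕ) (xs : List A) →
    (∀ {x} → P x → 1 ≤ f x) → length (filter P? xs) ≤ sumOver f xs
  sumOver-count P? f [] h = z≤n
  sumOver-count P? f (x ∷ xs) h with P? x
  ... | yes p = +-mono-≤ (h p) (sumOver-count P? f xs h)
  ... | no p = ≤-trans (sumOver-count P? f xs h) (m≤n+m _ (f x))

  length-filter-∃ : {P : A → Set} (P? : Decidable P) {x : A} {xs : List A} → x ∈ xs → P x →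
    1 ≤ length (filter P? xs)
  length-filter-∃ P? {xs = xs} x∈ p with filter P? xs | ∈-filter⁺ P? x∈ p
  ... | _ ∷ _ | _ = s≤s z≤n

  length-filter-∄ : {P : A → Set} (P? : Decidable P) (xs : List A) → (∀ {x} → x ∈ xs → ¬ P x) →
    length (filter P? xs) ≡ 0
  length-filter-∄ P? xs h with filter P? xs | (λ x → ∈-filter⁻ P? {v = x} {xs = xs})
  ... | [] | _ = refl
  ... | x ∷ _ | k = ⊥-elim (h (proj₁ (k x (here refl))) (proj₂ (k x (here refl))))

open Listing public

fresh : {xs A : List ℕ} → Unique xs → length A < length xs → ∃[ x ] (x ∈ xs × x ∉ A)
fresh {xs} {A} u lt with search (λ x → ¬? (x ∈? A)) xs
... | inj₁ r = r
... | inj₂ none = ⊥-elim (<⇒≱ lt (length-⊆ u λ {x} x∈ → stable x (none x∈)))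
  where
  stable : ∀ x → ¬ ¬ (x ∈ A) → x ∈ A
  stable x nn with x ∈? A
  ... | yes p = p
  ... | no n = ⊥-elim (nn n)

position : List ℕ → ℕ → ℕ
position [] u = 0
position (x ∷ xs) u with u ≟ x
... | yes _ = 0
... | no _ = suc (position xs u)

position-< : ∀ xs {u} → u ∈ xs → position xs u < length xs
position-< (x ∷ xs) {u} u∈ with u ≟ x
... | yes _ = s≤s z≤n
position-< (x ∷ xs) (here p) | no q = contradiction p q
position-< (x ∷ xs) (there u∈) | no q = s≤s (position-< xs u∈)

position-injective : ∀ xs {u v} → u ∈ xs → v ∈ xs → position xs u ≡ position xs v → u ≡ v
position-injective (x ∷ xs) {u} {v} u∈ v∈ eq with u ≟ x | v ≟ x
... | yes p | yes q = trans p (sym q)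
position-injective (x ∷ xs) (here p) v∈ eq | no p′ | no q′ = contradiction p p′
position-injective (x ∷ xs) (there u∈) (here q) eq | no p′ | no q′ = contradiction q q′
position-injective (x ∷ xs) (there u∈) (there v∈) eq | no p′ | no q′ =
  position-injective xs u∈ v∈ (suc-injective eq)

nth : List ℕ → ℕ → ℕ
nth [] i = 0
nth (x ∷ xs) zero = x
nth (x ∷ xs) (suc i) = nth xs i

nth-∈ : ∀ xs {i} → i < length xs → nth xs i ∈ xs
nth-∈ (x ∷ xs) {zero} lt = here refl
nth-∈ (x ∷ xs) {suc i} (s≤s lt) = there (nth-∈ xs lt)

nth-injective : ∀ {xs} → Unique xs → ∀ {i j} → i < length xs → j < length xs → nth xs i ≡ nth xs j → i ≡ j
nth-injective {x ∷ xs} u {zero} {zero} p q eq = refl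
nth-injective {x ∷ xs} (x∉ ∷ u) {zero} {suc j} p (s≤s q) eq = contradiction eq (All.lookup x∉ (nth-∈ xs q))
nth-injective {x ∷ xs} (x∉ ∷ u) {suc i} {zero} (s≤s p) q eq = contradiction (sym eq) (All.lookup x∉ (nth-∈ xs p))
nth-injective {x ∷ xs} (_ ∷ u) {suc i} {suc j} (s≤s p) (s≤s q) eq = cong suc (nth-injective u p q eq)

-- Edges as unordered pairs, and renaming of vertices.

Proper : Edge → Set
Proper e = proj₁ e < proj₂ e

proper? : Decidable Proper
proper? e = proj₁ e <? proj₂ e

_≟ₑ_ : (e f : Edge) → Dec (e ≡ f)
_≟ₑ_ = ≡-dec _≟_ _≟_

open import Data.List.Membership.DecPropositional _≟ₑ_ using () renaming (_∈?_ to _∈ₑ?_) public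

Inc : ℕ → Edge → Set
Inc x e = (proj₁ e ≡ x) ⊎ (proj₂ e ≡ x)

inc? : ∀ x → Decidable (Inc x)
inc? x e = (proj₁ e ≟ x) ⊎-dec (proj₂ e ≟ x)

abstract
  -- Written this way, an edge can be addressed from either end. On the diagonal the result is an
  -- improper pair, which has rank zero under `ρ` below.
  mk : ℕ → ℕ → Edge
  mk a b with a <? b
  ... | yes _ = a , b
  ... | no _ = b , a

  mk-comm : ∀ a b → mk a b ≡ mk b a
  mk-comm a b with a <? b | b <? a
  ... | yes p | yes q = contradiction q (<-asym p)
  ... | yes p | no q = refl
  ... | no p | yes q = refl
  ... | no p | no q with ≤-antisym (≮⇒≥ p) (≮⇒≥ q)
  ... | refl = refl

  mk-Proper : ∀ {a b} → a ≢ b → Proper (mk a b)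
  mk-Proper {a} {b} a≢b with a <? b
  ... | yes p = p
  ... | no p = ≤∧≢⇒< (≮⇒≥ p) (≢-sym a≢b)

  mk-of-Proper : ∀ {e} → Proper e → mk (proj₁ e) (proj₂ e) ≡ e
  mk-of-Proper {a , b} p with a <? b
  ... | yes _ = refl
  ... | no q = contradiction p q

  Inc-mkˡ : ∀ a b → Inc a (mk a b)
  Inc-mkˡ a b with a <? b
  ... | yes _ = inj₁ refl
  ... | no _ = inj₂ refl

  Inc-mk⁻ : ∀ {x} a b → Inc x (mk a b) → (x ≡ a) ⊎ (x ≡ b)
  Inc-mk⁻ a b i with a <? b
  Inc-mk⁻ a b (inj₁ p) | yes _ = inj₁ (sym p)
  Inc-mk⁻ a b (inj₂ p) | yes _ = inj₂ (sym p)
  Inc-mk⁻ a b (inj₁ p) | no _ = inj₂ (sym p)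
  Inc-mk⁻ a b (inj₂ p) | no _ = inj₁ (sym p)

  mk-Joins : ∀ a b → Joins (mk a b) a b
  mk-Joins a b with a <? b
  ... | yes _ = inj₁ refl
  ... | no _ = inj₂ refl

  mk-diag : ∀ {a} → ¬ Proper (mk a a)
  mk-diag {a} p with a <? a
  ... | yes q = <-irrefl refl p
  ... | no q = <-irrefl refl p

Inc-mkʳ : ∀ a b → Inc b (mk a b)
Inc-mkʳ a b = subst (Inc b) (mk-comm b a) (Inc-mkˡ b a)

Proper-mk⁻ : ∀ {a b} → Proper (mk a b) → a ≢ b
Proper-mk⁻ p refl = mk-diag p

Joins⇒mk : ∀ {e a b} → Proper e → Joins e a b → e ≡ mk a b
Joins⇒mk p (inj₁ refl) = sym (mk-of-Proper p)
Joins⇒mk p (inj₂ refl) = trans (sym (mk-of-Proper p)) (mk-comm _ _)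

rename : (ℕ → ℕ) → Edge → Edge
rename σ e = mk (σ (proj₁ e)) (σ (proj₂ e))

rename-Joins : ∀ σ {e a b} → Joins e a b → rename σ e ≡ mk (σ a) (σ b)
rename-Joins σ (inj₁ refl) = refl
rename-Joins σ (inj₂ refl) = mk-comm _ _

rename-mk : ∀ σ a b → rename σ (mk a b) ≡ mk (σ a) (σ b)
rename-mk σ a b = rename-Joins σ (mk-Joins a b)

Inc-rename : ∀ σ {e x} → Inc x e → Inc (σ x) (rename σ e)
Inc-rename σ (inj₁ refl) = Inc-mkˡ _ _
Inc-rename σ (inj₂ refl) = Inc-mkʳ _ _

abstract
  transpose : ℕ → ℕ → ℕ → ℕ
  transpose a b x with x ≟ a | x ≟ b
  ... | yes _ | _ = b
  ... | no _ | yes _ = a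
  ... | no _ | no _ = x

  transpose-ˡ : ∀ a b → transpose a b a ≡ b
  transpose-ˡ a b with a ≟ a | a ≟ b
  ... | yes _ | _ = refl
  ... | no n | _ = contradiction refl n

  transpose-ʳ : ∀ a b → transpose a b b ≡ a
  transpose-ʳ a b with b ≟ a | b ≟ b
  ... | yes p | _ = p
  ... | no _ | yes _ = refl
  ... | no _ | no n = contradiction refl n

  transpose-≢ : ∀ {a b x} → x ≢ a → x ≢ b → transpose a b x ≡ x
  transpose-≢ {a} {b} {x} p q with x ≟ a | x ≟ b
  ... | yes r | _ = contradiction r p
  ... | no _ | yes r = contradiction r q
  ... | no _ | no _ = refl

transpose-involutive : ∀ a b x → transpose a b (transpose a b x) ≡ x
transpose-involutive a b x = go (x ≟ a) (x ≟ b)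
  where
  go : Dec (x ≡ a) → Dec (x ≡ b) → transpose a b (transpose a b x) ≡ x
  go (yes refl) _ = trans (cong (transpose a b) (transpose-ˡ a b)) (transpose-ʳ a b)
  go (no _) (yes refl) = trans (cong (transpose a b) (transpose-ʳ a b)) (transpose-ˡ a b)
  go (no p) (no q) = trans (cong (transpose a b) (transpose-≢ p q)) (transpose-≢ p q)

transpose-injective : ∀ a b {x y} → transpose a b x ≡ transpose a b y → x ≡ y
transpose-injective a b {x} {y} eq =
  trans (sym (transpose-involutive a b x)) (trans (cong (transpose a b) eq) (transpose-involutive a b y))

other-end : ∀ {e x} → Proper e → Inc x e → ∃[ z ] (e ≡ mk x z)
other-end {e} p (inj₁ refl) = proj₂ e , sym (mk-of-Proper p)
other-end {e} p (inj₂ refl) = proj₁ e , trans (sym (mk-of-Proper p)) (mk-comm _ _)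

mk-of-Inc : ∀ {e x y} → Proper e → x ≢ y → Inc x e → Inc y e → e ≡ mk x y
mk-of-Inc {e} {x} {y} p x≢y i j with other-end p i
... | z , refl with Inc-mk⁻ x z j
... | inj₁ q = contradiction (sym q) x≢y
... | inj₂ refl = refl

-- Vertex sets and complete graphs.

Pr : List Edge → Set
Pr X = ∀ {e} → e ∈ X → Proper e

abstract
  V : List Edge → List ℕ
  V X = deduplicate _≟_ (map proj₁ X ++ map proj₂ X)

  V-unique : ∀ X → Unique (V X)
  V-unique X = deduplicate-! _

  ∈V⁺ : ∀ {X e x} → e ∈ X → Inc x e → x ∈ V X
  ∈V⁺ {X} e∈ (inj₁ refl) = ∈-deduplicate⁺ _≟_ (∈-++⁺ˡ (∈-map⁺ proj₁ e∈))
  ∈V⁺ {X} e∈ (inj₂ refl) = ∈-deduplicate⁺ _≟_ (∈-++⁺ʳ (map proj₁ X) (∈-map⁺ proj₂ e∈))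

  ∈V⁻ : ∀ {X x} → x ∈ V X → ∃[ e ] (e ∈ X × Inc x e)
  ∈V⁻ {X} x∈ with ∈-++⁻ (map proj₁ X) (∈-deduplicate⁻ _≟_ _ x∈)
  ... | inj₁ p with ∈-map⁻ proj₁ p
  ... | e , e∈ , eq = e , e∈ , inj₁ (sym eq)
  ∈V⁻ {X} x∈ | inj₂ p with ∈-map⁻ proj₂ p
  ... | e , e∈ , eq = e , e∈ , inj₂ (sym eq)

∈V-mk⁺ : ∀ {X x z} → mk x z ∈ X → x ∈ V X
∈V-mk⁺ {x = x} {z} p = ∈V⁺ p (Inc-mkˡ x z)

∈V-mk⁻ : ∀ {X x} → Pr X → x ∈ V X → ∃[ z ] (mk x z ∈ X)
∈V-mk⁻ {X} pr x∈ with ∈V⁻ {X} x∈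
... | e , e∈ , i with other-end (pr e∈) i
... | z , refl = z , e∈

V-mono : ∀ {X Y} → X ⊆ Y → V X ⊆ V Y
V-mono {X} s x∈ with ∈V⁻ {X} x∈
... | e , e∈ , i = ∈V⁺ (s e∈) i

nv : List Edge → ℕ
nv X = length (V X)

abstract
  K : List ℕ → List Edge
  K U = filter proper? (cartesianProduct U U)

  ∈K⁻ : ∀ {U e} → e ∈ K U → Proper e × proj₁ e ∈ U × proj₂ e ∈ U
  ∈K⁻ {U} e∈ with ∈-filter⁻ proper? e∈
  ... | p , q with ∈-cartesianProduct⁻ U U p
  ... | r , s = q , r , s

  ∈K-end : ∀ {U e} → Proper e → proj₁ e ∈ U → proj₂ e ∈ U → e ∈ K U
  ∈K-end p a b = ∈-filter⁺ proper? (∈-cartesianProduct⁺ a b) p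

K-Pr : ∀ U → Pr (K U)
K-Pr U e∈ = proj₁ (∈K⁻ {U} e∈)

K-Inc : ∀ {U e x} → e ∈ K U → Inc x e → x ∈ U
K-Inc e∈ (inj₁ refl) = proj₁ (proj₂ (∈K⁻ e∈))
K-Inc e∈ (inj₂ refl) = proj₂ (proj₂ (∈K⁻ e∈))

K-mono : ∀ {U W} → U ⊆ W → K U ⊆ K W
K-mono s e∈ with ∈K⁻ e∈
... | p , a , b = ∈K-end p (s a) (s b)

∈K-of-Inc : ∀ {U e} → Proper e → (∀ {x} → Inc x e → x ∈ U) → e ∈ K U
∈K-of-Inc p h = ∈K-end p (h (inj₁ refl)) (h (inj₂ refl))

∈K⁺ : ∀ {U u v} → u ∈ U → v ∈ U → u ≢ v → mk u v ∈ K U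
∈K⁺ {U} {u} {v} a b ne = ∈K-of-Inc (mk-Proper ne) λ i →
  [ (λ p → subst (_∈ U) (sym p) a) , (λ p → subst (_∈ U) (sym p) b) ]′ (Inc-mk⁻ u v i)

⊆K-V : ∀ {X} → Pr X → X ⊆ K (V X)
⊆K-V pr e∈ = ∈K-of-Inc (pr e∈) (∈V⁺ e∈)

∈K⇒mk : ∀ {U e} → e ∈ K U → ∃[ u ] ∃[ v ] (u ∈ U × v ∈ U × u ≢ v × e ≡ mk u v)
∈K⇒mk e∈ with ∈K⁻ e∈
... | p , a , b = _ , _ , a , b , <⇒≢ p , sym (mk-of-Proper p)

-- One rank function for all edge lists, and its closure.

module Rank (M : GraphMatroidFamily) where

  open IsMatroidRank

  properPart : List Edge → Graph
  properPart X = mkGraph (filter proper? X) (all-filter proper? X)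

  E-proper : ∀ G → Pr (E G)
  E-proper G = All.lookup (simple G)

  abstract

    -- Improper pairs count as loops, so ρ is total on lists.
    ρ : List Edge → ℕ
    ρ X = rk M (properPart X) (E (properPart X))

    rk≡ρ : ∀ G {X} → X ⊆ E G → rk M G X ≡ ρ X
    rk≡ρ G {X} s = trans
      (ext (matroid M G) X Y s Y⊆G (λ e∈ → ∈-filter⁺ proper? e∈ (E-proper G (s e∈))) Y⊆X)
      (sym (restrict M G (properPart X) Y⊆G Y id))
      where
      Y : List Edge
      Y = filter proper? X
      Y⊆X : Y ⊆ X
      Y⊆X e∈ = proj₁ (∈-filter⁻ proper? {xs = X} e∈)
      Y⊆G : Y ⊆ E G
      Y⊆G = s ∘ Y⊆X

    ρ-mono : ∀ {X Y} → X ⊆ Y → ρ X ≤ ρ Y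
    ρ-mono {X} {Y} s = ≤-trans (≤-reflexive (restrict M (properPart Y) (properPart X) s′ (filter proper? X) id))
      (mono (matroid M (properPart Y)) (filter proper? X) (filter proper? Y) id s′)
      where
      s′ : filter proper? X ⊆ filter proper? Y
      s′ e∈ with ∈-filter⁻ proper? {xs = X} e∈
      ... | p , q = ∈-filter⁺ proper? {xs = Y} (s p) q

    ρ-bound : ∀ X → ρ X ≤ length X
    ρ-bound X = ≤-trans (bound (matroid M (properPart X)) (filter proper? X) id) (length-filter proper? X)

    -- Inclusions in place of equations: monotonicity absorbs the difference, so `U` and `I` can be
    -- whatever lists are at hand.
    ρ-submod : ∀ {X Y U I} → (∀ {e} → e ∈ U → e ∈ X ⊎ e ∈ Y) → I ⊆ X → I ⊆ Y →
               ρ U + ρ I ≤ ρ X + ρ Y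
    ρ-submod {X} {Y} {U} {I} u ix iy = begin
        ρ U + ρ I       ≤⟨ +-mono-≤ U≤ I≤ ⟩
        rk M G (X′ ++ Y′) + rk M G (filter (_∈ₑ? Y′) X′)
                        ≤⟨ submod (matroid M G) X′ Y′ (X′ ++ Y′) (filter (_∈ₑ? Y′) X′) X′⊆ Y′⊆ cup cap ⟩
        rk M G X′ + rk M G Y′
                        ≡⟨ cong₂ _+_ (sym (restrict M G (properPart X) X′⊆ X′ id))
                                     (sym (restrict M G (properPart Y) Y′⊆ Y′ id)) ⟩
        ρ X + ρ Y       ∎
      where
      open ≤-Reasoning
      G : Graph
      G = properPart (X ++ Y)
      X′ Y′ : List Edge
      X′ = filter proper? X
      Y′ = filter proper? Y
      X′⊆ : X′ ⊆ E G
      X′⊆ e∈ with ∈-filter⁻ proper? {xs = X} e∈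
      ... | p , q = ∈-filter⁺ proper? {xs = X ++ Y} (∈-++⁺ˡ p) q
      Y′⊆ : Y′ ⊆ E G
      Y′⊆ e∈ with ∈-filter⁻ proper? {xs = Y} e∈
      ... | p , q = ∈-filter⁺ proper? {xs = X ++ Y} (∈-++⁺ʳ X p) q
      cup : ∀ e → (e ∈ X′ ++ Y′) ⇔ ((e ∈ X′) ⊎ (e ∈ Y′))
      cup e = mk⇔ (∈-++⁻ X′) [ ∈-++⁺ˡ , ∈-++⁺ʳ X′ ]′
      cap : ∀ e → (e ∈ filter (_∈ₑ? Y′) X′) ⇔ ((e ∈ X′) × (e ∈ Y′))
      cap e = mk⇔ (∈-filter⁻ (_∈ₑ? Y′) {xs = X′}) (λ (p , q) → ∈-filter⁺ (_∈ₑ? Y′) {xs = X′} p q)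
      sub : ∀ Z W → W ⊆ E G → filter proper? Z ⊆ W → ρ Z ≤ rk M G W
      sub Z W wg s = ≤-trans (≤-reflexive (restrict M G (properPart Z) (wg ∘ s) (filter proper? Z) id))
        (mono (matroid M G) (filter proper? Z) W wg s)
      U≤ : ρ U ≤ rk M G (X′ ++ Y′)
      U≤ = sub U (X′ ++ Y′) ([ X′⊆ , Y′⊆ ]′ ∘ ∈-++⁻ X′) λ e∈ → let (p , q) = ∈-filter⁻ proper? {xs = U} e∈ in
        [ (λ r → ∈-++⁺ˡ (∈-filter⁺ proper? {xs = X} r q)) , (λ r → ∈-++⁺ʳ X′ (∈-filter⁺ proper? {xs = Y} r q)) ]′ (u p)
      I≤ : ρ I ≤ rk M G (filter (_∈ₑ? Y′) X′)
      I≤ = sub I (filter (_∈ₑ? Y′) X′) (X′⊆ ∘ proj₁ ∘ ∈-filter⁻ (_∈ₑ? Y′) {xs = X′}) λ e∈ → let (p , q) = ∈-filter⁻ proper? {xs = I} e∈ in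
        ∈-filter⁺ (_∈ₑ? Y′) {xs = X′} (∈-filter⁺ proper? {xs = X} (ix p) q) (∈-filter⁺ proper? {xs = Y} (iy p) q)

  ρ-cong : ∀ {X Y} → X ⊆ Y → Y ⊆ X → ρ X ≡ ρ Y
  ρ-cong s t = ≤-antisym (ρ-mono s) (ρ-mono t)

  -- Injectivity is asked on the vertices of `X` only, because `position` and `nth`, which identify
  -- a vertex list with an initial segment, are injective only there.
  ρ-rename : ∀ {σ X} → Pr X → (∀ {u v} → u ∈ V X → v ∈ V X → σ u ≡ σ v → u ≡ v) →
             ρ (map (rename σ) X) ≡ ρ X
  ρ-rename {σ} {X} pr inj = trans (sym (rk≡ρ H X′⊆H))
    (trans (iso-inv M G H σ (rename σ) iso induced X id) (rk≡ρ G id))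
    where
    G = mkGraph X (All.tabulate pr)
    X′ = map (rename σ) X
    H = properPart X′
    rename-Proper : ∀ {e} → e ∈ X → Proper (rename σ e)
    rename-Proper e∈ = mk-Proper λ eq →
      <⇒≢ (pr e∈) (inj (∈V⁺ e∈ (inj₁ refl)) (∈V⁺ e∈ (inj₂ refl)) eq)
    X′⊆H : X′ ⊆ E H
    X′⊆H e∈ with ∈-map⁻ (rename σ) e∈
    ... | f , f∈ , refl = ∈-filter⁺ proper? {xs = X′} e∈ (rename-Proper f∈)
    E-H : ∀ {e} → e ∈ E H → ∃[ f ] (f ∈ X × e ≡ rename σ f)
    E-H e∈ = ∈-map⁻ (rename σ) (proj₁ (∈-filter⁻ proper? {xs = X′} e∈))
    E⇒H : ∀ {f} → f ∈ X → rename σ f ∈ E H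
    E⇒H f∈ = X′⊆H (∈-map⁺ (rename σ) f∈)
    induced : InducedBy G σ (rename σ)
    induced e e∈ = mk-Joins _ _
    iso : IsGraphIso G H σ
    iso = record
      { maps-into = λ u (e , e∈ , i) → rename σ e , E⇒H e∈ , Inc-rename σ i
      ; injective = λ u v (e , e∈ , i) (f , f∈ , j) → inj (∈V⁺ e∈ i) (∈V⁺ f∈ j)
      ; onto = λ w (e , e∈ , i) → onto′ w e e∈ i
      ; adj = λ u v p q → mk⇔ (to u v) (from u v p q) }
      where
      onto′ : ∀ w e → e ∈ E H → Inc w e → ∃[ u ] (InV G u × σ u ≡ w)
      onto′ w e e∈ i with E-H e∈
      ... | f , f∈ , refl with Inc-mk⁻ _ _ i
      ... | inj₁ refl = proj₁ f , (f , f∈ , inj₁ refl) , refl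
      ... | inj₂ refl = proj₂ f , (f , f∈ , inj₂ refl) , refl
      to : ∀ u v → Adj G u v → Adj H (σ u) (σ v)
      to u v (e , e∈ , j) = rename σ e , E⇒H e∈ ,
        subst (λ x → Joins x (σ u) (σ v)) (sym (rename-Joins σ j)) (mk-Joins _ _)
      from : ∀ u v → InV G u → InV G v → Adj H (σ u) (σ v) → Adj G u v
      from u v (a , a∈ , ia) (b , b∈ , ib) (e , e∈ , j) with E-H e∈
      ... | f , f∈ , refl = f , f∈ , ends (incs (inj₁ refl)) (incs (inj₂ refl)) (pr f∈)
        where
        incs : ∀ {x} → Inc x f → (x ≡ u) ⊎ (x ≡ v)
        incs {x} i = [ (λ p → inj₁ (inj (∈V⁺ f∈ i) (∈V⁺ a∈ ia) p))
                     , (λ p → inj₂ (inj (∈V⁺ f∈ i) (∈V⁺ b∈ ib) p)) ]′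
          (Inc-mk⁻ _ _ (subst (Inc (σ x)) (Joins⇒mk (rename-Proper f∈) j) (Inc-rename σ i)))
        ends : ∀ {f₁ f₂} → (f₁ ≡ u) ⊎ (f₁ ≡ v) → (f₂ ≡ u) ⊎ (f₂ ≡ v) → f₁ < f₂ → Joins (f₁ , f₂) u v
        ends (inj₁ refl) (inj₂ refl) _ = inj₁ refl
        ends (inj₂ refl) (inj₁ refl) _ = inj₂ refl
        ends (inj₁ refl) (inj₁ refl) lt = ⊥-elim (<-irrefl refl lt)
        ends (inj₂ refl) (inj₂ refl) lt = ⊥-elim (<-irrefl refl lt)

  infix 4 _∈cl_
  _∈cl_ : Edge → List Edge → Set
  e ∈cl Z = ρ (e ∷ Z) ≤ ρ Z

  -- Submodularity for `e ∷ Z` and `W`, whose intersection contains `Z`.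
  ∈cl-mono : ∀ {e Z W} → Z ⊆ W → e ∈cl Z → e ∈cl W
  ∈cl-mono {e} {Z} {W} s h = +-cancelʳ-≤ (ρ Z) _ _ (begin
    ρ (e ∷ W) + ρ Z ≤⟨ ρ-submod {X = e ∷ Z} {Y = W}
                         (λ { (here p) → inj₁ (here p) ; (there p) → inj₂ p }) there s ⟩
    ρ (e ∷ Z) + ρ W ≤⟨ +-monoˡ-≤ (ρ W) h ⟩
    ρ Z + ρ W       ≡⟨ +-comm (ρ Z) (ρ W) ⟩
    ρ W + ρ Z       ∎)
    where open ≤-Reasoning

  ∈cl-∈ : ∀ {e Z} → e ∈ Z → e ∈cl Z
  ∈cl-∈ e∈ = ρ-mono λ { (here refl) → e∈ ; (there p) → p }

  ρ-cl-++ : ∀ W {Z} → (∀ {e} → e ∈ W → e ∈cl Z) → ρ (W ++ Z) ≤ ρ Z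
  ρ-cl-++ [] h = ≤-refl
  ρ-cl-++ (e ∷ W) h = ≤-trans (∈cl-mono (∈-++⁺ʳ W) (h (here refl))) (ρ-cl-++ W (h ∘ there))

  ρ-cl : ∀ {W Z} → (∀ {e} → e ∈ W → e ∈cl Z) → ρ W ≤ ρ Z
  ρ-cl {W} h = ≤-trans (ρ-mono ∈-++⁺ˡ) (ρ-cl-++ W h)

  ∈cl-trans : ∀ {e W Z} → (∀ {f} → f ∈ W → f ∈cl Z) → e ∈cl W → e ∈cl Z
  ∈cl-trans {e} {W} {Z} h p = begin
    ρ (e ∷ Z)         ≤⟨ ρ-mono (λ { (here q) → here q ; (there q) → there (∈-++⁺ʳ W q) }) ⟩
    ρ (e ∷ W ++ Z)    ≤⟨ ∈cl-mono ∈-++⁺ˡ p ⟩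
    ρ (W ++ Z)        ≤⟨ ρ-cl-++ W h ⟩
    ρ Z               ∎
    where open ≤-Reasoning

  ρ-∷-≤ : ∀ e Z → ρ (e ∷ Z) ≤ suc (ρ Z)
  ρ-∷-≤ e Z = begin
    ρ (e ∷ Z)             ≤⟨ m≤m+n _ _ ⟩
    ρ (e ∷ Z) + ρ []      ≤⟨ ρ-submod {X = e ∷ []} {Y = Z}
                               (λ { (here p) → inj₁ (here p) ; (there p) → inj₂ p }) (λ ()) (λ ()) ⟩
    ρ (e ∷ []) + ρ Z      ≤⟨ +-monoˡ-≤ (ρ Z) (ρ-bound (e ∷ [])) ⟩
    suc (ρ Z)             ∎
    where open ≤-Reasoning

  ρ-++-≤ : ∀ L Z → ρ (L ++ Z) ≤ length L + ρ Z
  ρ-++-≤ [] Z = ≤-refl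
  ρ-++-≤ (e ∷ L) Z = ≤-trans (ρ-∷-≤ e (L ++ Z)) (s≤s (ρ-++-≤ L Z))

  ∈cl-rename : ∀ {σ e Z} → (∀ {u v} → σ u ≡ σ v → u ≡ v) → Proper e → Pr Z →
               e ∈cl Z → rename σ e ∈cl map (rename σ) Z
  ∈cl-rename {σ} {e} {Z} inj pe pz h = begin
    ρ (map (rename σ) (e ∷ Z))  ≡⟨ ρ-rename (λ { (here refl) → pe ; (there p) → pz p }) (λ _ _ → inj) ⟩
    ρ (e ∷ Z)                   ≤⟨ h ⟩
    ρ Z                         ≡⟨ sym (ρ-rename pz (λ _ _ → inj)) ⟩
    ρ (map (rename σ) Z)        ∎
    where open ≤-Reasoning

  Spans : List Edge → List ℕ → Set
  Spans Z U = ∀ {u v} → u ∈ U → v ∈ U → u ≢ v → mk u v ∈cl Z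

  Spans-K : ∀ {Z U e} → Spans Z U → e ∈ K U → e ∈cl Z
  Spans-K {Z} s e∈ with ∈K⇒mk e∈
  ... | u , v , a , b , ne , refl = s a b ne

  Spans⇒ρ : ∀ {Z U} → Spans Z U → ρ (K U) ≤ ρ Z
  Spans⇒ρ {Z} {U} s = ρ-cl (Spans-K {Z} {U} s)

  K-image : ∀ {σ U W} → (∀ {u v} → u ∈ U → v ∈ U → σ u ≡ σ v → u ≡ v) →
            (∀ {u} → u ∈ U → σ u ∈ W) → ρ (K U) ≤ ρ (K W)
  K-image {σ} {U} {W} inj into = begin
    ρ (K U)                  ≡⟨ sym (ρ-rename (K-Pr U) (λ a b → inj (sub a) (sub b))) ⟩
    ρ (map (rename σ) (K U)) ≤⟨ ρ-mono image ⟩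
    ρ (K W)                  ∎
    where
    open ≤-Reasoning
    sub : V (K U) ⊆ U
    sub x∈ with ∈V⁻ {K U} x∈
    ... | e , e∈ , i = K-Inc e∈ i
    image : map (rename σ) (K U) ⊆ K W
    image e∈ with ∈-map⁻ (rename σ) e∈
    ... | f , f∈ , refl with ∈K⁻ f∈
    ... | p , a , b = ∈K⁺ (into a) (into b) (λ eq → <⇒≢ p (inj a b eq))

  F : ℕ → ℕ
  F n = ρ (K (upTo n))

  -- Repetitions in `U` only enlarge the right side; the converse `F≤K` has to exclude them.
  K≤F : ∀ U → ρ (K U) ≤ F (length U)
  K≤F U = K-image (position-injective U) (λ u∈ → ∈-upTo⁺ (position-< U u∈))

  F≤K : ∀ {U} → Unique U → F (length U) ≤ ρ (K U)
  F≤K {U} u = K-image (λ a b → nth-injective u (∈-upTo⁻ a) (∈-upTo⁻ b)) (λ a → nth-∈ U (∈-upTo⁻ a))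

  F-mono : ∀ {m n} → m ≤ n → F m ≤ F n
  F-mono h = ρ-mono (K-mono λ x∈ → ∈-upTo⁺ (≤-trans (∈-upTo⁻ x∈) h))

  ρ≤F : ∀ {X} → Pr X → ρ X ≤ F (nv X)
  ρ≤F {X} pr = ≤-trans (ρ-mono (⊆K-V pr)) (K≤F (V X))

  Spans⇒F : ∀ {X} → Pr X → Spans X (V X) → ρ X ≡ F (nv X)
  Spans⇒F {X} pr s = ≤-antisym (ρ≤F pr) (≤-trans (F≤K (V-unique X)) (Spans⇒ρ {X} {V X} s))

-- Pendant edges are coloops; from Whitney to Lovász-Yemini.

module NewVertex (M : GraphMatroidFamily) (unb : Unbounded M) where

  open Rank M

  -- A single such edge would put every edge into the closure of K U, by symmetry.
  pendant∉cl-K : ∀ {U x u} → u ∈ U → x ∉ U → ¬ (mk x u ∈cl K U)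
  pendant∉cl-K {U} {x} {u} u∈ x∉ h with unb (ρ (K U))
  ... | n , G , _ , lt = <⇒≱ lt (≤-trans (≤-reflexive (rk≡ρ G id)) (ρ-cl (λ e∈ → all (E-proper G e∈))))
    where
    ≢∉ : ∀ {a b} → a ∈ U → b ∉ U → a ≢ b
    ≢∉ a∈ b∉ refl = b∉ a∈

    fixed : ∀ {σ} → (∀ {w} → w ∈ U → σ w ∈ U) → (∀ {w z} → σ w ≡ σ z → w ≡ z) →
            map (rename σ) (K U) ⊆ K U
    fixed {σ} into inj e∈ with ∈-map⁻ (rename σ) e∈
    ... | f , f∈ , refl with ∈K⁻ {U} f∈
    ... | p , a , b = ∈K⁺ (into a) (into b) (λ eq → <⇒≢ p (inj eq))

    move : ∀ a b {y w} → y ≢ w → mk y w ∈cl K U →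
           mk (transpose a b y) (transpose a b w) ∈cl map (rename (transpose a b)) (K U)
    move a b {y} {w} ne p = subst (_∈cl map (rename (transpose a b)) (K U)) (rename-mk (transpose a b) y w)
      (∈cl-rename (transpose-injective a b) (mk-Proper ne) (K-Pr U) p)

    step₁ : ∀ {w} → w ∈ U → mk x w ∈cl K U
    step₁ {w} w∈ = ∈cl-mono (fixed into (transpose-injective u w))
      (subst (_∈cl map (rename (transpose u w)) (K U))
        (cong₂ mk (transpose-≢ (≢-sym (≢∉ u∈ x∉)) (≢-sym (≢∉ w∈ x∉))) (transpose-ˡ u w))
        (move u w (≢-sym (≢∉ u∈ x∉)) h))
      where
      into : ∀ {z} → z ∈ U → transpose u w z ∈ U
      into {z} z∈ with z ≟ u | z ≟ w
      ... | yes refl | _ = subst (_∈ U) (sym (transpose-ˡ z w)) w∈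
      ... | no _ | yes refl = subst (_∈ U) (sym (transpose-ʳ u z)) u∈
      ... | no p | no q = subst (_∈ U) (sym (transpose-≢ p q)) z∈

    step₂ : ∀ {y w} → y ∉ U → w ∈ U → mk y w ∈cl K U
    step₂ {y} {w} y∉ w∈ = ∈cl-mono (fixed into (transpose-injective x y))
      (subst (_∈cl map (rename (transpose x y)) (K U))
        (cong₂ mk (transpose-ˡ x y) (transpose-≢ (≢∉ w∈ x∉) (≢∉ w∈ y∉)))
        (move x y (≢-sym (≢∉ w∈ x∉)) (step₁ w∈)))
      where
      into : ∀ {z} → z ∈ U → transpose x y z ∈ U
      into z∈ = subst (_∈ U) (sym (transpose-≢ (≢∉ z∈ x∉) (≢∉ z∈ y∉))) z∈

    -- Exchanging `u` and `z` carries the edge `y u` to `y z` but does not preserve `K U`: its edges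
    -- at `u` move to `z`. Those are spanned by `step₂`.
    step₃ : ∀ {y z} → y ∉ U → z ∉ U → y ≢ z → mk y z ∈cl K U
    step₃ {y} {z} y∉ z∉ ne = ∈cl-trans back
      (subst (_∈cl map (rename (transpose u z)) (K U))
        (cong₂ mk (transpose-≢ (≢-sym (≢∉ u∈ y∉)) ne) (transpose-ˡ u z))
        (move u z (≢-sym (≢∉ u∈ y∉)) (step₂ y∉ u∈)))
      where
      back : ∀ {f} → f ∈ map (rename (transpose u z)) (K U) → f ∈cl K U
      back f∈ with ∈-map⁻ (rename (transpose u z)) f∈
      ... | g , g∈ , refl with ∈K⇒mk {U} g∈
      ... | p , q , p∈ , q∈ , p≢q , refl = subst (_∈cl K U) (sym (rename-mk (transpose u z) p q)) (go (p ≟ u) (q ≟ u))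
        where
        t = transpose u z
        go : Dec (p ≡ u) → Dec (q ≡ u) → mk (t p) (t q) ∈cl K U
        go (yes refl) (yes refl) = contradiction refl p≢q
        go (yes refl) (no q≢u) = subst (_∈cl K U)
          (sym (cong₂ mk (transpose-ˡ u z) (transpose-≢ q≢u (≢∉ q∈ z∉)))) (step₂ z∉ q∈)
        go (no p≢u) (yes refl) = subst (_∈cl K U)
          (trans (mk-comm z p) (sym (cong₂ mk (transpose-≢ p≢u (≢∉ p∈ z∉)) (transpose-ˡ u z)))) (step₂ z∉ p∈)
        go (no p≢u) (no q≢u) = subst (_∈cl K U)
          (sym (cong₂ mk (transpose-≢ p≢u (≢∉ p∈ z∉)) (transpose-≢ q≢u (≢∉ q∈ z∉)))) (∈cl-∈ g∈)

    all : ∀ {e} → Proper e → e ∈cl K U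
    all {e} pe = subst (_∈cl K U) (mk-of-Proper pe) (go (<⇒≢ pe) (proj₁ e ∈? U) (proj₂ e ∈? U))
      where
      go : ∀ {p q} → p ≢ q → Dec (p ∈ U) → Dec (q ∈ U) → mk p q ∈cl K U
      go ne (yes a) (yes b) = ∈cl-∈ (∈K⁺ a b ne)
      go ne (no a) (yes b) = step₂ a b
      go {p} {q} ne (yes a) (no b) = subst (_∈cl K U) (mk-comm q p) (step₂ b a)
      go ne (no a) (no b) = step₃ a b ne

  pendant∉cl : ∀ {Z x u} → Pr Z → x ∉ V Z → x ≢ u → ¬ (mk x u ∈cl Z)
  pendant∉cl {Z} {x} {u} pz x∉ x≢u h = pendant∉cl-K {u ∷ V Z} (here refl)
    (λ { (here p) → x≢u p ; (there p) → x∉ p }) (∈cl-mono (K-mono there ∘ ⊆K-V pz) h)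

  pendant-ρ : ∀ {Z x u} → Pr Z → x ∉ V Z → x ≢ u → suc (ρ Z) ≤ ρ (mk x u ∷ Z)
  pendant-ρ pz x∉ x≢u = ≰⇒> (pendant∉cl pz x∉ x≢u)

  F-< : ∀ n → F (suc n) < F (suc (suc n))
  F-< n = ≤-trans (pendant-ρ (K-Pr (upTo (suc n))) x∉ (λ ())) (ρ-mono sub)
    where
    x∉ : suc n ∉ V (K (upTo (suc n)))
    x∉ x∈ with ∈V⁻ {K (upTo (suc n))} x∈
    ... | e , e∈ , i = <-irrefl refl (∈-upTo⁻ (K-Inc e∈ i))
    sub : mk (suc n) 0 ∷ K (upTo (suc n)) ⊆ K (upTo (suc (suc n)))
    sub (here refl) = ∈K⁺ (∈-upTo⁺ ≤-refl) (∈-upTo⁺ (s≤s z≤n)) λ ()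
    sub (there p) = K-mono {upTo (suc n)} (λ q → ∈-upTo⁺ (m≤n⇒m≤1+n (∈-upTo⁻ q))) p

  F-cancel-≤ : ∀ {m n} → 1 ≤ n → F m ≤ F n → m ≤ n
  F-cancel-≤ {m} {suc n} _ le with m ≤? suc n
  ... | yes p = p
  ... | no p = ⊥-elim (<⇒≱ (F-< n) (≤-trans (F-mono (≰⇒> p)) le))

  F-injective : ∀ {m n} → 1 ≤ m → 1 ≤ n → F m ≡ F n → m ≡ n
  F-injective hm hn eq = ≤-antisym (F-cancel-≤ hn (≤-reflexive eq)) (F-cancel-≤ hm (≤-reflexive (sym eq)))

  outside : ∀ X → ∃[ x ] (x ∉ V X)
  outside X with fresh {upTo (suc (nv X))} {V X} (upTo⁺ _) (≤-reflexive (sym (length-upTo (suc (nv X)))))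
  ... | x , _ , x∉ = x , x∉

  -- If e is not spanned by G, then G + e and G plus a pendant edge have isomorphic matroids.
  reconstructible⇒∈cl : ∀ G {e} → Proper e → (∀ {x} → Inc x e → x ∈ V (E G)) →
    (∀ H → E H ≡ e ∷ E G → Reconstructible M H) → e ∈cl E G
  reconstructible⇒∈cl G {e} pe ends rec with ρ (e ∷ E G) ≤? ρ (E G)
  ... | yes p = p
  ... | no e∉cl with outside (E G)
  ... | x , x∉ = ⊥-elim absurd
    where
    u = proj₁ e
    x≢u : x ≢ u
    x≢u refl = x∉ (ends (inj₁ refl))
    e′ = mk x u
    e∉ : e ∉ E G
    e∉ e∈ = e∉cl (∈cl-∈ e∈)
    e′∉ : e′ ∉ E G
    e′∉ e∈ = x∉ (∈V-mk⁺ e∈)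
    G⁺ H⁺ : Graph
    G⁺ = mkGraph (e ∷ E G) (pe ∷ simple G)
    H⁺ = mkGraph (e′ ∷ E G) (mk-Proper x≢u ∷ simple G)
    ψ : Edge → Edge
    ψ f with f ≟ₑ e
    ... | yes _ = e′
    ... | no _ = f
    ψ-e : ψ e ≡ e′
    ψ-e with e ≟ₑ e
    ... | yes _ = refl
    ... | no q = contradiction refl q
    ψ-≢ : ∀ {f} → f ≢ e → ψ f ≡ f
    ψ-≢ {f} q with f ≟ₑ e
    ... | yes p = contradiction p q
    ... | no _ = refl
    ∈G⇒≢ : ∀ {f} → f ∈ E G → f ≢ e
    ∈G⇒≢ f∈ refl = e∉ f∈
    ψ-G : ∀ {f} → f ∈ E G → ψ f ≡ f
    ψ-G = ψ-≢ ∘ ∈G⇒≢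
    into : ∀ f → f ∈ E G⁺ → ψ f ∈ E H⁺
    into f (here refl) = here ψ-e
    into f (there f∈) = there (subst (_∈ E G) (sym (ψ-G f∈)) f∈)
    inj : ∀ f g → f ∈ E G⁺ → g ∈ E G⁺ → ψ f ≡ ψ g → f ≡ g
    inj f g (here refl) (here refl) eq = refl
    inj f g (here refl) (there g∈) eq =
      contradiction (subst (_∈ E G) (trans (sym (ψ-G g∈)) (trans (sym eq) ψ-e)) g∈) e′∉
    inj f g (there f∈) (here refl) eq =
      contradiction (subst (_∈ E G) (trans (sym (ψ-G f∈)) (trans eq ψ-e)) f∈) e′∉
    inj f g (there f∈) (there g∈) eq = trans (sym (ψ-G f∈)) (trans eq (ψ-G g∈))
    onto : ∀ f → f ∈ E H⁺ → ∃[ g ] (g ∈ E G⁺ × ψ g ≡ f)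
    onto f (here refl) = e , here refl , ψ-e
    onto f (there f∈) = f , there f∈ , ψ-G f∈
    ρ-pres : ∀ X → X ⊆ E G⁺ → ρ (map ψ X) ≡ ρ X
    ρ-pres X X⊆ with e ∈ₑ? X
    ... | no e∉X = ρ-cong (λ f∈ → let (g , g∈ , eq) = ∈-map⁻ ψ f∈ in
                                  subst (_∈ X) (sym (trans eq (ψ-≢ λ g≡e → e∉X (subst (_∈ X) g≡e g∈)))) g∈)
                          (λ {f} f∈ → subst (_∈ map ψ X) (ψ-≢ λ f≡e → e∉X (subst (_∈ X) f≡e f∈)) (∈-map⁺ ψ f∈))
    -- `e` and `e′` are both coloops, so either side has rank one more than the common rest `X₀`.
    ... | yes e∈X = trans left (sym right)
      where
      ≢e? : Decidable (λ f → f ≢ e)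
      ≢e? f = ¬? (f ≟ₑ e)
      X₀ = filter ≢e? X
      X₀⊆ : X₀ ⊆ E G
      X₀⊆ f∈ with ∈-filter⁻ ≢e? {xs = X} f∈
      ... | p , q with X⊆ p
      ... | here r = contradiction r q
      ... | there r = r
      right : ρ X ≡ suc (ρ X₀)
      right = trans (ρ-cong split (λ { (here refl) → e∈X ; (there p) → proj₁ (∈-filter⁻ ≢e? {xs = X} p) }))
        (≤-antisym (ρ-∷-≤ e X₀) (≰⇒> λ h → e∉cl (∈cl-mono X₀⊆ h)))
        where
        split : X ⊆ e ∷ X₀
        split {f} f∈ with f ≟ₑ e
        ... | yes p = here p
        ... | no p = there (∈-filter⁺ ≢e? {xs = X} f∈ p)
      left : ρ (map ψ X) ≡ suc (ρ X₀)
      left = trans (ρ-cong to from)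
        (≤-antisym (ρ-∷-≤ e′ X₀) (pendant-ρ (E-proper G ∘ X₀⊆) (x∉ ∘ V-mono X₀⊆) x≢u))
        where
        to : map ψ X ⊆ e′ ∷ X₀
        to f∈ with ∈-map⁻ ψ f∈
        ... | g , g∈ , refl with g ≟ₑ e
        ... | yes p = here refl
        ... | no p = there (∈-filter⁺ ≢e? {xs = X} g∈ p)
        from : e′ ∷ X₀ ⊆ map ψ X
        from (here refl) = subst (_∈ map ψ X) ψ-e (∈-map⁺ ψ e∈X)
        from (there p) with ∈-filter⁻ ≢e? {xs = X} p
        ... | a , b = subst (_∈ map ψ X) (ψ-≢ b) (∈-map⁺ ψ a)
    iso : IsMatroidIso M G⁺ H⁺ ψ
    iso = record
      { maps-into = into ; injective = inj ; onto = onto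
      ; rank-pres = λ X s → trans (rk≡ρ H⁺ (λ f∈ → let (g , g∈ , eq) = ∈-map⁻ ψ f∈ in
                                  subst (_∈ E H⁺) (sym eq) (into g (s g∈))))
                                  (trans (ρ-pres X s) (sym (rk≡ρ G⁺ s))) }
    absurd : ⊥
    -- The new vertex `x` is the image of some `a`. Since `a` already lies on an edge of `G`, and
    -- `ψ` fixes that edge, the edge would have to contain `x`.
    absurd with rec G⁺ refl H⁺ ψ iso
    ... | φ , φ-iso , ind with IsGraphIso.onto φ-iso x (e′ , here refl , Inc-mkˡ x u)
    ... | a , (f , f∈ , i) , refl with inG f f∈ i
      where
      inG : ∀ f → f ∈ E G⁺ → Inc a f → a ∈ V (E G)
      inG f (here refl) i = ends i
      inG f (there f∈) i = ∈V⁺ f∈ i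
    ... | a∈ with ∈V⁻ {E G} a∈
    ... | g , g∈ , j = x∉ (∈V⁺ g∈ (subst (Inc (φ a)) (sym g≡) (Inc-rename φ j)))
      where
      g≡ : g ≡ rename φ g
      g≡ = Joins⇒mk (E-proper G g∈) (subst (λ h → Joins h _ _) (ψ-G g∈) (ind g (there g∈)))

  connected-insert : ∀ {c G H e} → E H ≡ e ∷ E G → (∀ {x} → Inc x e → x ∈ V (E G)) →
                     Connected c G → Connected c H
  connected-insert {c} {G} {H} {e} eq ends ((Vs , uq , inV , lt) , paths) =
    (Vs , uq , All.map up inV , lt) , λ X lx u v iu iv u∉ v∉ → upPath (paths X lx u v (down iu) (down iv) u∉ v∉)
    where
    E⊆ : ∀ {f} → f ∈ E G → f ∈ E H
    E⊆ {f} p = subst (f ∈_) (sym eq) (there p)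
    up : ∀ {u} → InV G u → InV H u
    up (f , f∈ , i) = f , E⊆ f∈ , i
    down : ∀ {u} → InV H u → InV G u
    down (f , f∈ , i) with subst (f ∈_) eq f∈
    ... | here refl = ∈V⁻ (ends i)
    ... | there p = f , p , i
    upPath : ∀ {X u v} → PathAvoiding G X u v → PathAvoiding H X u v
    upPath (here p q) = here (up p) q
    upPath (step (f , f∈ , j) q r) = step (f , E⊆ f∈ , j) q (upPath r)

  -- The constant stays the same, since adding an edge between existing vertices keeps a graph
  -- `c`-connected.
  whitney⇒lovaszYemini : WhitneyProperty M → LovaszYeminiProperty M
  whitney⇒lovaszYemini (c , rec) = c , rigid
    where
    rigid : ∀ G → Connected c G → Rigid M G
    rigid G conn H complete = trans (rk≡ρ G id)
      (trans (≤-antisym (ρ-mono G⊆H) (ρ-cl λ {e} e∈ → spanned e (E-proper H e∈) (complete-E e e∈)))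
        (sym (rk≡ρ H id)))
      where
      G⊆H : E G ⊆ E H
      G⊆H {e} e∈ = Equivalence.from (complete _ _ (E-proper G e∈))
        ((e , e∈ , inj₁ refl) , (e , e∈ , inj₂ refl))
      complete-E : ∀ e → e ∈ E H → InV G (proj₁ e) × InV G (proj₂ e)
      complete-E e e∈ = Equivalence.to (complete _ _ (E-proper H e∈)) e∈
      spanned : ∀ e → Proper e → InV G (proj₁ e) × InV G (proj₂ e) → e ∈cl E G
      spanned e pe ((f , f∈ , i) , (g , g∈ , j)) = reconstructible⇒∈cl G pe ends
        λ K eq → rec K (connected-insert {G = G} {K} eq ends conn)
        where
        ends : ∀ {x} → Inc x e → x ∈ V (E G)
        ends (inj₁ refl) = ∈V⁺ f∈ i
        ends (inj₂ refl) = ∈V⁺ g∈ j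

-- Connectivity through cuts.

Avoid : List ℕ → Edge → Set
Avoid A e = proj₁ e ∉ A × proj₂ e ∉ A

avoid? : ∀ A → Decidable (Avoid A)
avoid? A e = ¬? (proj₁ e ∈? A) ×-dec ¬? (proj₂ e ∈? A)

Avoid-Inc : ∀ {A e x} → Avoid A e → Inc x e → x ∉ A
Avoid-Inc (p , q) (inj₁ refl) = p
Avoid-Inc (p , q) (inj₂ refl) = q

Avoid-of-Inc : ∀ {A e} → (∀ {x} → Inc x e → x ∉ A) → Avoid A e
Avoid-of-Inc h = h (inj₁ refl) , h (inj₂ refl)

Avoid-mk : ∀ {A u z} → u ∉ A → z ∉ A → Avoid A (mk u z)
Avoid-mk {A} {u} {z} u∉ z∉ = Avoid-of-Inc λ i →
  [ (λ p → subst (_∉ A) (sym p) u∉) , (λ p → subst (_∉ A) (sym p) z∉) ]′ (Inc-mk⁻ u z i)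

Crossing : List Edge → List ℕ → (ℕ → Bool) → Set
Crossing X A C = ∃[ a ] ∃[ b ] (a ∉ A × b ∉ A × C a ≡ true × C b ≡ false × mk a b ∈ X)

crossing? : ∀ {X} → Pr X → ∀ A C → Crossing X A C ⊎
  (∀ {a b} → mk a b ∈ X → a ∉ A → b ∉ A → C a ≡ true → C b ≡ false → ⊥)
crossing? {X} pr A C with search dec X
  where
  dec : Decidable (λ e → Avoid A e × ((C (proj₁ e) ≡ true × C (proj₂ e) ≡ false) ⊎
                                      (C (proj₁ e) ≡ false × C (proj₂ e) ≡ true)))
  dec e = avoid? A e ×-dec ((C (proj₁ e) ≟ᵇ true ×-dec C (proj₂ e) ≟ᵇ false) ⊎-dec
                            (C (proj₁ e) ≟ᵇ false ×-dec C (proj₂ e) ≟ᵇ true))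
... | inj₁ (e , e∈ , (av₁ , av₂) , inj₁ (C₁ , C₂)) = inj₁ (_ , _ , av₁ , av₂ , C₁ , C₂ ,
        subst (_∈ X) (sym (mk-of-Proper (pr e∈))) e∈)
... | inj₁ (e , e∈ , (av₁ , av₂) , inj₂ (C₁ , C₂)) = inj₁ (_ , _ , av₂ , av₁ , C₂ , C₁ ,
        subst (_∈ X) (trans (sym (mk-of-Proper (pr e∈))) (mk-comm _ _)) e∈)
... | inj₂ none = inj₂ no-cross
  where
  no-cross : ∀ {a b} → mk a b ∈ X → a ∉ A → b ∉ A → C a ≡ true → C b ≡ false → ⊥
  no-cross {a} {b} e a∉ b∉ Ca Cb with mk-Joins a b
  ... | inj₁ eq = none (subst (_∈ X) eq e) ((a∉ , b∉) , inj₁ (Ca , Cb))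
  ... | inj₂ eq = none (subst (_∈ X) eq e) ((b∉ , a∉) , inj₂ (Cb , Ca))

-- Connectivity in terms of cuts: every 2-colouring of the vertices outside a small set A has a
-- bichromatic edge outside A.
record Conn (κ : ℕ) (X : List Edge) : Set where
  field
    big : ∀ A → length A ≤ κ → ∃[ v ] (v ∈ V X × v ∉ A)
    cut : ∀ A → length A < κ → (C : ℕ → Bool) → ∀ {u v} → u ∈ V X → v ∈ V X → u ∉ A → v ∉ A →
          C u ≡ true → C v ≡ false →
          Crossing X A C
open Conn public

-- Degree at least `k`, as the impossibility of covering the neighbourhood by fewer than `k`
-- vertices; each use hands over the list to be avoided.
Deg : ℕ → ℕ → List Edge → Set
Deg k u X = ∀ A → length A < k → ∃[ z ] (z ∉ A × mk u z ∈ X)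

abstract
  member : List ℕ → ℕ → Bool
  member L x = does (x ∈? L)

  member⁺ : ∀ {L x} → x ∈ L → member L x ≡ true
  member⁺ {L} {x} p = dec-true (x ∈? L) p

  member⁻ : ∀ {L x} → x ∉ L → member L x ≡ false
  member⁻ {L} {x} p = dec-false (x ∈? L) p

  member-true : ∀ {L x} → member L x ≡ true → x ∈ L
  member-true {L} {x} eq with x ∈? L
  ... | yes p = p

  member-false : ∀ {L x} → member L x ≡ false → x ∉ L
  member-false {L} {x} eq with x ∈? L
  ... | no p = p

∉-++ : ∀ {x : ℕ} {A B} → x ∉ A ++ B → x ∉ A × x ∉ B
∉-++ {A = A} h = (h ∘ ∈-++⁺ˡ) , (h ∘ ∈-++⁺ʳ A)

Conn-mono : ∀ {κ κ′ X} → κ′ ≤ κ → Conn κ X → Conn κ′ X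
Conn-mono le h = record
  { big = λ A l → big h A (≤-trans l le) ; cut = λ A l → cut h A (≤-trans l le) }

-- Colour `u` against all other vertices: a bichromatic edge is an edge at `u`. As `A` may contain
-- `u`, it is first removed from `A`.
Conn-Deg : ∀ {κ X u} → Conn κ X → u ∈ V X → Deg κ u X
Conn-Deg {κ} {X} {u} h u∈ A lt = go (big h (u ∷ A′) short)
  where
  ≢u? : Decidable (λ x → x ≢ u)
  ≢u? x = ¬? (x ≟ u)
  A′ = filter ≢u? A
  short : suc (length A′) ≤ κ
  short = ≤-trans (s≤s (length-filter ≢u? A)) lt
  go : ∃[ v ] (v ∈ V X × v ∉ u ∷ A′) → ∃[ z ] (z ∉ A × mk u z ∈ X)
  go (v , v∈ , v∉) with cut h A′ short (member (u ∷ [])) u∈ v∈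
                          (λ p → proj₂ (∈-filter⁻ ≢u? {xs = A} p) refl) (v∉ ∘ there)
                          (member⁺ (here refl)) (member⁻ λ { (here p) → v∉ (here p) })
  ... | a , b , a∉ , b∉ , Ca , Cb , e with member-true Ca
  ... | here refl = b , (λ p → b∉ (∈-filter⁺ ≢u? {xs = A} p λ q → member-false Cb (here q))) , e

-- The first half says that no vertex becomes isolated. It has to accompany the second because `V`
-- sees only vertices that lie on an edge.
Conn-del : ∀ {κ κ′ X X′ A} → length A + κ′ ≤ κ → 1 ≤ κ′ → Conn κ X → Pr X′ →
  (∀ {u z} → mk u z ∈ X → u ∉ A → z ∉ A → mk u z ∈ X′) →
  (∀ {u z} → mk u z ∈ X′ → mk u z ∈ X × u ∉ A × z ∉ A) →
  (∀ {u} → u ∈ V X → u ∉ A → u ∈ V X′) × Conn κ′ X′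
Conn-del {κ} {κ′} {X} {X′} {A} le pos h pr′ into back = stays , record { big = big′ ; cut = cut′ }
  where
  stays : ∀ {u} → u ∈ V X → u ∉ A → u ∈ V X′
  stays u∈ u∉ with Conn-Deg h u∈ A (≤-trans (≤-trans (≤-reflexive (+-comm 1 _)) (+-monoʳ-≤ _ pos)) le)
  ... | z , z∉ , e = ∈V-mk⁺ (into e u∉ z∉)
  size : ∀ B → length B ≤ κ′ → length (A ++ B) ≤ κ
  size B l = ≤-trans (≤-reflexive (length-++ A)) (≤-trans (+-monoʳ-≤ (length A) l) le)
  big′ : ∀ B → length B ≤ κ′ → ∃[ v ] (v ∈ V X′ × v ∉ B)
  big′ B l with big h (A ++ B) (size B l)
  ... | v , v∈ , v∉ = v , stays v∈ (proj₁ (∉-++ v∉)) , proj₂ (∉-++ {A = A} v∉)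
  down : ∀ {u} → u ∈ V X′ → u ∈ V X × u ∉ A
  down u∈ with ∈V-mk⁻ pr′ u∈
  ... | z , e with back e
  ... | p , q , _ = ∈V-mk⁺ p , q
  cut′ : ∀ B → length B < κ′ → (C : ℕ → Bool) → ∀ {u v} → u ∈ V X′ → v ∈ V X′ → u ∉ B → v ∉ B →
         C u ≡ true → C v ≡ false →
         Crossing X′ B C
  cut′ B l C u∈ v∈ u∉ v∉ Cu Cv with cut h (A ++ B) size′ C (proj₁ (down u∈)) (proj₁ (down v∈))
      ([ proj₂ (down u∈) , u∉ ]′ ∘ ∈-++⁻ A) ([ proj₂ (down v∈) , v∉ ]′ ∘ ∈-++⁻ A) Cu Cv
    where
    size′ : length (A ++ B) < κ
    size′ = ≤-trans (≤-reflexive (trans (cong suc (length-++ A)) (sym (+-suc (length A) (length B)))))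
              (≤-trans (+-monoʳ-≤ (length A) l) le)
  ... | a , b , a∉ , b∉ , Ca , Cb , e = a , b , proj₂ (∉-++ {A = A} a∉) , proj₂ (∉-++ {A = A} b∉) , Ca , Cb ,
          into e (proj₁ (∉-++ a∉)) (proj₁ (∉-++ b∉))

Connected⇒Conn : ∀ {κ} G → Connected κ G → Conn κ (E G)
Connected⇒Conn {κ} G ((Vs , uq , inV , lt) , paths) = record { big = big′ ; cut = cut′ }
  where
  up : ∀ {u} → InV G u → u ∈ V (E G)
  up (e , e∈ , i) = ∈V⁺ e∈ i
  big′ : ∀ A → length A ≤ κ → ∃[ v ] (v ∈ V (E G) × v ∉ A)
  big′ A l with fresh uq (≤-trans (s≤s l) lt)
  ... | v , v∈ , v∉ = v , up (All.lookup inV v∈) , v∉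
  cut′ : ∀ A → length A < κ → (C : ℕ → Bool) → ∀ {u v} → u ∈ V (E G) → v ∈ V (E G) → u ∉ A → v ∉ A →
         C u ≡ true → C v ≡ false →
         Crossing (E G) A C
  cut′ A l C {u} {v} u∈ v∈ u∉ v∉ Cu Cv = walk (paths A l u v (∈V⁻ u∈) (∈V⁻ v∈) u∉ v∉) Cu
    where
    source∉ : ∀ {x} → PathAvoiding G A x v → x ∉ A
    source∉ (here _ q) = q
    source∉ (step _ q _) = q
    walk : ∀ {x} → PathAvoiding G A x v → C x ≡ true →
           Crossing (E G) A C
    walk (here _ _) Cx with trans (sym Cx) Cv
    ... | ()
    walk {x} (step {w = w} (e , e∈ , j) q r) Cx with C w in Cw
    ... | true = walk r Cw
    ... | false = x , w , q , source∉ r , Cx , Cw ,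
                  subst (_∈ E G) (Joins⇒mk (All.lookup (simple G) e∈) j) e∈

Conn⇒Connected : ∀ {κ} G → Conn κ (E G) → Connected κ G
Conn⇒Connected {κ} G h = (V (E G) , V-unique (E G) , All.tabulate ∈V⁻ , ≰⇒> small) , paths
  where
  small : ¬ (nv (E G) ≤ κ)
  small le with big h (V (E G)) le
  ... | v , v∈ , v∉ = v∉ v∈
  snoc : ∀ {X u a b} → PathAvoiding G X u a → Adj G a b → InV G b → b ∉ X → PathAvoiding G X u b
  snoc (here _ q) adj ib b∉ = step adj q (here ib b∉)
  snoc (step adj′ q r) adj ib b∉ = step adj′ q (snoc r adj ib b∉)
  paths : ∀ X → length X < κ → ∀ u v → InV G u → InV G v → u ∉ X → v ∉ X → PathAvoiding G X u v
  paths X lt u v (e , e∈ , i) (f , f∈ , j) u∉ v∉ =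
    reach (nv (E G)) (u ∷ []) ([] ∷ []) (λ { (here refl) → ∈V⁺ e∈ i }) (here refl)
      (λ { (here refl) → here (e , e∈ , i) u∉ }) (m≤m+n _ _)
    where
    -- `L` holds vertices already reached from `u`. Colouring by membership in `L` yields an edge
    -- leaving `L`, and `L` can grow at most `nv (E G)` times.
    reach : ∀ fuel L → Unique L → L ⊆ V (E G) → u ∈ L → (∀ {y} → y ∈ L → PathAvoiding G X u y) →
            nv (E G) ≤ fuel + length L → PathAvoiding G X u v
    reach fuel L uq L⊆ u∈ path le with v ∈? L
    ... | yes v∈ = path v∈
    reach zero L uq L⊆ u∈ path le | no v∉L = ⊥-elim (<⇒≱ (length-⊆ uq′ sub) le)
      where
      uq′ : Unique (v ∷ L)
      uq′ = All.tabulate (λ y∈ eq → v∉L (subst (_∈ L) (sym eq) y∈)) ∷ uq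
      sub : v ∷ L ⊆ V (E G)
      sub (here refl) = ∈V⁺ f∈ j
      sub (there p) = L⊆ p
    reach (suc fuel) L uq L⊆ u∈ path le | no v∉L
      with cut h X lt (member L) (∈V⁺ e∈ i) (∈V⁺ f∈ j) u∉ v∉ (member⁺ u∈) (member⁻ v∉L)
    ... | a , b , a∉ , b∉ , Ca , Cb , ab = reach fuel (b ∷ L)
          (All.tabulate (λ y∈ eq → member-false Cb (subst (_∈ L) (sym eq) y∈)) ∷ uq)
          (λ { (here refl) → ∈V⁺ ab (Inc-mkʳ a b) ; (there p) → L⊆ p }) (there u∈)
          (λ { (here refl) → snoc (path (member-true Ca)) (mk a b , ab , mk-Joins a b) (mk a b , ab , Inc-mkʳ a b) b∉
             ; (there p) → path p })
          (≤-trans le (≤-reflexive (sym (+-suc fuel (length L)))))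

-- Absorbing vertices, and the increments of the rank of complete graphs.

module Rigidity (M : GraphMatroidFamily) (unb : Unbounded M) (c : ℕ) (c-pos : 1 ≤ c)
  (rigid : ∀ {X} → Pr X → Conn c X → Rank.Spans M X (V X)) where

  open Rank M
  open NewVertex M unb

  -- The clique on `U` together with the edges of `Z` from `u` to `U` is `c`-connected, hence rigid,
  -- and each of its edges lies in the closure of `Z`.
  absorb : ∀ {Z U u} → Spans Z U →
           (∀ A → length A < c → ∃[ z ] (z ∈ U × z ∉ A × u ≢ z × mk u z ∈ Z)) → Spans Z (u ∷ U)
  absorb {Z} {U} {u} s nbrs = spans
    where
    star? : Decidable (λ e → Inc u e × e ∈ K (u ∷ U))
    star? e = inc? u e ×-dec (e ∈ₑ? K (u ∷ U))
    S = filter star? Z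
    X = K U ++ S
    ∈S : ∀ {z} → z ∈ U → u ≢ z → mk u z ∈ Z → mk u z ∈ X
    ∈S {z} z∈ ne e∈ = ∈-++⁺ʳ (K U) (∈-filter⁺ star? {xs = Z} e∈ (Inc-mkˡ u z , ∈K⁺ (here refl) (there z∈) ne))
    X⊆ : X ⊆ K (u ∷ U)
    X⊆ e∈ = [ K-mono there , (λ p → proj₂ (proj₂ (∈-filter⁻ star? {xs = Z} p))) ]′ (∈-++⁻ (K U) e∈)
    X-cl : ∀ {e} → e ∈ X → e ∈cl Z
    X-cl e∈ = [ Spans-K {Z} {U} s , (λ p → ∈cl-∈ (proj₁ (∈-filter⁻ star? {xs = Z} p))) ]′ (∈-++⁻ (K U) e∈)
    VX⊆ : V X ⊆ u ∷ U
    VX⊆ x∈ with ∈V⁻ {X} x∈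
    ... | e , e∈ , i = K-Inc (X⊆ e∈) i
    big′ : ∀ A → length A ≤ c → ∃[ v ] (v ∈ V X × v ∉ A)
    big′ A l with u ∈? A
    ... | no u∉ with nbrs [] c-pos
    ... | z , z∈ , _ , ne , e = u , ∈V-mk⁺ (∈S z∈ ne e) , u∉
    -- When `u` itself takes one of the at most `c` places of `A`, fewer than `c` are left to block
    -- its neighbours.
    big′ A l | yes u∈ with ∈-∃++ u∈
    ... | A₁ , A₂ , refl with nbrs (A₁ ++ A₂) (≤-trans (≤-reflexive shorter) l)
      where
      shorter : suc (length (A₁ ++ A₂)) ≡ length (A₁ ++ u ∷ A₂)
      shorter = trans (cong suc (length-++ A₁)) (trans (sym (+-suc _ _)) (sym (length-++ A₁)))
    ... | z , z∈ , z∉ , ne , e = z , ∈V⁺ (∈S z∈ ne e) (Inc-mkʳ u z) ,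
          λ p → [ z∉ ∘ ∈-++⁺ˡ , (λ { (here q) → ne (sym q) ; (there q) → z∉ (∈-++⁺ʳ A₁ q) }) ]′ (∈-++⁻ A₁ p)
    cut′ : ∀ A → length A < c → (C : ℕ → Bool) → ∀ {p q} → p ∈ V X → q ∈ V X → p ∉ A → q ∉ A →
           C p ≡ true → C q ≡ false →
           Crossing X A C
    cut′ A l C {p} {q} p∈ q∈ p∉ q∉ Cp Cq = go (VX⊆ p∈) (VX⊆ q∈)
      where
      differ : ∀ {a b} → C a ≡ true → C b ≡ false → a ≢ b
      differ Ca Cb refl with trans (sym Ca) Cb
      ... | ()
      go : p ∈ u ∷ U → q ∈ u ∷ U → Crossing X A C
      go (there p∈) (there q∈) = p , q , p∉ , q∉ , Cp , Cq , ∈-++⁺ˡ (∈K⁺ p∈ q∈ (differ Cp Cq))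
      go (here refl) (here refl) = contradiction refl (differ Cp Cq)
      go (here refl) (there q∈) with nbrs A l
      ... | z , z∈ , z∉ , ne , e with C z in Cz
      ... | true = z , q , z∉ , q∉ , Cz , Cq , ∈-++⁺ˡ (∈K⁺ z∈ q∈ (differ Cz Cq))
      ... | false = p , z , p∉ , z∉ , Cp , Cz , ∈S z∈ ne e
      go (there p∈) (here refl) with nbrs A l
      ... | z , z∈ , z∉ , ne , e with C z in Cz
      ... | true = z , q , z∉ , q∉ , Cz , Cq , subst (_∈ X) (mk-comm q z) (∈S z∈ ne e)
      ... | false = p , z , p∉ , z∉ , Cp , Cz , ∈-++⁺ˡ (∈K⁺ p∈ z∈ (differ Cp Cz))
    spanX : Spans X (V X)
    spanX = rigid (K-Pr (u ∷ U) ∘ X⊆) (record { big = big′ ; cut = cut′ })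
    inVX : ∀ {v} → v ∈ U → v ∈ V X × u ∈ V X
    inVX {v} v∈ with nbrs [] c-pos
    ... | z , z∈ , _ , ne , e with v ≟ z
    ... | yes refl = ∈V⁺ (∈S z∈ ne e) (Inc-mkʳ u v) , ∈V-mk⁺ (∈S z∈ ne e)
    ... | no v≢z = ∈V-mk⁺ {z = z} (∈-++⁺ˡ (∈K⁺ v∈ z∈ v≢z)) , ∈V-mk⁺ (∈S z∈ ne e)
    toU : ∀ {v} → v ∈ U → u ≢ v → mk u v ∈cl Z
    toU v∈ ne with inVX v∈
    ... | v∈X , u∈X = ∈cl-trans X-cl (spanX u∈X v∈X ne)
    spans : Spans Z (u ∷ U)
    spans (here refl) (here refl) ne = contradiction refl ne
    spans (here refl) (there v∈) ne = toU v∈ ne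
    spans {p} (there u∈) (here refl) ne = subst (_∈cl Z) (mk-comm u p) (toU u∈ (≢-sym ne))
    spans (there u∈) (there v∈) ne = s u∈ v∈ ne

  spans-K : ∀ {Z U} → K U ⊆ Z → Spans Z U
  spans-K sub u∈ v∈ ne = ∈cl-∈ (sub (∈K⁺ u∈ v∈ ne))

  upTo-≢ : ∀ {n x} → x ∈ upTo n → n ≢ x
  upTo-≢ x∈ refl = <-irrefl refl (∈-upTo⁻ x∈)

  upTo-fresh : ∀ {m} A → length A < c → c ≤ m → ∃[ z ] (z ∈ upTo m × z ∉ A)
  upTo-fresh {m} A l le = fresh (upTo⁺ m) (≤-trans l (≤-trans le (≤-reflexive (sym (length-upTo m)))))

  F-suc-≤ρ : ∀ {m Z} → Spans Z (m ∷ upTo m) → F (suc m) ≤ ρ Z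
  F-suc-≤ρ {m} {Z} s = ≤-trans (ρ-mono (K-mono sub)) (Spans⇒ρ {Z} {m ∷ upTo m} s)
    where
    sub : upTo (suc m) ⊆ m ∷ upTo m
    sub {x} x∈ with x ≟ m
    ... | yes p = here p
    ... | no p = there (∈-upTo⁺ (≤∧≢⇒< (≤-pred (∈-upTo⁻ x∈)) p))

  -- A new vertex joined to `c` old ones is absorbed, and `c` edges add at most `c` to the rank.
  F-suc : ∀ {m} → c ≤ m → F (suc m) ≤ c + F m
  F-suc {m} le = begin
      F (suc m)                    ≤⟨ F-suc-≤ρ (absorb {u = m} (spans-K (∈-++⁺ʳ L)) nbrs) ⟩
      ρ (L ++ K (upTo m))          ≤⟨ ρ-++-≤ L (K (upTo m)) ⟩
      length L + F m               ≡⟨ cong (_+ F m) (trans (length-map (mk m) (upTo c)) (length-upTo c)) ⟩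
      c + F m                      ∎
    where
    open ≤-Reasoning
    L = map (mk m) (upTo c)
    nbrs : ∀ A → length A < c → ∃[ z ] (z ∈ upTo m × z ∉ A × m ≢ z × mk m z ∈ L ++ K (upTo m))
    nbrs A l with upTo-fresh {c} A l ≤-refl
    ... | z , z∈ , z∉ = z , z∈m , z∉ , upTo-≢ z∈m , ∈-++⁺ˡ (∈-map⁺ (mk m) z∈)
      where
      z∈m = ∈-upTo⁺ (≤-trans (∈-upTo⁻ z∈) le)

  -- Two cliques on `suc m` vertices that share `m` of them: absorbing the last vertex shows that
  -- their union spans the only missing edge, and submodularity does the rest.
  F-concave : ∀ {m} → c ≤ m → F (suc (suc m)) + F m ≤ F (suc m) + F (suc m)
  F-concave {m} le = begin
      F (suc (suc m)) + F m     ≤⟨ +-monoˡ-≤ (F m) F≤ ⟩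
      ρ W + F m                 ≤⟨ ρ-submod {X = X} {Y} (∈-++⁻ X) (K-mono there) (K-mono there) ⟩
      ρ X + ρ Y                 ≤⟨ +-mono-≤ (K≤F (m ∷ U)) (K≤F (suc m ∷ U)) ⟩
      F (suc (length U)) + F (suc (length U)) ≡⟨ cong (λ n → F (suc n) + F (suc n)) (length-upTo m) ⟩
      F (suc m) + F (suc m)     ∎
    where
    open ≤-Reasoning
    U = upTo m
    X = K (m ∷ U)
    Y = K (suc m ∷ U)
    W = X ++ Y
    s≢ : ∀ {x} → x ∈ U → suc m ≢ x
    s≢ x∈ refl = <-irrefl refl (<-trans ≤-refl (∈-upTo⁻ x∈))
    nbrs : ∀ A → length A < c → ∃[ z ] (z ∈ m ∷ U × z ∉ A × suc m ≢ z × mk (suc m) z ∈ W)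
    nbrs A l with upTo-fresh {m} A l le
    ... | z , z∈ , z∉ = z , there z∈ , z∉ , s≢ z∈ , ∈-++⁺ʳ X (∈K⁺ (here refl) (there z∈) (s≢ z∈))
    F≤ : F (suc (suc m)) ≤ ρ W
    F≤ = ≤-trans (ρ-mono (K-mono sub)) (Spans⇒ρ {W} {suc m ∷ m ∷ U} (absorb (spans-K ∈-++⁺ˡ) nbrs))
      where
      sub : upTo (suc (suc m)) ⊆ suc m ∷ m ∷ U
      sub {x} x∈ with x ≟ suc m
      ... | yes p = here p
      ... | no p with x ≟ m
      ... | yes q = there (here q)
      ... | no q = there (there (∈-upTo⁺ (≤∧≢⇒< (≤-pred (≤∧≢⇒< (≤-pred (∈-upTo⁻ x∈)) p)) q)))

  -- A lower bound on the increment of `F` at `n`, free of subtraction; refuting it for `suc d` is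
  -- the upper bound `d`. By concavity it descends to smaller sizes, as far as `c`.
  Lev : ℕ → ℕ → Set
  Lev d n = d + F n ≤ F (suc n)

  Lev-pred : ∀ {d m} → c ≤ m → Lev d (suc m) → Lev d m
  Lev-pred {d} {m} le h = +-cancelʳ-≤ (F (suc m)) _ _ (begin
      (d + F m) + F (suc m) ≡⟨ trans (+-assoc d (F m) _) (trans (cong (d +_) (+-comm (F m) _)) (sym (+-assoc d _ (F m)))) ⟩
      (d + F (suc m)) + F m ≤⟨ +-monoˡ-≤ (F m) h ⟩
      F (suc (suc m)) + F m ≤⟨ F-concave le ⟩
      F (suc m) + F (suc m) ∎)
    where open ≤-Reasoning

  Lev-antitone : ∀ {d m} j → c ≤ m → Lev d (j + m) → Lev d m
  Lev-antitone zero le h = h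
  Lev-antitone (suc j) le h = Lev-antitone j le (Lev-pred (≤-trans le (m≤n+m _ j)) h)

  Lev-≤ : ∀ {d m n} → c ≤ m → m ≤ n → Lev d n → Lev d m
  Lev-≤ {d} {m} {n} le mn h = Lev-antitone (n ∸ m) le (subst (Lev d) (sym (m∸n+n≡m mn)) h)

  -- The increment at the upper end is the smallest one of the range; dually, `F-linear-≤` uses that
  -- the increment at the lower end is the largest.
  F-linear-≥ : ∀ {d m} j → c ≤ m → Lev d (j + m) → d * j + F m ≤ F (j + m)
  F-linear-≥ {d} {m} zero le h = ≤-reflexive (cong (_+ F m) (*-zeroʳ d))
  F-linear-≥ {d} {m} (suc j) le h = begin
      d * suc j + F m     ≡⟨ trans (cong (_+ F m) (*-suc d j)) (+-assoc d (d * j) (F m)) ⟩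
      d + (d * j + F m)   ≤⟨ +-monoʳ-≤ d (F-linear-≥ j le lev) ⟩
      d + F (j + m)       ≤⟨ lev ⟩
      F (suc j + m)       ∎
    where
    open ≤-Reasoning
    lev = Lev-pred (≤-trans le (m≤n+m _ j)) h

  F-linear-≤ : ∀ {d m} j → c ≤ m → ¬ Lev (suc d) m → F (j + m) ≤ d * j + F m
  F-linear-≤ {d} {m} zero le h = m≤n+m _ (d * 0)
  F-linear-≤ {d} {m} (suc j) le h = begin
      F (suc (j + m))     ≤⟨ ≤-pred (≰⇒> λ q → h (Lev-antitone j le q)) ⟩
      d + F (j + m)       ≤⟨ +-monoʳ-≤ d (F-linear-≤ j le h) ⟩
      d + (d * j + F m)   ≡⟨ sym (trans (cong (_+ F m) (*-suc d j)) (+-assoc d (d * j) (F m))) ⟩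
      d * suc j + F m     ∎
    where open ≤-Reasoning

  ¬Lev-suc-c : ∀ {m} → c ≤ m → ¬ Lev (suc c) m
  ¬Lev-suc-c le h = <-irrefl refl (≤-trans h (F-suc le))

  Lev-1 : ∀ n → Lev 1 (suc n)
  Lev-1 = F-<

length-concatMap-≤ : ∀ {A B : Set} n (h : A → List B) → (∀ x → length (h x) ≤ n) →
                     ∀ xs → length (concatMap h xs) ≤ length xs * n
length-concatMap-≤ n h le [] = z≤n
length-concatMap-≤ n h le (x ∷ xs) =
  ≤-trans (≤-reflexive (length-++ (h x))) (+-mono-≤ (le x) (length-concatMap-≤ n h le xs))

Conn-nv : ∀ {κ X} → Conn κ X → κ < nv X
Conn-nv {κ} {X} h = ≰⇒> λ le → let (v , v∈ , v∉) = big h (V X) le in v∉ v∈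

-- Matroid isomorphisms as two labellings of one index set; matching of stars.

module Pairs (M : GraphMatroidFamily) (unb : Unbounded M) (c : ℕ) (c-pos : 1 ≤ c)
  (rigid : ∀ {X} → Pr X → Conn c X → Rank.Spans M X (V X)) (I : Set) where

  open Rank M
  open NewVertex M unb
  open Rigidity M unb c c-pos rigid

  del : (I → Edge) → List ℕ → List I → List I
  del a A Y = filter (λ i → avoid? A (a i)) Y

  del⁻ : ∀ a A Y {i} → i ∈ del a A Y → i ∈ Y × Avoid A (a i)
  del⁻ a A Y = ∈-filter⁻ (λ i → avoid? A (a i)) {xs = Y}

  del⁺ : ∀ a A {Y i} → i ∈ Y → Avoid A (a i) → i ∈ del a A Y
  del⁺ a A {Y} = ∈-filter⁺ (λ i → avoid? A (a i)) {xs = Y}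

  del⊆ : ∀ a A Y → del a A Y ⊆ Y
  del⊆ a A Y = proj₁ ∘ del⁻ a A Y

  map-⊆ : ∀ (a : I → Edge) {Z Y} → Z ⊆ Y → map a Z ⊆ map a Y
  map-⊆ a s e∈ with ∈-map⁻ a e∈
  ... | i , i∈ , refl = ∈-map⁺ a (s i∈)

  map-del⁻ : ∀ a A Y {e} → e ∈ map a (del a A Y) → e ∈ map a Y × Avoid A e
  map-del⁻ a A Y e∈ with ∈-map⁻ a e∈
  ... | i , i∈ , refl = ∈-map⁺ a (proj₁ (del⁻ a A Y i∈)) , proj₂ (del⁻ a A Y i∈)

  map-del⁺ : ∀ a A Y {e} → e ∈ map a Y → Avoid A e → e ∈ map a (del a A Y)
  map-del⁺ a A Y e∈ av with ∈-map⁻ a e∈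
  ... | i , i∈ , refl = ∈-map⁺ a (del⁺ a A i∈ av)

  V-del : ∀ a A Y {x} → x ∈ V (map a (del a A Y)) → x ∈ V (map a Y) × x ∉ A
  V-del a A Y x∈ with ∈V⁻ {map a (del a A Y)} x∈
  ... | e , e∈ , i with map-del⁻ a A Y e∈
  ... | p , av = ∈V⁺ p i , Avoid-Inc av i

  -- A matroid isomorphism: i ∈ Y names the edge a i of one graph and the edge b i of the other.
  record Pair (a b : I → Edge) (Y : List I) : Set where
    field
      ρ-eq : ∀ {Z} → Z ⊆ Y → ρ (map a Z) ≡ ρ (map b Z)
      properˡ : ∀ {i} → i ∈ Y → Proper (a i)
      properʳ : ∀ {i} → i ∈ Y → Proper (b i)
      injectiveˡ : ∀ {i j} → i ∈ Y → j ∈ Y → a i ≡ a j → i ≡ j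
      injectiveʳ : ∀ {i j} → i ∈ Y → j ∈ Y → b i ≡ b j → i ≡ j
  open Pair public

  Pair-swap : ∀ {a b Y} → Pair a b Y → Pair b a Y
  Pair-swap P = record
    { ρ-eq = λ s → sym (ρ-eq P s) ; properˡ = properʳ P ; properʳ = properˡ P
    ; injectiveˡ = injectiveʳ P ; injectiveʳ = injectiveˡ P }

  Pair-⊆ : ∀ {a b Y Z} → Z ⊆ Y → Pair a b Y → Pair a b Z
  Pair-⊆ s P = record
    { ρ-eq = λ t → ρ-eq P (s ∘ t) ; properˡ = properˡ P ∘ s ; properʳ = properʳ P ∘ s
    ; injectiveˡ = λ i j → injectiveˡ P (s i) (s j) ; injectiveʳ = λ i j → injectiveʳ P (s i) (s j) }

  Prˡ : ∀ {a b Y} → Pair a b Y → Pr (map a Y)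
  Prˡ {a} P e∈ with ∈-map⁻ a e∈
  ... | i , i∈ , refl = properˡ P i∈

  Prʳ : ∀ {a b Y} → Pair a b Y → Pr (map b Y)
  Prʳ P = Prˡ (Pair-swap P)

  ∈cl-transfer : ∀ {a b Y Z i} → Pair a b Y → Z ⊆ Y → i ∈ Y → a i ∈cl map a Z → b i ∈cl map b Z
  ∈cl-transfer {a} {b} {Y} {Z} {i} P s i∈ h = begin
    ρ (map b (i ∷ Z))   ≡⟨ sym (ρ-eq P {i ∷ Z} λ { (here refl) → i∈ ; (there p) → s p }) ⟩
    ρ (map a (i ∷ Z))   ≤⟨ h ⟩
    ρ (map a Z)         ≡⟨ ρ-eq P s ⟩
    ρ (map b Z)         ∎
    where open ≤-Reasoning

  module _ {a : I → Edge} {Y : List I} (pr : Pr (map a Y)) where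

    Pr-del : ∀ A → Pr (map a (del a A Y))
    Pr-del A = pr ∘ map-⊆ a (del⊆ a A Y)

    del-Conn : ∀ {κ κ′} A → length A + κ′ ≤ κ → 1 ≤ κ′ → Conn κ (map a Y) →
      (∀ {u} → u ∈ V (map a Y) → u ∉ A → u ∈ V (map a (del a A Y))) × Conn κ′ (map a (del a A Y))
    del-Conn A le pos h = Conn-del le pos h (Pr-del A)
      (λ e u∉ z∉ → map-del⁺ a A Y e (Avoid-mk u∉ z∉))
      (λ {u} {z} e → let (p , av) = map-del⁻ a A Y e in
                     p , Avoid-Inc av (Inc-mkˡ u z) , Avoid-Inc av (Inc-mkʳ u z))

    del-Spans : ∀ {κ} A → length A + c ≤ κ → Conn κ (map a Y) →
      Spans (map a (del a A Y)) (V (map a (del a A Y)))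
    del-Spans A le h = rigid (Pr-del A) (proj₂ (del-Conn A le c-pos h))

    nv-del : ∀ {κ} A → length A + c ≤ κ → Conn κ (map a Y) →
      nv (map a Y) ≤ length A + nv (map a (del a A Y))
    nv-del A le h = ≤-trans (length-⊆ (V-unique _) sub) (≤-reflexive (length-++ A))
      where
      sub : V (map a Y) ⊆ A ++ V (map a (del a A Y))
      sub {x} x∈ with x ∈? A
      ... | yes p = ∈-++⁺ˡ p
      ... | no p = ∈-++⁺ʳ A (proj₁ (del-Conn A le c-pos h) x∈ p)

    -- What remains is rigid, so its rank is a value of `F`, and each vertex put back adds at most
    -- `c` to the bound.
    ρ-del : ∀ {κ} A → length A + c ≤ κ → Conn κ (map a Y) →
      ρ (map a Y) ≤ c * length A + ρ (map a (del a A Y))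
    ρ-del A le h = begin
        ρ (map a Y)               ≤⟨ ρ≤F pr ⟩
        F (nv (map a Y))          ≤⟨ F-mono (nv-del A le h) ⟩
        F (length A + n′)         ≤⟨ F-linear-≤ (length A) c≤n′ (¬Lev-suc-c c≤n′) ⟩
        c * length A + F n′       ≡⟨ cong (c * length A +_) (sym (Spans⇒F (Pr-del A) (del-Spans A le h))) ⟩
        c * length A + ρ (map a (del a A Y)) ∎
      where
      open ≤-Reasoning
      n′ = nv (map a (del a A Y))
      c≤n′ : c ≤ n′
      c≤n′ = <⇒≤ (Conn-nv (proj₂ (del-Conn A le c-pos h)))

  -- If w had few edges, deleting their a-ends would leave a rigid graph spanning them.
  minDeg : ∀ {a b Y κ k} → Pair a b Y → k * 2 + c ≤ κ → Conn κ (map a Y) →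
           ∀ {w} → w ∈ V (map b Y) → Deg k w (map b Y)
  minDeg {a} {b} {Y} {κ} {k} P le h {w} w∈ A lt
    with search (λ z → ¬? (z ∈? A) ×-dec (mk w z ∈ₑ? map b Y)) (V (map b Y))
  ... | inj₁ (z , _ , p) = z , p
  ... | inj₂ none = ⊥-elim (absurd (∈V⁻ {map b Y} w∈))
    where
    in-A : ∀ {z} → mk w z ∈ map b Y → z ∈ A
    in-A {z} e with z ∈? A
    ... | yes p = p
    ... | no p = ⊥-elim (none (∈V⁺ e (Inc-mkʳ w z)) (p , e))
    -- The `a`-ends of the edge whose `b`-ends are `w` and `z`: two vertices for each `z` in `A`,
    -- whence `k * 2` in the hypothesis.
    ends : ℕ → List ℕ
    ends z with mk w z ∈ₑ? map b Y
    ... | yes p = proj₁ (a (proj₁ (∈-map⁻ b p))) ∷ proj₂ (a (proj₁ (∈-map⁻ b p))) ∷ []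
    ... | no _ = []
    ends-≤ : ∀ z → length (ends z) ≤ 2
    ends-≤ z with mk w z ∈ₑ? map b Y
    ... | yes p = ≤-refl
    ... | no _ = z≤n
    ends-∈ : ∀ {i z x} → i ∈ Y → b i ≡ mk w z → Inc x (a i) → x ∈ ends z
    ends-∈ {i} {z} i∈ eq inc with mk w z ∈ₑ? map b Y
    ... | no q = contradiction (subst (_∈ map b Y) eq (∈-map⁺ b i∈)) q
    ... | yes p with ∈-map⁻ b p
    ... | j , j∈ , eq′ with injectiveʳ P i∈ j∈ (trans eq eq′)
    ends-∈ i∈ eq (inj₁ refl) | yes p | j , j∈ , eq′ | refl = here refl
    ends-∈ i∈ eq (inj₂ refl) | yes p | j , j∈ , eq′ | refl = there (here refl)
    B = concatMap ends A
    cover : ∀ {i x} → i ∈ Y → Inc w (b i) → Inc x (a i) → x ∈ B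
    cover {i} i∈ iw ix with other-end (properʳ P i∈) iw
    ... | z , eq = ∈-concatMap⁺ ends (lose (in-A (subst (_∈ map b Y) eq (∈-map⁺ b i∈))) (ends-∈ i∈ eq ix))
    size : length B + c ≤ κ
    size = ≤-trans (+-monoˡ-≤ c (≤-trans (length-concatMap-≤ 2 ends ends-≤ A) (*-monoˡ-≤ 2 (<⇒≤ lt)))) le
    off? : Decidable (λ i → ¬ Inc w (b i))
    off? i = ¬? (inc? w (b i))
    Z = filter off? Y
    Z⊆ : Z ⊆ Y
    Z⊆ = proj₁ ∘ ∈-filter⁻ off? {xs = Y}
    Γ = map a (del a B Y)
    Γ⊆ : Γ ⊆ map a Z
    Γ⊆ = map-⊆ a λ i∈ → let (p , av) = del⁻ a B Y i∈ in
      ∈-filter⁺ off? {xs = Y} p (λ iw → proj₁ av (cover p iw (inj₁ refl)))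
    stays = proj₁ (del-Conn (Prˡ P) B size c-pos h)
    rich : ∀ {x} → x ∈ B → x ∈ V (map a Y) → ∀ A′ → length A′ < c →
           ∃[ z ] (z ∈ V Γ × z ∉ A′ × x ≢ z × mk x z ∈ map a Z)
    rich {x} x∈B x∈ A′ l with Conn-Deg h x∈ (B ++ A′) size′
      where
      size′ : length (B ++ A′) < κ
      size′ = ≤-trans (≤-reflexive (trans (cong suc (length-++ B)) (sym (+-suc _ _))))
                (≤-trans (+-monoʳ-≤ (length B) l) size)
    ... | z , z∉ , e with ∈-map⁻ a e
    ... | i , i∈ , eq = z , stays (∈V⁺ e (Inc-mkʳ x z)) z∉B , proj₂ (∉-++ {A = B} z∉) , (λ { refl → z∉B x∈B }) ,
          subst (_∈ map a Z) (sym eq) (∈-map⁺ a (∈-filter⁺ off? {xs = Y} i∈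
            (λ iw → z∉B (cover i∈ iw (subst (Inc z) eq (Inc-mkʳ x z))))))
      where
      z∉B = proj₁ (∉-++ z∉)
    absurd : ∃[ e ] (e ∈ map b Y × Inc w e) → ⊥
    absurd (e , e∈ , iw) with ∈-map⁻ b e∈
    ... | i , i∈ , refl with other-end (properʳ P i∈) iw
    -- On the `a` side the edge is spanned by `Z`, but on the `b` side it is pendant, as `Z` has no
    -- edge at `w`.
    ... | z , eq = pendant∉cl (Prʳ (Pair-⊆ Z⊆ P)) w∉ (Proper-mk⁻ (subst Proper eq (properʳ P i∈)))
                     (subst (_∈cl map b Z) eq (∈cl-transfer P Z⊆ i∈ spanned))
      where
      w∉ : w ∉ V (map b Z)
      w∉ w∈ with ∈V⁻ {map b Z} w∈
      ... | f , f∈ , iw′ with ∈-map⁻ b f∈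
      ... | j , j∈ , refl = proj₂ (∈-filter⁻ off? {xs = Y} j∈) iw′
      x = proj₁ (a i)
      y = proj₂ (a i)
      x∈B = cover i∈ iw (inj₁ refl)
      y∈B = cover i∈ iw (inj₂ refl)
      in-V : ∀ {v} → Inc v (a i) → v ∈ V (map a Y)
      in-V = ∈V⁺ (∈-map⁺ a i∈)
      s₀ : Spans (map a Z) (V Γ)
      s₀ u∈ v∈ ne = ∈cl-mono Γ⊆ (del-Spans (Prˡ P) B size h u∈ v∈ ne)
      s₂ : Spans (map a Z) (y ∷ x ∷ V Γ)
      s₂ = absorb (absorb s₀ (rich x∈B (in-V (inj₁ refl)))) λ A′ l →
        let (z , z∈ , r) = rich y∈B (in-V (inj₂ refl)) A′ l in z , there z∈ , r
      spanned : a i ∈cl map a Z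
      spanned = subst (_∈cl map a Z) (mk-of-Proper (properˡ P i∈)) (s₂ (there (here refl)) (here refl) (<⇒≢ (properˡ P i∈)))

  -- Otherwise the surviving edges meet no vertex of `R` on the `b` side. Then edges from `p` to
  -- `suc (c * length A)` distinct neighbours in `R` can be put back one by one, each pendant at its
  -- new end, and raise the rank each time; but deleting `A` on the `a` side cost at most
  -- `c * length A`.
  survive : ∀ {a b Y κ k} {R : ℕ → Set} → Pair a b Y → Conn κ (map a Y) → Decidable R →
    ∀ {p} T A → Deg k p (map b Y) → (∀ {z} → mk p z ∈ map b Y → R z ⊎ z ∈ T) →
    length A + c ≤ κ → suc (c * length A) + length T ≤ k →
    ∃[ i ] (i ∈ Y × Avoid A (a i) × (R (proj₁ (b i)) ⊎ R (proj₂ (b i))))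
  survive {a} {b} {Y} {κ} {k} {R} P h R? {p} T A deg nbr le le′
    with search (λ i → avoid? A (a i) ×-dec (R? (proj₁ (b i)) ⊎-dec R? (proj₂ (b i)))) Y
  ... | inj₁ r = r
  ... | inj₂ none = ⊥-elim (<-irrefl refl (begin
      suc (c * length A) + ρ (map b Z)  ≤⟨ proj₂ (proj₂ (grow (suc (c * length A)) le′)) ⟩
      ρ (map (mk p) L ++ map b Z)       ≤⟨ ρ-mono L⊆ ⟩
      ρ (map b Y)                       ≡⟨ sym (ρ-eq P id) ⟩
      ρ (map a Y)                       ≤⟨ ρ-del (Prˡ P) A le h ⟩
      c * length A + ρ (map a Z)        ≡⟨ cong (c * length A +_) (ρ-eq P (del⊆ a A Y)) ⟩
      c * length A + ρ (map b Z)        ∎))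
    where
    open ≤-Reasoning
    Z = del a A Y
    Star : List ℕ → Set
    Star L = ∀ {z} → z ∈ L → mk p z ∈ map b Y
    grow : ∀ m → m + length T ≤ k → ∃[ L ] ((length L ≡ m × Star L) × m + ρ (map b Z) ≤ ρ (map (mk p) L ++ map b Z))
    grow zero _ = [] , (refl , λ ()) , ≤-refl
    grow (suc m) lm with grow m (≤-trans (n≤1+n _) lm)
    ... | L , (len , star) , bnd with deg (L ++ T) (≤-trans (≤-reflexive (cong suc (trans (length-++ L) (cong (_+ length T) len)))) lm)
    ... | z , z∉ , e = z ∷ L , (cong suc len , λ { (here refl) → e ; (there q) → star q }) ,
          ≤-trans (s≤s bnd) (subst (λ f → suc (ρ X) ≤ ρ (f ∷ X)) (mk-comm z p) (pendant-ρ pX z∉X z≢p))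
      where
      X = map (mk p) L ++ map b Z
      z≢p : z ≢ p
      z≢p = ≢-sym (Proper-mk⁻ (Prʳ P e))
      Rz : R z
      Rz = [ id , (λ q → ⊥-elim (proj₂ (∉-++ {A = L} z∉) q)) ]′ (nbr e)
      pX : Pr X
      pX f∈ with ∈-++⁻ (map (mk p) L) f∈
      ... | inj₂ q = Prʳ P (map-⊆ b (del⊆ a A Y) q)
      ... | inj₁ q with ∈-map⁻ (mk p) q
      ... | y , y∈ , refl = Prʳ P (star y∈)
      z∉X : z ∉ V X
      z∉X z∈ with ∈V⁻ {X} z∈
      ... | f , f∈ , inc with ∈-++⁻ (map (mk p) L) f∈
      ... | inj₁ q with ∈-map⁻ (mk p) q
      ... | y , y∈ , refl = [ z≢p , (λ { refl → proj₁ (∉-++ z∉) y∈ }) ]′ (Inc-mk⁻ p y inc)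
      z∉X z∈ | f , f∈ , inc | inj₂ q with ∈-map⁻ b q
      ... | i , i∈ , refl with del⁻ a A Y i∈ | inc
      ... | i∈Y , av | inj₁ eq = none i∈Y (av , inj₁ (subst R (sym eq) Rz))
      ... | i∈Y , av | inj₂ eq = none i∈Y (av , inj₂ (subst R (sym eq) Rz))
    L = proj₁ (grow (suc (c * length A)) le′)
    L⊆ : map (mk p) L ++ map b Z ⊆ map b Y
    L⊆ f∈ with ∈-++⁻ (map (mk p) L) f∈
    ... | inj₂ q = map-⊆ b (del⊆ a A Y) q
    ... | inj₁ q with ∈-map⁻ (mk p) q
    ... | y , y∈ , refl = proj₂ (proj₁ (proj₂ (grow (suc (c * length A)) le′))) y∈

  record EqualCounts (a b : I → Edge) (Z : List I) : Set where
    field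
      whole : nv (map b Z) ≡ nv (map a Z)
      minus : ∀ {w} → w ∈ V (map a Z) →
              nv (map b (del a (w ∷ []) Z)) ≡ nv (map a (del a (w ∷ []) Z))
  open EqualCounts public

  StarsMatch : (a b : I → Edge) → List I → ℕ → ℕ → Set
  StarsMatch a b Z w x = ∀ {i} → i ∈ Z → (Inc w (a i) → Inc x (b i)) × (Inc x (b i) → Inc w (a i))

  -- Deleting the star of `w` makes some `b`-vertex `x` disappear, so the star of `x` lies in that
  -- of `w`. Conversely the `b`-graph without `x` has, by its size, no larger rank than the
  -- `b`-graph without the star of `w`. An edge at `w` but not at `x` would thus be spanned by the
  -- latter, although it is pendant on the `a` side.
  starMatch : ∀ {a b Z κ} → Pair a b Z → Conn κ (map a Z) → suc c ≤ κ → EqualCounts a b Z →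
              ∀ {w} → w ∈ V (map a Z) → ∃[ x ] StarsMatch a b Z w x
  starMatch {a} {b} {Z} {κ} P h le eq {w} w∈ with fresh (V-unique (map b Z)) fewer
    where
    Z′ = del a (w ∷ []) Z
    fewer : nv (map b Z′) < nv (map b Z)
    fewer = begin
      suc (nv (map b Z′))  ≡⟨ cong suc (minus eq w∈) ⟩
      suc (nv (map a Z′))  ≤⟨ length-⊆ (All.tabulate (λ y∈ → λ { refl → proj₂ (V-del a (w ∷ []) Z y∈) (here refl) }) ∷ V-unique _)
                                 (λ { (here refl) → w∈ ; (there p) → proj₁ (V-del a (w ∷ []) Z p) }) ⟩
      nv (map a Z)         ≡⟨ sym (whole eq) ⟩
      nv (map b Z)         ∎
      where open ≤-Reasoning
  ... | x , x∈ , x∉ = x , λ i∈ → forth i∈ , back i∈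
    where
    Z′ = del a (w ∷ []) Z
    Zₓ = del b (x ∷ []) Z
    off : ∀ {y e} → ¬ Inc y e → Avoid (y ∷ []) e
    off n = Avoid-of-Inc λ { i (here refl) → n i }
    back : ∀ {i} → i ∈ Z → Inc x (b i) → Inc w (a i)
    back {i} i∈ ix with inc? w (a i)
    ... | yes p = p
    ... | no p = ⊥-elim (x∉ (∈V⁺ (∈-map⁺ b (del⁺ a (w ∷ []) i∈ (off p))) ix))
    P′ = Pair-⊆ (del⊆ a (w ∷ []) Z) P
    ρₓ : ρ (map b Zₓ) ≤ ρ (map b Z′)
    ρₓ = begin
      ρ (map b Zₓ)           ≤⟨ ρ≤F (Pr-del (Prʳ P) (x ∷ [])) ⟩
      F (nv (map b Zₓ))      ≤⟨ F-mono (≤-pred count) ⟩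
      F (nv (map a Z′))      ≡⟨ sym (Spans⇒F (Pr-del (Prˡ P) (w ∷ [])) (del-Spans (Prˡ P) (w ∷ []) le h)) ⟩
      ρ (map a Z′)           ≡⟨ ρ-eq P′ id ⟩
      ρ (map b Z′)           ∎
      where
      open ≤-Reasoning
      count : suc (nv (map b Zₓ)) ≤ suc (nv (map a Z′))
      count = begin
        suc (nv (map b Zₓ))  ≤⟨ length-⊆ (All.tabulate (λ y∈ → λ { refl → proj₂ (V-del b (x ∷ []) Z y∈) (here refl) }) ∷ V-unique _)
                                   (λ { (here refl) → x∈ ; (there p) → proj₁ (V-del b (x ∷ []) Z p) }) ⟩
        nv (map b Z)         ≡⟨ whole eq ⟩
        nv (map a Z)         ≤⟨ nv-del (Prˡ P) (w ∷ []) le h ⟩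
        suc (nv (map a Z′))  ∎
    forth : ∀ {i} → i ∈ Z → Inc w (a i) → Inc x (b i)
    forth {i} i∈ iw with inc? x (b i)
    ... | yes p = p
    ... | no p with other-end (properˡ P i∈) iw
    ... | z , ai≡ = ⊥-elim (pendant∉cl (Prˡ P′) (λ q → proj₂ (V-del a (w ∷ []) Z q) (here refl))
          (Proper-mk⁻ (subst Proper ai≡ (properˡ P i∈)))
          (subst (_∈cl map a Z′) ai≡ (∈cl-transfer (Pair-swap P) (del⊆ a (w ∷ []) Z) i∈
            (≤-trans (ρ-mono sub) ρₓ))))
      where
      sub : b i ∷ map b Z′ ⊆ map b Zₓ
      sub (here refl) = ∈-map⁺ b (del⁺ b (x ∷ []) i∈ (off p))
      sub (there q) with ∈-map⁻ b q
      ... | j , j∈ , refl = ∈-map⁺ b (del⁺ b (x ∷ []) (del⊆ a (w ∷ []) Z j∈) (off λ ix → x∉ (∈V⁺ (∈-map⁺ b j∈) ix)))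

  -- An edge from `w` to a neighbour other than `w′` lies in the star of `x`, hence in the star of
  -- `w′`.
  starMatch-injective : ∀ {a b Z κ w w′ x} → Pr (map a Z) → Conn κ (map a Z) → 2 ≤ κ → w ∈ V (map a Z) →
    StarsMatch a b Z w x → StarsMatch a b Z w′ x → w ≡ w′
  starMatch-injective {a} {b} {Z} {w = w} {w′} pr h le w∈ m m′ with Conn-Deg h w∈ (w′ ∷ []) le
  ... | z , z∉ , e with ∈-map⁻ a e
  ... | i , i∈ , eq with Inc-mk⁻ w z (subst (Inc w′) (sym eq) (proj₂ (m′ i∈) (proj₁ (m i∈) (subst (Inc w) eq (Inc-mkˡ w z)))))
  ... | inj₁ p = sym p
  ... | inj₂ p = ⊥-elim (z∉ (here (sym p)))

  abstract
    starMap : ∀ {a b Z κ} → Pair a b Z → Conn κ (map a Z) → suc c ≤ κ → EqualCounts a b Z →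
      Σ (ℕ → ℕ) λ φ → ((∀ {w} → w ∈ V (map a Z) → StarsMatch a b Z w (φ w)) ×
              (∀ {w w′} → w ∈ V (map a Z) → w′ ∈ V (map a Z) → φ w ≡ φ w′ → w ≡ w′) ×
              (∀ {i} → i ∈ Z → b i ≡ mk (φ (proj₁ (a i))) (φ (proj₂ (a i)))))
    starMap {a} {b} {Z} P h le eqs = φ , match , injective , ends
      where
      φ : ℕ → ℕ
      φ w with w ∈? V (map a Z)
      ... | yes w∈ = proj₁ (starMatch P h le eqs w∈)
      ... | no _ = 0
      match : ∀ {w} → w ∈ V (map a Z) → StarsMatch a b Z w (φ w)
      match {w} w∈ with w ∈? V (map a Z)
      ... | yes w∈′ = proj₂ (starMatch P h le eqs w∈′)
      ... | no w∉ = contradiction w∈ w∉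
      injective : ∀ {w w′} → w ∈ V (map a Z) → w′ ∈ V (map a Z) → φ w ≡ φ w′ → w ≡ w′
      injective {w} {w′} w∈ w′∈ eq = starMatch-injective {b = b} (Prˡ P) h (≤-trans (s≤s c-pos) le) w∈ (match w∈)
        (subst (StarsMatch a b Z w′) (sym eq) (match w′∈))
      ends : ∀ {i} → i ∈ Z → b i ≡ mk (φ (proj₁ (a i))) (φ (proj₂ (a i)))
      ends {i} i∈ = mk-of-Inc (properʳ P i∈) (λ eq → <⇒≢ (properˡ P i∈) (injective (v∈ (inj₁ refl)) (v∈ (inj₂ refl)) eq))
          (proj₁ (match (v∈ (inj₁ refl)) i∈) (inj₁ refl)) (proj₁ (match (v∈ (inj₂ refl)) i∈) (inj₂ refl))
        where
        v∈ : ∀ {v} → Inc v (a i) → v ∈ V (map a Z)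
        v∈ = ∈V⁺ (∈-map⁺ a i∈)

-- Highly connected fragments with small boundary.

_[_] : List Edge → List ℕ → List Edge
X [ W ] = filter (_∈ₑ? K W) X

induced⁺ : ∀ {X W a b} → Pr X → mk a b ∈ X → a ∈ W → b ∈ W → mk a b ∈ X [ W ]
induced⁺ {X} {W} pr e a∈ b∈ = ∈-filter⁺ (_∈ₑ? K W) {xs = X} e (∈K⁺ a∈ b∈ (Proper-mk⁻ (pr e)))

induced⁻ : ∀ X W {e} → e ∈ X [ W ] → e ∈ X × e ∈ K W
induced⁻ X W = ∈-filter⁻ (_∈ₑ? K W) {xs = X}

-- All edges that leave `W` do so at the few vertices of `T`. The field `near` confines `W` to the
-- closed neighbourhood of `U₀`, so that a vertex strictly beyond a separator around `U₀` stays
-- outside; `core` provides a vertex whose whole star lies inside.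
record Fragment (X : List Edge) (y q : ℕ) (U₀ : List ℕ) : Set where
  field
    W T : List ℕ
    T-small : length T ≤ q
    conn : Conn y (X [ W ])
    near : ∀ {z} → z ∈ W → z ∈ U₀ ⊎ (∃[ u ] (u ∈ U₀ × mk u z ∈ X))
    inside : ∀ {u z} → u ∈ W → u ∉ T → mk u z ∈ X → z ∈ W
    core : ∃[ u ] (u ∈ W × u ∉ T × u ∈ V X)

module Fragments (X : List Edge) (pr : Pr X) (y : ℕ) (y-pos : 1 ≤ y) where

  -- The price of one split: each of fewer than `y` cut vertices weighs at most `y` for either part.
  -- If the weight before the split is at most `q`, the two parts have at most `q + q` together, and
  -- one of them is again within `q`.
  q : ℕ
  q = (y + y) * y

  adj? : ∀ s → Decidable (λ u → mk s u ∈ X)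
  adj? s u = mk s u ∈ₑ? X

  cnt : ℕ → List ℕ → ℕ
  cnt s U = length (filter (adj? s) U)

  term : List ℕ → ℕ → ℕ
  term U s with s ∈? U
  ... | yes _ = 0
  ... | no _ = y ⊓ cnt s U

  term-∈ : ∀ {U s} → s ∈ U → term U s ≡ 0
  term-∈ {U} {s} p with s ∈? U
  ... | yes _ = refl
  ... | no n = contradiction p n

  term-∉ : ∀ {U s} → s ∉ U → term U s ≡ y ⊓ cnt s U
  term-∉ {U} {s} n with s ∈? U
  ... | yes p = contradiction p n
  ... | no _ = refl

  term-≤y : ∀ U s → term U s ≤ y
  term-≤y U s with s ∈? U
  ... | yes _ = z≤n
  ... | no _ = m⊓n≤m y _

  term-≤cnt : ∀ U s → term U s ≤ cnt s U
  term-≤cnt U s with s ∈? U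
  ... | yes _ = z≤n
  ... | no _ = m⊓n≤n y _

  -- The boundary weight of U: an outside vertex with at least y neighbours in U counts as
  -- a vertex of the separator (weight y), any other one by its edges into U.
  ν : List ℕ → ℕ
  ν U = sumOver (term U) (V X)

  count-⊆ : ∀ B → length (filter (_∈? B) (V X)) ≤ length B
  count-⊆ B = length-⊆ (filter⁺ (_∈? B) (V-unique X)) (λ p → proj₂ (∈-filter⁻ (_∈? B) {xs = V X} p))

  ν-separated : ∀ {U T} → (∀ {u s} → u ∈ U → s ∉ U → mk s u ∈ X → s ∈ T) → ν U ≤ y * length T
  ν-separated {U} {T} sep = ≤-trans (sumOver-filter (_∈? T) y (term U) (V X) (λ {s} _ → term-≤y U s) zero-off)
    (*-monoʳ-≤ y (count-⊆ T))
    where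
    zero-off : ∀ {s} → s ∉ T → term U s ≤ 0
    zero-off {s} s∉T with s ∈? U
    ... | yes _ = z≤n
    ... | no s∉U = ≤-trans (m⊓n≤n y _) (≤-reflexive (length-filter-∄ (adj? s) U λ u∈ e → s∉T (sep u∈ s∉U e)))

  module _ {k : ℕ} (q+q+y<k : q + q + y < k) (deg : ∀ {u} → u ∈ V X → Deg k u X) {U₀ : List ℕ} where

    -- A separation of the graph induced on W would split U into two parts whose weights add up
    -- to at most 2q, so one of them could replace U.
    fragment : ∀ n U → length U < n → Unique U → U ⊆ V X → U ⊆ U₀ → (∃[ u ] (u ∈ U)) → ν U ≤ q →
               (Fragment X y q U₀ → ⊥) → ⊥
    fragment (suc n) U (s≤s l) uq U⊆V U⊆U₀ (u₀ , u₀∈) νU≤ handler = handler record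
        { W = W ; T = T ; T-small = T-small ; conn = record { big = big′ ; cut = cut′ }
        ; near = near ; inside = inside ; core = core }
      where
      outer? : Decidable (λ s → s ∉ U × 1 ≤ cnt s U)
      outer? s = ¬? (s ∈? U) ×-dec (1 ≤? cnt s U)
      O = filter outer? (V X)
      O-small : length O ≤ q
      O-small = ≤-trans (sumOver-count outer? (term U) (V X)
        (λ { {s} (s∉ , pos) → ≤-trans (⊓-glb y-pos pos) (≤-reflexive (sym (term-∉ s∉))) })) νU≤

      high? : Decidable (λ s → s ∉ U × y ≤ cnt s U)
      high? s = ¬? (s ∈? U) ×-dec (y ≤? cnt s U)
      W = U ++ filter high? (V X)

      -- An outside vertex with many neighbours in `U` joins `W` and becomes boundary itself; for
      -- one with few, these neighbours become boundary. Either way the cost is at most its weight,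
      -- so `T` has at most `ν U` entries.
      part : ℕ → List ℕ
      part s with s ∈? U | y ≤? cnt s U
      ... | yes _ | _ = []
      ... | no _ | yes _ = s ∷ []
      ... | no _ | no _ = filter (adj? s) U
      part-≤ : ∀ s → length (part s) ≤ term U s
      part-≤ s with s ∈? U | y ≤? cnt s U
      ... | yes _ | _ = z≤n
      ... | no _ | yes p = ⊓-glb y-pos (≤-trans y-pos p)
      ... | no _ | no p = ⊓-glb (<⇒≤ (≰⇒> p)) ≤-refl
      T = concatMap part (V X)
      T-small : length T ≤ q
      T-small = ≤-trans (≤-reflexive (length-concatMap part (V X)))
        (≤-trans (sumOver-mono _ (term U) (V X) (λ {s} _ → part-≤ s)) νU≤)
      high∈T : ∀ {s} → s ∈ V X → s ∉ U → y ≤ cnt s U → s ∈ T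
      high∈T {s} s∈ s∉ hi = ∈-concatMap⁺ part (lose s∈ self)
        where
        self : s ∈ part s
        self with s ∈? U | y ≤? cnt s U
        ... | yes p | _ = contradiction p s∉
        ... | no _ | yes _ = here refl
        ... | no _ | no p = contradiction hi p
      low∈T : ∀ {s u} → s ∈ V X → s ∉ U → ¬ (y ≤ cnt s U) → u ∈ U → mk s u ∈ X → u ∈ T
      low∈T {s} {u} s∈ s∉ lo u∈ e = ∈-concatMap⁺ part (lose s∈ self)
        where
        self : u ∈ part s
        self with s ∈? U | y ≤? cnt s U
        ... | yes p | _ = contradiction p s∉
        ... | no _ | yes p = contradiction p lo
        ... | no _ | no _ = ∈-filter⁺ (adj? s) {xs = U} u∈ e

      sw : ∀ {a b} → mk a b ∈ X → mk b a ∈ X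
      sw {a} {b} = subst (_∈ X) (mk-comm a b)
      inV : ∀ {a b} → mk a b ∈ X → b ∈ V X
      inV = ∈V-mk⁺ ∘ sw

      -- Each outside neighbour of `U` has weight at least one, so at most `q` neighbours of `u` lie
      -- outside `U`.
      inner : ∀ {u} → u ∈ U → ∀ B → length B + q < k → ∃[ z ] (z ∈ U × z ∉ B × mk u z ∈ X)
      inner {u} u∈ B lb with deg (U⊆V u∈) (B ++ O) short
        where
        short : length (B ++ O) < k
        short = ≤-trans (s≤s (≤-trans (≤-reflexive (length-++ B)) (+-monoʳ-≤ (length B) O-small))) lb
      ... | z , z∉ , e with z ∈? U
      ... | yes z∈ = z , z∈ , proj₁ (∉-++ z∉) , e
      ... | no z∉U = ⊥-elim (proj₂ (∉-++ {A = B} z∉) (∈-filter⁺ outer? {xs = V X} (inV e)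
                       (z∉U , length-filter-∃ (adj? z) u∈ (sw e))))

      hit : ∀ {s} B → length B < y → y ≤ cnt s U → ∃[ z ] (z ∈ U × z ∉ B × mk s z ∈ X)
      hit {s} B lb hi with fresh (filter⁺ (adj? s) uq) (≤-trans lb hi)
      ... | z , z∈ , z∉ = z , proj₁ (∈-filter⁻ (adj? s) {xs = U} z∈) , z∉ , proj₂ (∈-filter⁻ (adj? s) {xs = U} z∈)

      ∈W : ∀ {z} → z ∈ W → z ∈ U ⊎ (z ∈ V X × z ∉ U × y ≤ cnt z U)
      ∈W z∈ with ∈-++⁻ U z∈
      ... | inj₁ p = inj₁ p
      ... | inj₂ p with ∈-filter⁻ high? {xs = V X} p
      ... | r , s = inj₂ (r , s)
      U⊆W : U ⊆ W
      U⊆W = ∈-++⁺ˡ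
      high⊆W : ∀ {s} → s ∈ V X → s ∉ U → y ≤ cnt s U → s ∈ W
      high⊆W s∈ s∉ hi = ∈-++⁺ʳ U (∈-filter⁺ high? {xs = V X} s∈ (s∉ , hi))

      core : ∃[ u ] (u ∈ W × u ∉ T × u ∈ V X)
      core with inner u₀∈ T (≤-trans (s≤s (≤-trans (+-monoˡ-≤ q T-small) (m≤m+n (q + q) y))) q+q+y<k)
      ... | z , z∈ , z∉ , _ = z , U⊆W z∈ , z∉ , U⊆V z∈

      near : ∀ {z} → z ∈ W → z ∈ U₀ ⊎ (∃[ u ] (u ∈ U₀ × mk u z ∈ X))
      near z∈ with ∈W z∈
      ... | inj₁ p = inj₁ (U⊆U₀ p)
      ... | inj₂ (_ , _ , hi) with hit [] y-pos hi
      ... | u , u∈ , _ , e = inj₂ (u , U⊆U₀ u∈ , sw e)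

      inside : ∀ {u z} → u ∈ W → u ∉ T → mk u z ∈ X → z ∈ W
      inside {u} {z} u∈ u∉T e with ∈W u∈
      ... | inj₂ (r , s , hi) = ⊥-elim (u∉T (high∈T r s hi))
      ... | inj₁ u∈U with z ∈? U | y ≤? cnt z U
      ... | yes z∈ | _ = U⊆W z∈
      ... | no z∉ | yes hi = high⊆W (inV e) z∉ hi
      ... | no z∉ | no lo = ⊥-elim (u∉T (low∈T (inV e) z∉ lo u∈U (sw e)))

      big′ : ∀ A → length A ≤ y → ∃[ v ] (v ∈ V (X [ W ]) × v ∉ A)
      big′ A la with inner u₀∈ A (≤-trans (s≤s (≤-trans (+-monoˡ-≤ q la)
                       (≤-trans (≤-reflexive (+-comm y q)) (+-monoˡ-≤ y (m≤m+n q q))))) q+q+y<k)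
      ... | z , z∈ , z∉ , e = z , ∈V⁺ (induced⁺ pr e (U⊆W u₀∈) (U⊆W z∈)) (Inc-mkʳ _ z) , z∉

      cut′ : ∀ B → length B < y → (C : ℕ → Bool) → ∀ {p p′} → p ∈ V (X [ W ]) → p′ ∈ V (X [ W ]) →
             p ∉ B → p′ ∉ B → C p ≡ true → C p′ ≡ false →
             Crossing (X [ W ]) B C
      cut′ B lB C {p} {p′} p∈ p′∈ p∉ p′∉ Cp Cp′ with crossing? (pr ∘ proj₁ ∘ induced⁻ X W) B C
      ... | inj₁ found = found
      -- Whether the candidate `W` is sufficiently connected is never decided. `handler` receives it
      -- at once, and a failing cut that it asks about is answered by recursion on a smaller set
      -- with the same `handler`; this is why the result is `⊥`.
      ... | inj₂ none = ⊥-elim split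
        where
        differ : ∀ {x} → C x ≡ true → C x ≡ false → ⊥
        differ t f with trans (sym t) f
        ... | ()
        no-cross : ∀ {a b} → mk a b ∈ X → a ∈ W → b ∈ W → a ∉ B → b ∉ B → C a ≡ true → C b ≡ false → ⊥
        no-cross e a∈ b∈ = none (induced⁺ pr e a∈ b∈)
        p∈W : ∀ {v} → v ∈ V (X [ W ]) → v ∈ W
        p∈W v∈ with ∈V⁻ {X [ W ]} v∈
        ... | e , e∈ , i = K-Inc (proj₂ (induced⁻ X W e∈)) i
        t? : Decidable (λ z → C z ≡ true × z ∉ B)
        t? z = (C z ≟ᵇ true) ×-dec ¬? (z ∈? B)
        f? : Decidable (λ z → C z ≡ false × z ∉ B)
        f? z = (C z ≟ᵇ false) ×-dec ¬? (z ∈? B)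
        A₁ = filter t? U
        A₂ = filter f? U
        ∈A₁ : ∀ {z} → z ∈ A₁ → z ∈ U × C z ≡ true × z ∉ B
        ∈A₁ = ∈-filter⁻ t? {xs = U}
        ∈A₂ : ∀ {z} → z ∈ A₂ → z ∈ U × C z ≡ false × z ∉ B
        ∈A₂ = ∈-filter⁻ f? {xs = U}
        bool : ∀ z → C z ≡ true ⊎ C z ≡ false
        bool z with C z
        ... | true = inj₁ refl
        ... | false = inj₂ refl
        -- If `p` lies outside `U`, it has at least `y` neighbours in `U`, one of which escapes `B`
        -- and must have the colour of `p`.
        non₁ : ∃[ z ] (z ∈ A₁)
        non₁ with ∈W (p∈W p∈)
        ... | inj₁ r = p , ∈-filter⁺ t? {xs = U} r (Cp , p∉)
        ... | inj₂ (_ , _ , hi) with hit B lB hi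
        ... | z , z∈ , z∉ , e with bool z
        ... | inj₁ Cz = z , ∈-filter⁺ t? {xs = U} z∈ (Cz , z∉)
        ... | inj₂ Cz = ⊥-elim (no-cross e (p∈W p∈) (U⊆W z∈) p∉ z∉ Cp Cz)
        non₂ : ∃[ z ] (z ∈ A₂)
        non₂ with ∈W (p∈W p′∈)
        ... | inj₁ r = p′ , ∈-filter⁺ f? {xs = U} r (Cp′ , p′∉)
        ... | inj₂ (_ , _ , hi) with hit B lB hi
        ... | z , z∈ , z∉ , e with bool z
        ... | inj₂ Cz = z , ∈-filter⁺ f? {xs = U} z∈ (Cz , z∉)
        ... | inj₁ Cz = ⊥-elim (no-cross (sw e) (U⊆W z∈) (p∈W p′∈) z∉ p′∉ Cz Cp′)
        smaller : ∀ {A z} → Unique A → A ⊆ U → z ∈ U → z ∉ A → length A < n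
        smaller {A} {z} uA A⊆ z∈ z∉ = ≤-trans
          (length-⊆ (All.tabulate (λ y∈ eq → z∉ (subst (_∈ A) (sym eq) y∈)) ∷ uA)
            (λ { (here refl) → z∈ ; (there r) → A⊆ r })) l
        extra : ℕ → ℕ
        extra s with s ∈? B
        ... | yes _ = y + y
        ... | no _ = 0
        cnt₁ : ∀ {s} → s ∈ W → s ∉ B → C s ≡ false → cnt s A₁ ≡ 0
        cnt₁ {s} s∈ s∉ Cs = length-filter-∄ (adj? s) A₁ λ z∈ e → let (z∈U , Cz , z∉) = ∈A₁ z∈ in
          no-cross (sw e) (U⊆W z∈U) s∈ z∉ s∉ Cz Cs
        cnt₂ : ∀ {s} → s ∈ W → s ∉ B → C s ≡ true → cnt s A₂ ≡ 0
        cnt₂ {s} s∈ s∉ Cs = length-filter-∄ (adj? s) A₂ λ z∈ e → let (z∈U , Cz , z∉) = ∈A₂ z∈ in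
          no-cross e s∈ (U⊆W z∈U) s∉ z∉ Cs Cz
        ≤0 : ∀ {A s} → cnt s A ≡ 0 → term A s ≤ 0
        ≤0 {A} {s} eq = ≤-trans (term-≤cnt A s) (≤-reflexive eq)
        -- Outside `B`, a vertex of `W` has neighbours in one part only, and any other vertex shares
        -- its edges between the parts. Only vertices of `B` can be charged twice.
        pointwise : ∀ {s} → s ∈ V X → term A₁ s + term A₂ s ≤ term U s + extra s
        pointwise {s} s∈V with s ∈? B
        ... | yes _ = ≤-trans (+-mono-≤ (term-≤y A₁ s) (term-≤y A₂ s)) (m≤n+m (y + y) (term U s))
        ... | no s∉B = ≤-trans (go (s ∈? U) (bool s) (y ≤? cnt s U)) (m≤m+n (term U s) 0)
          where
          go : Dec (s ∈ U) → C s ≡ true ⊎ C s ≡ false → Dec (y ≤ cnt s U) → term A₁ s + term A₂ s ≤ term U s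
          go (yes s∈) (inj₁ Cs) _ = ≤-trans (+-mono-≤ (≤-reflexive (term-∈ (∈-filter⁺ t? {xs = U} s∈ (Cs , s∉B))))
            (≤0 {A₂} (cnt₂ (U⊆W s∈) s∉B Cs))) z≤n
          go (yes s∈) (inj₂ Cs) _ = ≤-trans (+-mono-≤ (≤0 {A₁} (cnt₁ (U⊆W s∈) s∉B Cs))
            (≤-reflexive (term-∈ (∈-filter⁺ f? {xs = U} s∈ (Cs , s∉B))))) z≤n
          go (no s∉) (inj₁ Cs) (yes hi) = ≤-trans (+-mono-≤ (term-≤y A₁ s) (≤0 {A₂} (cnt₂ (high⊆W s∈V s∉ hi) s∉B Cs)))
            (≤-trans (≤-reflexive (+-identityʳ y)) (≤-trans (⊓-glb ≤-refl hi) (≤-reflexive (sym (term-∉ s∉)))))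
          go (no s∉) (inj₂ Cs) (yes hi) = ≤-trans (+-mono-≤ (≤0 {A₁} (cnt₁ (high⊆W s∈V s∉ hi) s∉B Cs)) (term-≤y A₂ s))
            (≤-trans (⊓-glb ≤-refl hi) (≤-reflexive (sym (term-∉ s∉))))
          go (no s∉) _ (no lo) = ≤-trans (+-mono-≤ (term-≤cnt A₁ s) (term-≤cnt A₂ s))
            (≤-trans (length-filter-disjoint t? f? (adj? s) (λ { (a , _) (b , _) → differ a b }) U)
              (≤-trans (⊓-glb (<⇒≤ (≰⇒> lo)) ≤-refl) (≤-reflexive (sym (term-∉ s∉)))))
        extra-≤ : sumOver extra (V X) ≤ q
        extra-≤ = ≤-trans (sumOver-filter (_∈? B) (y + y) extra (V X) on off)
          (*-monoʳ-≤ (y + y) (≤-trans (count-⊆ B) (<⇒≤ lB)))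
          where
          on : ∀ {s} → s ∈ B → extra s ≤ y + y
          on {s} s∈ with s ∈? B
          ... | yes _ = ≤-refl
          ... | no _ = z≤n
          off : ∀ {s} → s ∉ B → extra s ≤ 0
          off {s} s∉ with s ∈? B
          ... | yes s∈ = contradiction s∈ s∉
          ... | no _ = z≤n
        total : ν A₁ + ν A₂ ≤ q + q
        total = ≤-trans (sumOver-+ (term A₁) (term A₂) (term U) extra (V X) pointwise) (+-mono-≤ νU≤ extra-≤)
        split : ⊥
        split with ν A₁ ≤? q
        ... | yes le = fragment n A₁ (smaller (filter⁺ t? uq) (proj₁ ∘ ∈A₁) (proj₁ (∈A₂ (proj₂ non₂)))
                           (λ r → differ (proj₁ (proj₂ (∈A₁ r))) (proj₁ (proj₂ (∈A₂ (proj₂ non₂))))))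
                         (filter⁺ t? uq) (U⊆V ∘ proj₁ ∘ ∈A₁) (U⊆U₀ ∘ proj₁ ∘ ∈A₁) non₁ le handler
        ... | no gt = fragment n A₂ (smaller (filter⁺ f? uq) (proj₁ ∘ ∈A₂) (proj₁ (∈A₁ (proj₂ non₁)))
                           (λ r → differ (proj₁ (proj₂ (∈A₁ (proj₂ non₁)))) (proj₁ (proj₂ (∈A₂ r)))))
                         (filter⁺ f? uq) (U⊆V ∘ proj₁ ∘ ∈A₂) (U⊆U₀ ∘ proj₁ ∘ ∈A₂) non₂
                         (+-cancelˡ-≤ q _ _ (≤-trans (+-monoˡ-≤ (ν A₂) (<⇒≤ (≰⇒> gt))) total)) handler

-- Exchanging two inner vertices of a fragment.

module Twins (M : GraphMatroidFamily) (unb : Unbounded M) (c : ℕ) (c-pos : 1 ≤ c)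
  (rigid : ∀ {X} → Pr X → Conn c X → Rank.Spans M X (V X)) (I : Set) where

  open Rank M
  open NewVertex M unb
  open Rigidity M unb c c-pos rigid
  open Pairs M unb c c-pos rigid I

  Conn-resp : ∀ {κ X X′} → X ⊆ X′ → X′ ⊆ X → Conn κ X → Conn κ X′
  Conn-resp s t h = record
    { big = λ A l → let (v , v∈ , v∉) = big h A l in v , V-mono s v∈ , v∉
    ; cut = λ A l C u∈ v∈ u∉ v∉ Cu Cv →
        let (a , b , a∉ , b∉ , Ca , Cb , e) = cut h A l C (V-mono t u∈) (V-mono t v∈) u∉ v∉ Cu Cv in
        a , b , a∉ , b∉ , Ca , Cb , s e }

  induced : (I → Edge) → List I → List ℕ → List I
  induced b Y W = filter (λ i → b i ∈ₑ? K W) Y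

  induced-⊆ : ∀ b Y W → induced b Y W ⊆ Y
  induced-⊆ b Y W = proj₁ ∘ ∈-filter⁻ (λ i → b i ∈ₑ? K W) {xs = Y}

  induced-K : ∀ b Y W {i} → i ∈ induced b Y W → b i ∈ K W
  induced-K b Y W = proj₂ ∘ ∈-filter⁻ (λ i → b i ∈ₑ? K W) {xs = Y}

  induced-Conn : ∀ {b Y W y} → Conn y (map b Y [ W ]) → Conn y (map b (induced b Y W))
  induced-Conn {b} {Y} {W} = Conn-resp to from
    where
    to : map b Y [ W ] ⊆ map b (induced b Y W)
    to e∈ with induced⁻ (map b Y) W e∈
    ... | q₁ , q₂ with ∈-map⁻ b q₁
    ... | i , i∈ , refl = ∈-map⁺ b (∈-filter⁺ (λ i → b i ∈ₑ? K W) {xs = Y} i∈ q₂)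
    from : map b (induced b Y W) ⊆ map b Y [ W ]
    from e∈ with ∈-map⁻ b e∈
    ... | i , i∈ , refl = ∈-filter⁺ (_∈ₑ? K W) {xs = map b Y} (∈-map⁺ b (induced-⊆ b Y W i∈)) (induced-K b Y W i∈)

  -- `R` collects the vertices on red edges. If it misses the chosen end of `j`, an edge leaving `R`
  -- is not red, and its end in `R` meets both kinds.
  bichromatic : ∀ {a Y κ} {Red : I → Set} → Pr (map a Y) → Conn κ (map a Y) → Decidable Red →
    ∀ A → length A < κ → ∀ {i j} → i ∈ Y → Avoid A (a i) → Red i → j ∈ Y → Avoid A (a j) → ¬ Red j →
    ∃[ x ] (x ∉ A × (∃[ r ] (r ∈ Y × Avoid A (a r) × Red r × Inc x (a r))) ×
                    (∃[ s ] (s ∈ Y × Avoid A (a s) × ¬ Red s × Inc x (a s))))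
  bichromatic {a} {Y} {κ} {Red} pr h red? A lt {i} {j} i∈ iA ri j∈ jA rj = go (v ∈? R)
    where
    N = filter red? (del a A Y)
    R = V (map a N)
    ∈N : ∀ {l} → l ∈ Y → Avoid A (a l) → Red l → l ∈ N
    ∈N l∈ lA rl = ∈-filter⁺ red? {xs = del a A Y} (del⁺ a A l∈ lA) rl
    ∈R : ∀ {x} → x ∈ R → ∃[ r ] (r ∈ Y × Avoid A (a r) × Red r × Inc x (a r))
    ∈R x∈ with ∈V⁻ {map a N} x∈
    ... | e , e∈ , inc with ∈-map⁻ a e∈
    ... | r , r∈ , refl with ∈-filter⁻ red? {xs = del a A Y} r∈
    ... | p , rr = r , proj₁ (del⁻ a A Y p) , proj₂ (del⁻ a A Y p) , rr , inc
    u = proj₁ (a i)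
    v = proj₁ (a j)
    go : Dec (v ∈ R) → _
    go (yes v∈) = v , proj₁ jA , ∈R v∈ , j , j∈ , jA , rj , inj₁ refl
    go (no v∉) with cut h A lt (member R) (∈V⁺ (∈-map⁺ a i∈) (inj₁ refl)) (∈V⁺ (∈-map⁺ a j∈) (inj₁ refl))
                      (proj₁ iA) (proj₁ jA) (member⁺ (∈V⁺ (∈-map⁺ a (∈N i∈ iA ri)) (inj₁ refl))) (member⁻ v∉)
    ... | p , r , p∉ , r∉ , Cp , Cr , e with ∈-map⁻ a e
    ... | l , l∈ , eq = p , p∉ , ∈R (member-true Cp) , l , l∈ , lA ,
          (λ rl → member-false Cr (∈V⁺ (∈-map⁺ a (∈N l∈ lA rl)) (subst (Inc r) eq (Inc-mkʳ p r)))) ,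
          subst (Inc p) eq (Inc-mkˡ p r)
      where
      lA = subst (Avoid A) eq (Avoid-mk p∉ r∉)

  -- Exchanging w₁ and w₂ does not affect the b-ranks, whereas the corresponding a-vertices x₁ and x₂
  -- meet different edges outside the fragment.
  exchange-⊥ : ∀ {a b Y κ y} W → Pair a b Y → Conn κ (map a Y) → 2 + c ≤ κ →
    Conn y (map b (induced b Y W)) → suc c * 2 + c ≤ y →
    ∀ {w₁ w₂ x₁ x₂} → w₁ ∈ V (map b (induced b Y W)) → w₂ ∈ V (map b (induced b Y W)) → w₁ ≢ w₂ → x₂ ≢ x₁ →
    (∀ {i} → i ∈ Y → Inc w₁ (b i) → i ∈ induced b Y W) → (∀ {i} → i ∈ Y → Inc w₂ (b i) → i ∈ induced b Y W) →
    StarsMatch b a (induced b Y W) w₁ x₁ → StarsMatch b a (induced b Y W) w₂ x₂ →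
    ∀ {j} → j ∈ Y → ¬ Inc x₁ (a j) → j ∉ induced b Y W → Inc x₂ (a j) → ⊥
  exchange-⊥ {a} {b} {Y} {κ} {y} W P h sz connZ ly {w₁} {w₂} {x₁} {x₂} w₁∈ w₂∈ w₁≢w₂ x₂≢x₁ in₁ in₂ match₁ match₂
    {j} j∈ jx₁ j∉Z jx = <-irrefl refl (begin-strict
      ρ (map a N₁)            ≡⟨ Spans⇒F (Pr-del (Prˡ P) (x₁ ∷ [])) (del-Spans (Prˡ P) (x₁ ∷ []) (≤-trans (n≤1+n _) sz) h) ⟩
      F (nv (map a N₁))       ≤⟨ F-mono nv≤ ⟩
      F (suc (nv Γ))          ≤⟨ F≤K uq ⟩
      ρ (K (x₁ ∷ V Γ))        ≤⟨ Spans⇒ρ {map a D} {x₁ ∷ V Γ} spanD ⟩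
      ρ (map a D)             <⟨ subst (λ e → suc (ρ (map a D)) ≤ ρ (e ∷ map a D)) (sym (proj₂ jz))
                                   (pendant-ρ prD x₂∉D (Proper-mk⁻ (subst Proper (proj₂ jz) (properˡ P j∈)))) ⟩
      ρ (map a (j ∷ D))       ≤⟨ ρ-mono (map-⊆ a jD⊆) ⟩
      ρ (map a Rgt)           ≡⟨ ρ-eq P Rgt⊆ ⟩
      ρ (map b Rgt)           ≤⟨ exchange ⟩
      ρ (map b Lft)           ≡⟨ sym (ρ-eq P Lft⊆) ⟩
      ρ (map a Lft)           ≤⟨ ρ-mono (map-⊆ a Lft⊆N₁) ⟩
      ρ (map a N₁)            ∎)
    where
    open ≤-Reasoning
    Z : List I
    Z = induced b Y W
    Z⊆ : Z ⊆ Y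
    Z⊆ = induced-⊆ b Y W
    ∈Z : ∀ {i} → i ∈ Y → b i ∈ K W → i ∈ Z
    ∈Z = ∈-filter⁺ (λ i → b i ∈ₑ? K W) {xs = Y}
    PZ : Pair a b Z
    PZ = Pair-⊆ Z⊆ P
    szZ : suc c ≤ y
    szZ = ≤-trans (s≤s (≤-trans (m≤m*n c 2) (≤-trans (n≤1+n _) (m≤m+n _ c)))) ly
    off : ∀ {v e} → ¬ Inc v e → Avoid (v ∷ []) e
    off n = Avoid-of-Inc λ { i (here refl) → n i }
    on : ∀ {v e} → Avoid (v ∷ []) e → ¬ Inc v e
    on av i = Avoid-Inc av i (here refl)
    rest? : Decidable (λ i → b i ∉ K W × ¬ Inc x₁ (a i))
    rest? i = ¬? (b i ∈ₑ? K W) ×-dec ¬? (inc? x₁ (a i))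
    R = filter rest? Y
    ∈R : ∀ {i} → i ∈ R → i ∈ Y × b i ∉ K W × ¬ Inc x₁ (a i)
    ∈R = ∈-filter⁻ rest? {xs = Y}
    Z₁ = del b (w₁ ∷ []) Z
    Z₂ = del b (w₂ ∷ []) Z
    -- Both lists share `R`, the edges outside the fragment that miss `x₁`. On the `a` side `Lft`
    -- avoids `x₁` altogether, whereas `Rgt` without the star of `x₂` already spans as many vertices
    -- as the graph without `x₁`, and `j` adds one more rank at `x₂`.
    Lft = Z₁ ++ R
    Rgt = Z₂ ++ R
    Lft⊆ : Lft ⊆ Y
    Lft⊆ i∈ = [ Z⊆ ∘ del⊆ b (w₁ ∷ []) Z , proj₁ ∘ ∈R ]′ (∈-++⁻ Z₁ i∈)
    Rgt⊆ : Rgt ⊆ Y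
    Rgt⊆ i∈ = [ Z⊆ ∘ del⊆ b (w₂ ∷ []) Z , proj₁ ∘ ∈R ]′ (∈-++⁻ Z₂ i∈)
    N₁ = del a (x₁ ∷ []) Y
    Lft⊆N₁ : Lft ⊆ N₁
    Lft⊆N₁ i∈ with ∈-++⁻ Z₁ i∈
    ... | inj₂ r = del⁺ a (x₁ ∷ []) (proj₁ (∈R r)) (off (proj₂ (proj₂ (∈R r))))
    ... | inj₁ r with del⁻ b (w₁ ∷ []) Z r
    ... | i∈Z , av = del⁺ a (x₁ ∷ []) (Z⊆ i∈Z) (off λ ix → on av (proj₂ (match₁ i∈Z) ix))

    N₁₂ = del a (x₁ ∷ x₂ ∷ []) Y
    Γ = map a N₁₂
    D = del a (x₂ ∷ []) Rgt
    D⊆Y : D ⊆ Y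
    D⊆Y = Rgt⊆ ∘ del⊆ a (x₂ ∷ []) Rgt
    prD : Pr (map a D)
    prD = Prˡ (Pair-⊆ D⊆Y P)
    x₂∉D : x₂ ∉ V (map a D)
    x₂∉D v∈ = proj₂ (V-del a (x₂ ∷ []) Rgt v∈) (here refl)
    jz = other-end (properˡ P j∈) jx
    jD⊆ : j ∷ D ⊆ Rgt
    jD⊆ (there r) = del⊆ a (x₂ ∷ []) Rgt r
    jD⊆ (here refl) = ∈-++⁺ʳ Z₂ (∈-filter⁺ rest? {xs = Y} j∈ ((λ jK → j∉Z (∈Z j∈ jK)) , jx₁))
    ∈D : ∀ {i} → i ∈ Y → ¬ Inc x₂ (a i) → i ∈ Z ⊎ ¬ Inc x₁ (a i) → i ∈ D
    ∈D {i} i∈ nx c′ with b i ∈ₑ? K W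
    ... | yes iK = del⁺ a (x₂ ∷ []) (∈-++⁺ˡ (del⁺ b (w₂ ∷ []) (∈Z i∈ iK)
                     (off λ iw → nx (proj₁ (match₂ (∈Z i∈ iK)) iw)))) (off nx)
    ... | no nK = del⁺ a (x₂ ∷ []) (∈-++⁺ʳ Z₂ (∈-filter⁺ rest? {xs = Y} i∈ (nK ,
                     [ (λ iZ → ⊥-elim (nK (induced-K b Y W iZ))) , id ]′ c′))) (off nx)
    N⊆D : N₁₂ ⊆ D
    N⊆D i∈ with del⁻ a (x₁ ∷ x₂ ∷ []) Y i∈
    ... | i∈Y , av = ∈D i∈Y (λ ix → Avoid-Inc av ix (there (here refl))) (inj₂ λ ix → Avoid-Inc av ix (here refl))
    stays = proj₁ (del-Conn (Prˡ P) (x₁ ∷ x₂ ∷ []) sz c-pos h)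
    x₁∈ : x₁ ∈ V (map a Z)
    x₁∈ with ∈V⁻ {map b Z} w₁∈
    ... | e , e∈ , iw with ∈-map⁻ b e∈
    ... | i , i∈ , refl = ∈V⁺ (∈-map⁺ a i∈) (proj₁ (match₁ i∈) iw)
    rich : ∀ A → length A < c → ∃[ z ] (z ∈ V Γ × z ∉ A × x₁ ≢ z × mk x₁ z ∈ map a D)
    -- One neighbour more than `c`, because `x₂` must be avoided too; this gives the constant
    -- `suc c * 2 + c`.
    rich A l with minDeg {k = suc c} (Pair-swap PZ) ly connZ x₁∈ (x₂ ∷ A) (s≤s l)
    ... | z , z∉ , e with ∈-map⁻ a e
    ... | i , i∈ , eq = z , stays (∈V⁺ (map-⊆ a Z⊆ e) (Inc-mkʳ x₁ z)) z∉₁₂ , z∉ ∘ there , x₁≢z ,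
          subst (_∈ map a D) (sym eq) (∈-map⁺ a (∈D (Z⊆ i∈) nx (inj₁ i∈)))
      where
      x₁≢z : x₁ ≢ z
      x₁≢z = Proper-mk⁻ (Prˡ PZ e)
      z∉₁₂ : z ∉ x₁ ∷ x₂ ∷ []
      z∉₁₂ (here r) = x₁≢z (sym r)
      z∉₁₂ (there (here r)) = z∉ (here r)
      nx : ¬ Inc x₂ (a i)
      nx ix = [ x₂≢x₁ , (λ r → z∉ (here (sym r))) ]′ (Inc-mk⁻ x₁ z (subst (Inc x₂) (sym eq) ix))
    spanD : Spans (map a D) (x₁ ∷ V Γ)
    spanD = absorb (λ u∈ v∈ ne → ∈cl-mono (map-⊆ a N⊆D) (del-Spans (Prˡ P) (x₁ ∷ x₂ ∷ []) sz h u∈ v∈ ne)) rich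
    uq : Unique (x₁ ∷ V Γ)
    uq = All.tabulate (λ z∈ → λ { refl → proj₂ (V-del a (x₁ ∷ x₂ ∷ []) Y z∈) (here refl) }) ∷ V-unique Γ
    nv≤ : nv (map a N₁) ≤ suc (nv Γ)
    nv≤ = length-⊆ (V-unique _) sub
      where
      sub : V (map a N₁) ⊆ x₂ ∷ V Γ
      sub {z} z∈ with z ≟ x₂ | V-del a (x₁ ∷ []) Y z∈
      ... | yes r | _ = here r
      ... | no r | z∈Y , z∉ = there (stays z∈Y λ { (here s) → z∉ (here s) ; (there (here s)) → r s })

    τ = transpose w₁ w₂
    V₁ = V (map b Z₁)
    V₂ = V (map b Z₂)
    stays₁ = proj₁ (del-Conn (Prʳ PZ) (w₁ ∷ []) szZ c-pos connZ)
    τ-V : ∀ {v} → v ∈ V₂ → τ v ∈ V₁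
    τ-V {v} v∈ with V-del b (w₂ ∷ []) Z v∈
    ... | v∈Z , v∉ with v ≟ w₁
    ... | yes refl = subst (_∈ V₁) (sym (transpose-ˡ w₁ w₂)) (stays₁ w₂∈ λ { (here r) → w₁≢w₂ (sym r) })
    ... | no v≢ = subst (_∈ V₁) (sym (transpose-≢ v≢ (λ r → v∉ (here r)))) (stays₁ v∈Z λ { (here r) → v≢ r })
    R-off : ∀ {i w} → i ∈ R → (∀ {l} → l ∈ Y → Inc w (b l) → l ∈ Z) → ¬ Inc w (b i)
    R-off i∈ closed iw = proj₁ (proj₂ (∈R i∈)) (induced-K b Y W (closed (proj₁ (∈R i∈)) iw))
    τ-fix : ∀ {i} → i ∈ R → rename τ (b i) ≡ b i
    τ-fix {i} i∈ = trans (cong₂ mk (fix (inj₁ refl)) (fix (inj₂ refl))) (mk-of-Proper (properʳ P (proj₁ (∈R i∈))))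
      where
      fix : ∀ {v} → Inc v (b i) → τ v ≡ v
      fix iv = transpose-≢ (λ { refl → R-off i∈ in₁ iv }) (λ { refl → R-off i∈ in₂ iv })
    X₁ = K V₁ ++ map b R
    X₂ = K V₂ ++ map b R
    prX₂ : Pr X₂
    prX₂ e∈ = [ K-Pr V₂ , (λ r → Prʳ P (map-⊆ b (proj₁ ∘ ∈R) r)) ]′ (∈-++⁻ (K V₂) e∈)
    image : map (rename τ) X₂ ⊆ X₁
    image e∈ with ∈-map⁻ (rename τ) e∈
    ... | g , g∈ , refl with ∈-++⁻ (K V₂) g∈
    ... | inj₁ r with ∈K⁻ r
    ... | pg , u∈ , v∈ = ∈-++⁺ˡ (∈K⁺ (τ-V u∈) (τ-V v∈) λ eq → <⇒≢ pg (transpose-injective w₁ w₂ eq))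
    image e∈ | g , g∈ , refl | inj₂ r with ∈-map⁻ b r
    ... | i , i∈ , refl = ∈-++⁺ʳ (K V₁) (subst (_∈ map b R) (sym (τ-fix i∈)) (∈-map⁺ b i∈))
    split : ∀ Z′ {e} → e ∈ map b (Z′ ++ R) → e ∈ map b Z′ ⊎ e ∈ map b R
    split Z′ e∈ with ∈-map⁻ b e∈
    ... | i , i∈ , refl = [ inj₁ ∘ ∈-map⁺ b , inj₂ ∘ ∈-map⁺ b ]′ (∈-++⁻ Z′ i∈)
    exchange : ρ (map b Rgt) ≤ ρ (map b Lft)
    exchange = begin
      ρ (map b Rgt)           ≤⟨ ρ-mono (λ e∈ → [ ∈-++⁺ˡ ∘ ⊆K-V (Pr-del (Prʳ PZ) (w₂ ∷ [])) , ∈-++⁺ʳ (K V₂) ]′ (split Z₂ e∈)) ⟩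
      ρ X₂                    ≡⟨ sym (ρ-rename prX₂ (λ _ _ → transpose-injective w₁ w₂)) ⟩
      ρ (map (rename τ) X₂)   ≤⟨ ρ-mono image ⟩
      ρ X₁                    ≤⟨ ρ-cl X₁-cl ⟩
      ρ (map b Lft)           ∎
      where
      X₁-cl : ∀ {e} → e ∈ X₁ → e ∈cl map b Lft
      X₁-cl e∈ with ∈-++⁻ (K V₁) e∈
      ... | inj₁ r = ∈cl-mono (map-⊆ b ∈-++⁺ˡ) (Spans-K {map b Z₁} {V₁} (del-Spans (Prʳ PZ) (w₁ ∷ []) szZ connZ) r)
      ... | inj₂ r = ∈cl-∈ (map-⊆ b (∈-++⁺ʳ Z₁) r)


  -- Call an edge red if a `b`-end lies in `W` but not in `T`; red edges belong to the fragment,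
  -- whose vertices correspond on both sides by `eqs`. By `survive`, both red and other edges remain
  -- after deleting `suc q` `a`-vertices: the former through `core`, the latter through `p`.
  -- Deleting the images of `T` thus leaves an `a`-vertex with edges of both kinds, and it is the
  -- image of an inner vertex of the fragment.
  twins : ∀ {a b Y κ k y q U₀} → Pair a b Y → Conn κ (map a Y) →
    (∀ {u} → u ∈ V (map b Y) → Deg k u (map b Y)) → (f : Fragment (map b Y) y q U₀) →
    ∀ {p} → p ∈ V (map b Y) → p ∉ Fragment.W f →
    EqualCounts b a (induced b Y (Fragment.W f)) →
    suc (c * suc q) + q ≤ k → suc (suc q) + c ≤ κ → suc c * 2 + c ≤ y → ⊥
  twins {a} {b} {Y} {κ} {k} {y} {q} P h deg f {p} p∈ p∉W eqs lk lκ ly = clash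
    where
    open Fragment f
    Z : List I
    Z = induced b Y W
    Z⊆ : Z ⊆ Y
    Z⊆ = induced-⊆ b Y W
    ∈Z : ∀ {i} → i ∈ Y → b i ∈ K W → i ∈ Z
    ∈Z = ∈-filter⁺ (λ i → b i ∈ₑ? K W) {xs = Y}
    Z-K : ∀ {i} → i ∈ Z → b i ∈ K W
    Z-K = induced-K b Y W
    PZ : Pair a b Z
    PZ = Pair-⊆ Z⊆ P
    1<c+c : suc (suc c) ≤ suc c * 2 + c
    1<c+c = ≤-trans (s≤s (s≤s (m≤m*n c 2))) (m≤m+n _ c)
    szZ : suc c ≤ y
    szZ = ≤-trans (n≤1+n _) (≤-trans 1<c+c ly)
    connZ : Conn y (map b Z)
    connZ = induced-Conn {b} {Y} conn
    stars = starMap (Pair-swap PZ) connZ szZ eqs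
    img : ℕ → ℕ
    img = proj₁ stars
    img-match : ∀ {w} → w ∈ V (map b Z) → StarsMatch b a Z w (img w)
    img-match = proj₁ (proj₂ stars)
    img-ends : ∀ {i} → i ∈ Z → a i ≡ mk (img (proj₁ (b i))) (img (proj₂ (b i)))
    img-ends = proj₂ (proj₂ (proj₂ stars))

    Core : ℕ → Set
    Core z = z ∈ W × z ∉ T
    core? : Decidable Core
    core? z = (z ∈? W) ×-dec ¬? (z ∈? T)
    Red : I → Set
    Red i = Core (proj₁ (b i)) ⊎ Core (proj₂ (b i))
    red? : Decidable Red
    red? i = core? (proj₁ (b i)) ⊎-dec core? (proj₂ (b i))
    Core⇒Z : ∀ {i w} → i ∈ Y → Inc w (b i) → Core w → i ∈ Z
    Core⇒Z {i} {w} i∈ iw (w∈ , w∉) with other-end (properʳ P i∈) iw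
    ... | z , eq = ∈Z i∈ (subst (_∈ K W) (sym eq) (∈K⁺ w∈ (inside w∈ w∉ e) (Proper-mk⁻ (Prʳ P e))))
      where
      e : mk w z ∈ map b Y
      e = subst (_∈ map b Y) eq (∈-map⁺ b i∈)
    Red⇒Z : ∀ {i} → i ∈ Y → Red i → i ∈ Z
    Red⇒Z i∈ (inj₁ r) = Core⇒Z i∈ (inj₁ refl) r
    Red⇒Z i∈ (inj₂ r) = Core⇒Z i∈ (inj₂ refl) r

    Picked : List ℕ → Set
    Picked A = ∃[ w ] ((Core w × w ∈ V (map b Z)) × img w ∉ A ×
                       ∃[ j ] (j ∈ Y × Avoid A (a j) × ¬ Red j × Inc (img w) (a j)))

    finish : ∀ A → map img T ⊆ A → ∀ {x} → x ∉ A → ∀ {r} → r ∈ Y → Red r → Inc x (a r) →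
             ∃[ j ] (j ∈ Y × Avoid A (a j) × ¬ Red j × Inc x (a j)) → Picked A
    finish A T⊆A {x} x∉ {r} r∈ rr rx blue = [ result (inj₁ refl) , result (inj₂ refl) ]′
        (Inc-mk⁻ _ _ (subst (Inc x) (img-ends r∈Z) rx))
      where
      r∈Z : r ∈ Z
      r∈Z = Red⇒Z r∈ rr
      v∈ : ∀ {v} → Inc v (b r) → v ∈ V (map b Z)
      v∈ = ∈V⁺ (∈-map⁺ b r∈Z)
      result : ∀ {v} → Inc v (b r) → x ≡ img v → Picked A
      result {v} iv refl = v , ((K-Inc (Z-K r∈Z) iv ,
                                  (λ v∈T → x∉ (T⊆A (∈-map⁺ img v∈T)))) , v∈ iv) , x∉ , blue

    redAvoiding : ∀ A → length A ≤ suc q → ∃[ i ] (i ∈ Y × Avoid A (a i) × Red i)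
    redAvoiding A lA = survive P h core? T A (deg (proj₂ (proj₂ (proj₂ core)))) nbr
        (≤-trans (+-monoˡ-≤ c lA) (≤-trans (n≤1+n _) lκ))
        (≤-trans (+-mono-≤ (s≤s (*-monoʳ-≤ c lA)) T-small) lk)
      where
      nbr : ∀ {z} → mk (proj₁ core) z ∈ map b Y → Core z ⊎ z ∈ T
      nbr {z} e with z ∈? T
      ... | yes r = inj₂ r
      ... | no r = inj₁ (inside (proj₁ (proj₂ core)) (proj₁ (proj₂ (proj₂ core))) e , r)

    blueAvoiding : ∀ A → length A ≤ suc q → ∃[ i ] (i ∈ Y × Avoid A (a i) × ¬ Red i)
    blueAvoiding A lA = blue (survive P h (λ z → ¬? (z ∈? W)) T A (deg p∈) nbr
        (≤-trans (+-monoˡ-≤ c lA) (≤-trans (n≤1+n _) lκ))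
        (≤-trans (+-mono-≤ (s≤s (*-monoʳ-≤ c lA)) T-small) lk))
      where
      nbr : ∀ {z} → mk p z ∈ map b Y → z ∉ W ⊎ z ∈ T
      nbr {z} e with z ∈? W | z ∈? T
      ... | no r | _ = inj₁ r
      ... | yes _ | yes r = inj₂ r
      ... | yes z∈ | no z∉ = ⊥-elim (p∉W (inside z∈ z∉ (subst (_∈ map b Y) (mk-comm p z) e)))
      blue : ∃[ i ] (i ∈ Y × Avoid A (a i) × (proj₁ (b i) ∉ W ⊎ proj₂ (b i) ∉ W)) →
             ∃[ i ] (i ∈ Y × Avoid A (a i) × ¬ Red i)
      blue (j , j∈ , jA , out) = j , j∈ , jA , λ rj →
        [ (λ o → o (K-Inc (Z-K (Red⇒Z j∈ rj)) (inj₁ refl))) , (λ o → o (K-Inc (Z-K (Red⇒Z j∈ rj)) (inj₂ refl))) ]′ out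

    pick : ∀ A → length A ≤ suc q → map img T ⊆ A → Picked A
    pick A lA T⊆A = choose (redAvoiding A lA) (blueAvoiding A lA)
      where
      choose : ∃[ i ] (i ∈ Y × Avoid A (a i) × Red i) → ∃[ i ] (i ∈ Y × Avoid A (a i) × ¬ Red i) → Picked A
      choose (i , i∈ , iA , ri) (j , j∈ , jA , rj) =
        let (x , x∉ , (r , r∈ , _ , rr , rx) , blue) =
              bichromatic (Prˡ P) h red? A (≤-trans (s≤s lA) (≤-trans (m≤m+n _ c) lκ)) i∈ iA ri j∈ jA rj
        in finish A T⊆A x∉ r∈ rr rx blue

    A₀ = map img T
    A₀-small : length A₀ ≤ q
    A₀-small = ≤-trans (≤-reflexive (length-map img T)) T-small

    outside-Z : ∀ {w j} → Core w → w ∈ V (map b Z) → ¬ Red j → Inc (img w) (a j) → j ∉ Z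
    outside-Z {w} {j} cw w∈ jr jx j∈ = jr (at (proj₂ (img-match w∈ j∈) jx))
      where
      at : Inc w (b j) → Red j
      at (inj₁ refl) = inj₁ cw
      at (inj₂ refl) = inj₂ cw

    clash : ⊥
    clash =
      -- The second choice also deletes the image of `w₁`, which takes the extra place in `suc q`
      -- and keeps the edge `j` away from that image.
      let (w₁ , (core₁ , w₁∈) , _ , _) = pick A₀ (≤-trans A₀-small (n≤1+n q)) id
          (w₂ , (core₂ , w₂∈) , x₂∉ , j , j∈ , jA , jr , jx) = pick (img w₁ ∷ A₀) (s≤s A₀-small) there
      in exchange-⊥ W P h (≤-trans (+-monoˡ-≤ c (s≤s (s≤s z≤n))) lκ) connZ ly w₁∈ w₂∈
           (λ eq → x₂∉ (here (cong img (sym eq)))) (λ eq → x₂∉ (here eq))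
           (λ i∈ iw → Core⇒Z i∈ iw core₁) (λ i∈ iw → Core⇒Z i∈ iw core₂) (img-match w₁∈) (img-match w₂∈)
           j∈ (λ ix → Avoid-Inc jA ix (here refl)) (outside-Z core₂ w₂∈ jr jx) jx

-- Separations, and the passage to fragments.

record Separation (X : List Edge) (c : ℕ) : Set where
  field
    side : ℕ → Bool
    sep : List ℕ
    sep-small : length sep ≤ c
    u v : ℕ
    u∈ : u ∈ V X
    v∈ : v ∈ V X
    u∉ : u ∉ sep
    v∉ : v ∉ sep
    side-u : side u ≡ true
    side-v : side v ≡ false
    separated : ∀ {a b} → mk a b ∈ X → a ∉ sep → b ∉ sep → side a ≡ true → side b ≡ false → ⊥

  Inner Outer : ℕ → Set
  Inner z = side z ≡ true × z ∉ sep
  Outer z = side z ≡ false × z ∉ sep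

  inner? : Decidable Inner
  inner? z = (side z ≟ᵇ true) ×-dec ¬? (z ∈? sep)

  outer? : Decidable Outer
  outer? z = (side z ≟ᵇ false) ×-dec ¬? (z ∈? sep)

  exclusive : ∀ {z} → Inner z → Outer z → ⊥
  exclusive (p , _) (q , _) with trans (sym p) q
  ... | ()

  inner-nbr : ∀ {w z} → Inner w → mk w z ∈ X → Inner z ⊎ z ∈ sep
  inner-nbr {w} {z} (p , w∉) e with z ∈? sep | side z in eq
  ... | yes r | _ = inj₂ r
  ... | no r | true = inj₁ (refl , r)
  ... | no r | false = ⊥-elim (separated e w∉ r p eq)

  outer-nbr : ∀ {w z} → Outer w → mk w z ∈ X → Outer z ⊎ z ∈ sep
  outer-nbr {w} {z} (p , w∉) e with z ∈? sep | side z in eq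
  ... | yes r | _ = inj₂ r
  ... | no r | false = inj₁ (refl , r)
  ... | no r | true = ⊥-elim (separated (subst (_∈ X) (mk-comm w z) e) r w∉ eq p)

module Descent (M : GraphMatroidFamily) (unb : Unbounded M) (c : ℕ) (c-pos : 1 ≤ c)
  (rigid : ∀ {X} → Pr X → Conn c X → Rank.Spans M X (V X)) (I : Set) where

  open Rank M
  open NewVertex M unb
  open Rigidity M unb c c-pos rigid
  open Pairs M unb c c-pos rigid I
  open Twins M unb c c-pos rigid I

  -- `qOf` is the boundary size from `Fragments`. The summands of `kOf` are the degrees required by
  -- `twins` and by `fragment`; those of `κOf` are the connectivities required by `minDeg` for that
  -- degree and by `twins`.
  qOf kOf κOf : ℕ → ℕ
  qOf y = (y + y) * y
  kOf y = (suc (c * suc (qOf y)) + qOf y) + suc (qOf y + qOf y + y)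
  κOf y = (kOf y * 2 + c) + (suc (suc (qOf y)) + c)

  inner : ∀ {X} → Separation X c → List ℕ
  inner {X} S = filter (Separation.inner? S) (V X)

  -- The search starts from the inner side of `S`, whose weight is at most `y` for each separator
  -- vertex. The vertex `v` of the other side stays outside the fragment and serves as `p` in
  -- `twins`.
  fragment-⊥ : ∀ {a b Y κ y} → Pair a b Y → Conn κ (map a Y) → (S : Separation (map b Y) c) →
    suc c * 2 + c ≤ y → κOf y ≤ κ →
    ((f : Fragment (map b Y) y (qOf y) (inner S)) →
      (EqualCounts b a (induced b Y (Fragment.W f)) → ⊥) → ⊥) → ⊥
  fragment-⊥ {a} {b} {Y} {κ} {y} P h S ly lκ handler =
    fragment big-k deg (suc (length U)) U ≤-refl (filter⁺ inner? (V-unique X)) (proj₁ ∘ ∈U) id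
      (u , ∈-filter⁺ inner? {xs = V X} u∈ (side-u , u∉)) ν≤ λ f →
      handler f λ eqs → twins P h deg f v∈ (v∉W f) eqs (m≤m+n _ _) (≤-trans (m≤n+m _ (kOf y * 2 + c)) lκ) ly
    where
    open Separation S
    X = map b Y
    c≤y : c ≤ y
    c≤y = ≤-trans (m≤n+m c (suc c * 2)) ly
    open Fragments X (Prʳ P) y (≤-trans c-pos c≤y)
    U = inner S
    ∈U : ∀ {z} → z ∈ U → z ∈ V X × Inner z
    ∈U = ∈-filter⁻ inner? {xs = V X}
    big-k : qOf y + qOf y + y < kOf y
    big-k = m≤n+m _ (suc (c * suc (qOf y)) + qOf y)
    deg : ∀ {w} → w ∈ V X → Deg (kOf y) w X
    deg = minDeg P (≤-trans (m≤m+n _ _) lκ) h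
    ν≤ : ν U ≤ q
    ν≤ = ≤-trans (ν-separated {U} {sep} boundary)
      (≤-trans (*-monoʳ-≤ y (≤-trans sep-small (≤-trans c≤y (m≤m+n y y)))) (≤-reflexive (*-comm y (y + y))))
      where
      boundary : ∀ {w s} → w ∈ U → s ∉ U → mk s w ∈ X → s ∈ sep
      boundary {w} {s} w∈ s∉ e with inner-nbr (proj₂ (∈U w∈)) (subst (_∈ X) (mk-comm s w) e)
      ... | inj₂ r = r
      ... | inj₁ r = ⊥-elim (s∉ (∈-filter⁺ inner? {xs = V X} (∈V-mk⁺ e) r))
    v∉W : (f : Fragment X y (qOf y) U) → v ∉ Fragment.W f
    v∉W f v∈W with Fragment.near f v∈W
    ... | inj₁ r = exclusive (proj₂ (∈U r)) (side-v , v∉)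
    ... | inj₂ (w , w∈ , e) with inner-nbr (proj₂ (∈U w∈)) e
    ... | inj₁ r = exclusive r (side-v , v∉)
    ... | inj₂ r = v∉ r

  nv-nonzero : ∀ {a b : I → Edge} {Z x} → x ∈ V (map a Z) → 1 ≤ nv (map b Z)
  nv-nonzero {a} {b} {Z} x∈ with ∈V⁻ {map a Z} x∈
  ... | e , e∈ , _ with ∈-map⁻ a e∈
  ... | i , i∈ , _ = length-⊆ ([] ∷ []) λ { (here refl) → ∈V⁺ (∈-map⁺ b i∈) (inj₁ refl) }

  -- Among graphs of a given rank, a rigid one has the fewest vertices.
  nv-≤ : ∀ {a b Z} → Pair a b Z → Conn c (map a Z) → nv (map a Z) ≤ nv (map b Z)
  nv-≤ {a} {b} {Z} P h = F-cancel-≤ (nv-nonzero {a} {b} {Z} (proj₁ (proj₂ (big h [] z≤n)))) (begin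
      F (nv (map a Z))  ≡⟨ sym (Spans⇒F (Prˡ P) (rigid (Prˡ P) h)) ⟩
      ρ (map a Z)       ≡⟨ ρ-eq P id ⟩
      ρ (map b Z)       ≤⟨ ρ≤F (Prʳ P) ⟩
      F (nv (map b Z))  ∎)
    where open ≤-Reasoning

  -- Without a small separator, and with the size guaranteed by `minDeg`, the `b`-graph is
  -- `c`-connected. Both graphs are then rigid of equal rank, and `F` is injective.
  unseparated⇒nv : ∀ {a b Y κ} → Pair a b Y → Conn κ (map a Y) → suc c * 2 + c ≤ κ →
    (Separation (map b Y) c → ⊥) → nv (map b Y) ≡ nv (map a Y)
  unseparated⇒nv {a} {b} {Y} {κ} P h lκ none =
    F-injective (≤-trans (s≤s z≤n) (Conn-nv conn)) (≤-trans (s≤s z≤n) (Conn-nv h))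
      (trans (sym (Spans⇒F (Prʳ P) (rigid (Prʳ P) conn)))
        (trans (sym (ρ-eq P {Y} id)) (Spans⇒F (Prˡ P) (rigid (Prˡ P) (Conn-mono (≤-trans (m≤n+m c _) lκ) h)))))
    where
    vertex : ∃[ w ] (w ∈ V (map b Y))
    vertex with ∈V⁻ {map a Y} (proj₁ (proj₂ (big h [] z≤n)))
    ... | e , e∈ , _ with ∈-map⁻ a e∈
    ... | i , i∈ , _ = proj₁ (b i) , ∈V⁺ (∈-map⁺ b i∈) (inj₁ refl)
    big′ : ∀ A → length A ≤ c → ∃[ w ] (w ∈ V (map b Y) × w ∉ A)
    big′ A l with minDeg {k = suc c} P lκ h (proj₂ vertex) A (s≤s l)
    ... | z , z∉ , e = z , ∈V⁺ e (Inc-mkʳ _ z) , z∉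
    cut′ : ∀ A → length A < c → (C : ℕ → Bool) → ∀ {p q} → p ∈ V (map b Y) → q ∈ V (map b Y) →
           p ∉ A → q ∉ A → C p ≡ true → C q ≡ false → Crossing (map b Y) A C
    cut′ A l C p∈ q∈ p∉ q∉ Cp Cq with crossing? (Prʳ P) A C
    ... | inj₁ found = found
    ... | inj₂ sep = ⊥-elim (none record
            { side = C ; sep = A ; sep-small = <⇒≤ l ; u∈ = p∈ ; v∈ = q∈ ; u∉ = p∉ ; v∉ = q∉
            ; side-u = Cp ; side-v = Cq ; separated = sep })
    conn : Conn c (map b Y)
    conn = record { big = big′ ; cut = cut′ }

  -- d bounds the increment F (n + 1) - F n from below at the vertex count n of map a Y (CountsAt)
  -- or of map b Y (CountsBelow).
  CountsAt CountsBelow : ℕ → ℕ → Set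
  CountsAt d κ = ∀ {a b Y} → Pair a b Y → Conn κ (map a Y) → Lev d (nv (map a Y)) →
                 nv (map b Y) ≡ nv (map a Y)
  CountsBelow d κ = ∀ {a b Y} → Pair a b Y → Conn κ (map a Y) → Lev d (nv (map b Y)) →
                    nv (map b Y) ≡ nv (map a Y)

  -- In the fragment the `b` side is the connected one, so `below` looks at the size of the `a`
  -- side. That is a subgraph of `map a Y`, and the bound on the increment descends to it.
  below⇒at : ∀ {d κ} → CountsBelow d κ → ∃[ κ′ ] CountsAt d κ′
  below⇒at {d} {κ} below = κ′ , at
    where
    -- One unit pays for the vertex deleted in `minus`, the other keeps the remaining connectivity
    -- `suc κ` positive.
    y = suc (suc κ) + (suc c * 2 + c)
    κ′ = κOf y + (suc c * 2 + c)
    at : CountsAt d κ′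
    at {a} {b} {Y} P h lev = unseparated⇒nv P h (m≤n+m _ (κOf y)) λ S →
      fragment-⊥ P h S (m≤n+m _ (suc (suc κ))) (m≤m+n _ _) λ f k → k (counts f)
      where
      counts : ∀ {U₀} (f : Fragment (map b Y) y (qOf y) U₀) → EqualCounts b a (induced b Y (Fragment.W f))
      counts f = record { whole = part id (Conn-mono (≤-trans (m≤n+m κ 2) (m≤m+n (suc (suc κ)) _)) conn) (Conn-mono c≤y conn)
                        ; minus = λ {w} _ → part (del⊆ b (w ∷ []) Z)
                            (Conn-mono (n≤1+n κ) (proj₂ (del-Conn (Prʳ PZ) (w ∷ []) (m≤m+n (suc (suc κ)) _) (s≤s z≤n) conn)))
                            (proj₂ (del-Conn (Prʳ PZ) (w ∷ []) sc≤y c-pos conn)) }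
        where
        Z = induced b Y (Fragment.W f)
        PZ = Pair-⊆ (induced-⊆ b Y (Fragment.W f)) P
        conn : Conn y (map b Z)
        conn = induced-Conn {b} {Y} (Fragment.conn f)
        c≤y : c ≤ y
        c≤y = ≤-trans (m≤n+m c (suc c * 2)) (m≤n+m _ (suc (suc κ)))
        sc≤y : suc c ≤ y
        sc≤y = ≤-trans (s≤s (m≤n+m c (suc κ))) (+-monoʳ-≤ (suc (suc κ)) (m≤n+m c (suc c * 2)))
        part : ∀ {Z′} → Z′ ⊆ Z → Conn κ (map b Z′) → Conn c (map b Z′) → nv (map a Z′) ≡ nv (map b Z′)
        part {Z′} s hκ hc = below (Pair-swap PZ′) hκ (Lev-≤ c≤ (length-⊆ (V-unique _)
                              (V-mono (map-⊆ a (induced-⊆ b Y (Fragment.W f) ∘ s)))) lev)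
          where
          PZ′ = Pair-⊆ s PZ
          c≤ : c ≤ nv (map a Z′)
          c≤ = ≤-trans (<⇒≤ (Conn-nv hc)) (nv-≤ (Pair-swap PZ′) hc)

-- Deleting vertices that meet both sides of a separation.

module Excess (M : GraphMatroidFamily) (unb : Unbounded M) (c : ℕ) (c-pos : 1 ≤ c)
  (rigid : ∀ {X} → Pr X → Conn c X → Rank.Spans M X (V X)) (I : Set) where

  open Rank M
  open NewVertex M unb
  open Rigidity M unb c c-pos rigid
  open Pairs M unb c c-pos rigid I
  open Twins M unb c c-pos rigid I

  keep : (a : I → Edge) {Col : I → Set} → Decidable Col → List ℕ → List I → List I
  keep a col? A Y = filter (λ i → col? i ⊎-dec avoid? A (a i)) Y

  module Colour {a : I → Edge} {Y : List I} {κ : ℕ} (pr : Pr (map a Y)) (h : Conn κ (map a Y))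
    {Col : I → Set} (col? : Decidable Col) (A : List ℕ) (x : ℕ) (lA : suc (length A) + c ≤ κ) where

    mid? : Decidable (λ i → Avoid A (a i) × (Col i ⊎ Avoid (x ∷ A) (a i)))
    mid? i = avoid? A (a i) ×-dec (col? i ⊎-dec avoid? (x ∷ A) (a i))

    -- The edges that survive the deletion of `x ∷ A`, together with those at `x` of the given
    -- colour that survive the deletion of `A`.
    mid : List I
    mid = filter mid? Y

    mid⁻ : ∀ {i} → i ∈ mid → i ∈ Y × Avoid A (a i) × (Col i ⊎ Avoid (x ∷ A) (a i))
    mid⁻ = ∈-filter⁻ mid? {xs = Y}

    del⊆mid : del a (x ∷ A) Y ⊆ mid
    del⊆mid i∈ with del⁻ a (x ∷ A) Y i∈
    ... | i∈Y , (p , q) = ∈-filter⁺ mid? {xs = Y} i∈Y ((p ∘ there , q ∘ there) , inj₂ (p , q))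

    keep-step : ρ (map a (keep a col? A Y)) + ρ (map a mid) ≤
                ρ (map a (keep a col? (x ∷ A) Y)) + ρ (map a (del a A Y))
    keep-step = ρ-submod cover (map-⊆ a mid⊆keep) (map-⊆ a λ i∈ → let (p , q , _) = mid⁻ i∈ in del⁺ a A p q)
      where
      keep? : ∀ B → Decidable (λ i → Col i ⊎ Avoid B (a i))
      keep? B i = col? i ⊎-dec avoid? B (a i)
      mid⊆keep : mid ⊆ keep a col? (x ∷ A) Y
      mid⊆keep i∈ with mid⁻ i∈
      ... | p , _ , r = ∈-filter⁺ (keep? (x ∷ A)) {xs = Y} p r
      cover : ∀ {e} → e ∈ map a (keep a col? A Y) →
              e ∈ map a (keep a col? (x ∷ A) Y) ⊎ e ∈ map a (del a A Y)
      cover e∈ with ∈-map⁻ a e∈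
      ... | i , i∈ , refl with ∈-filter⁻ (keep? A) {xs = Y} i∈
      ... | p , inj₁ col = inj₁ (∈-map⁺ a (∈-filter⁺ (keep? (x ∷ A)) {xs = Y} p (inj₁ col)))
      ... | p , inj₂ av = inj₂ (∈-map⁺ a (del⁺ a A p av))

    mid-pendant : ∀ {i} → i ∈ Y → Avoid A (a i) → Col i → Inc x (a i) →
                  suc (ρ (map a (del a (x ∷ A) Y))) ≤ ρ (map a mid)
    mid-pendant {i} i∈ av col ix with other-end (pr (∈-map⁺ a i∈)) ix
    ... | z , eq = ≤-trans
          (subst (λ e → suc (ρ Γ) ≤ ρ (e ∷ Γ)) (sym eq)
            (pendant-ρ (Pr-del pr (x ∷ A)) (λ v∈ → proj₂ (V-del a (x ∷ A) Y v∈) (here refl))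
              (Proper-mk⁻ (subst Proper eq (pr (∈-map⁺ a i∈))))))
          (ρ-mono λ { (here refl) → ∈-map⁺ a (∈-filter⁺ mid? {xs = Y} i∈ (av , inj₁ col))
                    ; (there p) → map-⊆ a del⊆mid p })
      where
      Γ = map a (del a (x ∷ A) Y)

    mid-rich : (∀ B → length B < c → ∃[ z ] (z ∉ B × mk x z ∈ map a mid)) →
               ρ (map a (del a A Y)) ≤ ρ (map a mid)
    mid-rich rich = ρ-cl spanned
      where
      Γ = map a (del a (x ∷ A) Y)
      stays = proj₁ (del-Conn pr (x ∷ A) lA c-pos h)
      prM : Pr (map a mid)
      prM = pr ∘ map-⊆ a (proj₁ ∘ mid⁻)
      z∉A : ∀ {z} → mk x z ∈ map a mid → z ∈ V (map a Y) × z ∉ A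
      z∉A {z} e with ∈-map⁻ a e
      ... | i , i∈ , eq = ∈V⁺ (∈-map⁺ a (proj₁ (mid⁻ i∈))) iz , Avoid-Inc (proj₁ (proj₂ (mid⁻ i∈))) iz
        where
        iz = subst (Inc z) eq (Inc-mkʳ x z)
      nbrs : ∀ B → length B < c → ∃[ z ] (z ∈ V Γ × z ∉ B × x ≢ z × mk x z ∈ map a mid)
      nbrs B l =
        let (z , z∉ , e) = rich B l
            x≢z = Proper-mk⁻ (prM e)
        in z , stays (proj₁ (z∉A e)) (λ { (here r) → x≢z (sym r) ; (there r) → proj₂ (z∉A e) r }) , z∉ , x≢z , e
      spans : Spans (map a mid) (x ∷ V Γ)
      spans = absorb (λ u∈ v∈ ne → ∈cl-mono (map-⊆ a del⊆mid) (del-Spans pr (x ∷ A) lA h u∈ v∈ ne)) nbrs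
      spanned : ∀ {e} → e ∈ map a (del a A Y) → e ∈cl map a mid
      spanned e∈ = Spans-K {map a mid} {x ∷ V Γ} spans (∈K-of-Inc (Pr-del pr A e∈) ends)
        where
        ends : ∀ {v} → Inc v _ → v ∈ x ∷ V Γ
        ends {v} i with v ≟ x
        ... | yes r = here r
        ... | no r = there (stays (∈V⁺ (proj₁ (map-del⁻ a A Y e∈)) i)
                       λ { (here s) → r s ; (there s) → Avoid-Inc (proj₂ (map-del⁻ a A Y e∈)) i s })

  module TwoColours {a : I → Edge} {Y : List I} {κ : ℕ} (pr : Pr (map a Y)) (h : Conn κ (map a Y))
    {Red : I → Set} (red? : Decidable Red) where

    blue? : Decidable (λ i → ¬ Red i)
    blue? i = ¬? (red? i)

    ρA : List ℕ → ℕ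
    ρA A = ρ (map a (del a A Y))

    -- The vertex `x` has at least `c` neighbours along one of the colours. Restoring its edges of
    -- that colour spans everything lost with `x`, while in the other colour a single edge at `x` is
    -- pendant and gains one.
    bicoloured-vertex : ∀ {A x r s} → length A + (c + c) < κ → x ∉ A →
      r ∈ Y → Avoid A (a r) → Red r → Inc x (a r) → s ∈ Y → Avoid A (a s) → ¬ Red s → Inc x (a s) →
      ∀ (lA : suc (length A) + c ≤ κ) →
      suc (ρA A + ρA (x ∷ A)) ≤ ρ (map a (Colour.mid pr h red? A x lA)) + ρ (map a (Colour.mid pr h blue? A x lA))
    bicoloured-vertex {A} {x} {r} {s} lκ x∉ r∈ rA rr rx s∈ sA sr sx lA = go (suc c ≤? length N)
      where
      module R = Colour pr h red? A x lA
      module B = Colour pr h blue? A x lA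
      at? : Decidable (λ i → Red i × Inc x (a i))
      at? i = red? i ×-dec inc? x (a i)
      L = filter at? (del a A Y)
      -- `N` counts `x` itself along with its red neighbours, hence the threshold `suc c`.
      N = V (map a L)
      ∈L : ∀ {i} → i ∈ L → (i ∈ Y × Avoid A (a i)) × Red i × Inc x (a i)
      ∈L i∈ = let (p , q) = ∈-filter⁻ at? {xs = del a A Y} i∈ in del⁻ a A Y p , q
      redRich : suc c ≤ length N → ∀ B → length B < c → ∃[ z ] (z ∉ B × mk x z ∈ map a R.mid)
      redRich le B l with fresh (V-unique (map a L)) (≤-trans (s≤s l) le)
      ... | z , z∈ , z∉ with ∈V⁻ {map a L} z∈
      ... | e , e∈ , iz with ∈-map⁻ a e∈
      ... | i , i∈ , refl = z , z∉ ∘ there , subst (_∈ map a R.mid)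
            (mk-of-Inc (pr (∈-map⁺ a (proj₁ (proj₁ (∈L i∈))))) (λ q → z∉ (here (sym q))) (proj₂ (proj₂ (∈L i∈))) iz)
            (∈-map⁺ a (∈-filter⁺ R.mid? {xs = Y} (proj₁ (proj₁ (∈L i∈)))
              (proj₂ (proj₁ (∈L i∈)) , inj₁ (proj₁ (proj₂ (∈L i∈))))))
      blueRich : length N ≤ c → ∀ B → length B < c → ∃[ z ] (z ∉ B × mk x z ∈ map a B.mid)
      blueRich le B l with Conn-Deg h (∈V⁺ (∈-map⁺ a r∈) rx) (A ++ (N ++ B)) short
        where
        short : length (A ++ (N ++ B)) < κ
        short = ≤-trans (s≤s (≤-trans (≤-reflexive (trans (length-++ A) (cong (length A +_) (length-++ N))))
          (+-monoʳ-≤ (length A) (+-mono-≤ le (<⇒≤ l))))) lκ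
      ... | z , z∉ , e with ∈-map⁻ a e
      ... | i , i∈ , eq = z , proj₂ (∉-++ {A = N} z∉NB) , subst (_∈ map a B.mid) (sym eq)
            (∈-map⁺ a (∈-filter⁺ B.mid? {xs = Y} i∈ (iA , inj₁ blue)))
        where
        z∉NB = proj₂ (∉-++ {A = A} z∉)
        iA : Avoid A (a i)
        iA = subst (Avoid A) eq (Avoid-mk x∉ (proj₁ (∉-++ z∉)))
        blue : ¬ Red i
        blue ri = proj₁ (∉-++ z∉NB) (∈V⁺ (∈-map⁺ a (∈-filter⁺ at? {xs = del a A Y} (del⁺ a A i∈ iA)
                    (ri , subst (Inc x) eq (Inc-mkˡ x z)))) (subst (Inc z) eq (Inc-mkʳ x z)))
      go : Dec (suc c ≤ length N) → suc (ρA A + ρA (x ∷ A)) ≤ ρ (map a R.mid) + ρ (map a B.mid)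
      go (yes le) = ≤-trans (≤-reflexive (sym (+-suc (ρA A) (ρA (x ∷ A)))))
        (+-mono-≤ (R.mid-rich (redRich le)) (B.mid-pendant s∈ sA sr sx))
      go (no ≰) = ≤-trans (≤-reflexive (cong suc (+-comm (ρA A) (ρA (x ∷ A)))))
        (+-mono-≤ (R.mid-pendant r∈ rA rr rx) (B.mid-rich (blueRich (≤-pred (≰⇒> ≰)))))

    -- The two kept lists have union `Y` and intersection `del a A Y`; `j` is a lower bound for the
    -- slack in their submodular inequality.
    Exceeds : ℕ → List ℕ → Set
    Exceeds j A = j + (ρ (map a Y) + ρA A) ≤ ρ (map a (keep a red? A Y)) + ρ (map a (keep a blue? A Y))

    exceeds-step : ∀ {j A x} (lA : suc (length A) + c ≤ κ) → Exceeds j A →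
      suc (ρA A + ρA (x ∷ A)) ≤ ρ (map a (Colour.mid pr h red? A x lA)) + ρ (map a (Colour.mid pr h blue? A x lA)) →
      Exceeds (suc j) (x ∷ A)
    exceeds-step {j} {A} {x} lA ex one =
        arith (ρ (map a (keep a red? A Y))) (ρ (map a R.mid)) (ρ (map a (keep a red? (x ∷ A) Y))) (ρA A)
              (ρ (map a (keep a blue? A Y))) (ρ (map a B.mid)) (ρ (map a (keep a blue? (x ∷ A) Y)))
              (ρA (x ∷ A)) (ρ (map a Y)) R.keep-step B.keep-step ex one
      where
      module R = Colour pr h red? A x lA
      module B = Colour pr h blue? A x lA
      arith : ∀ p m p′ y q n q′ z w → p + m ≤ p′ + y → q + n ≤ q′ + y → j + (w + y) ≤ p + q →
              suc (y + z) ≤ m + n → suc j + (w + z) ≤ p′ + q′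
      arith p m p′ y q n q′ z w h₁ h₂ h₃ h₄ = +-cancelʳ-≤ (y + y) _ _ (begin
          (suc j + (w + z)) + (y + y)          ≡⟨ solve 4 (λ j w z y → (con 1 :+ j :+ (w :+ z)) :+ (y :+ y) :=
                                                   (j :+ (w :+ y)) :+ (con 1 :+ (y :+ z))) refl j w z y ⟩
          (j + (w + y)) + suc (y + z)          ≤⟨ +-mono-≤ h₃ h₄ ⟩
          (p + q) + (m + n)                    ≡⟨ solve 4 (λ p q m n → (p :+ q) :+ (m :+ n) := (p :+ m) :+ (q :+ n)) refl p q m n ⟩
          (p + m) + (q + n)                    ≤⟨ +-mono-≤ h₁ h₂ ⟩
          (p′ + y) + (q′ + y)                  ≡⟨ solve 3 (λ p q y → (p :+ y) :+ (q :+ y) := (p :+ q) :+ (y :+ y)) refl p′ q′ y ⟩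
          (p′ + q′) + (y + y)                  ∎)
        where
        open ≤-Reasoning
        open +-*-Solver

    exceeds : ∀ t → t + (c + c) < κ →
      (∀ A → length A ≤ t → ∃[ i ] (i ∈ Y × Avoid A (a i) × Red i)) →
      (∀ A → length A ≤ t → ∃[ i ] (i ∈ Y × Avoid A (a i) × ¬ Red i)) →
      ∀ j → j ≤ t → ∃[ A ] (length A ≡ j × Exceeds j A)
    exceeds t lκ reds blues zero _ = [] , refl , +-mono-≤ (ρ-mono (map-⊆ a all-red)) (ρ-mono (map-⊆ a all-blue))
      where
      none : ∀ {e} → Avoid [] e
      none = (λ ()) , (λ ())
      all-red : Y ⊆ keep a red? [] Y
      all-red i∈ = ∈-filter⁺ (λ i → red? i ⊎-dec avoid? [] (a i)) {xs = Y} i∈ (inj₂ none)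
      all-blue : del a [] Y ⊆ keep a blue? [] Y
      all-blue i∈ = ∈-filter⁺ (λ i → blue? i ⊎-dec avoid? [] (a i)) {xs = Y} (del⊆ a [] Y i∈) (inj₂ none)
    exceeds t lκ reds blues (suc j) le = extend (exceeds t lκ reds blues j (<⇒≤ le))
      where
      extend : ∃[ A ] (length A ≡ j × Exceeds j A) → ∃[ A ] (length A ≡ suc j × Exceeds (suc j) A)
      extend (A , refl , ex) =
        let (i , i∈ , iA , ri) = reds A (<⇒≤ le)
            (k , k∈ , kA , rk) = blues A (<⇒≤ le)
            (x , x∉ , (r , r∈ , rA , rr , rx) , (s , s∈ , sA , sr , sx)) =
              bichromatic pr h red? A (≤-trans le (≤-trans (m≤m+n t _) (<⇒≤ lκ))) i∈ iA ri k∈ kA rk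
        in x ∷ A , refl , exceeds-step {length A} lA ex (bicoloured-vertex short x∉ r∈ rA rr rx s∈ sA sr sx lA)
        where
        short : length A + (c + c) < κ
        short = ≤-trans (s≤s (+-monoˡ-≤ (c + c) (<⇒≤ le))) lκ
        lA : suc (length A) + c ≤ κ
        lA = ≤-trans (+-monoˡ-≤ c le) (≤-trans (+-monoʳ-≤ t (m≤m+n c c)) (<⇒≤ lκ))

-- Bounding the excess across a small separator.

take-⊆ : ∀ {A : Set} n (xs : List A) → take n xs ⊆ xs
take-⊆ (suc n) (x ∷ xs) (here p) = here p
take-⊆ (suc n) (x ∷ xs) (there p) = there (take-⊆ n xs p)

module Bounds (M : GraphMatroidFamily) (unb : Unbounded M) (c : ℕ) (c-pos : 1 ≤ c)
  (rigid : ∀ {X} → Pr X → Conn c X → Rank.Spans M X (V X)) (I : Set) where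

  open Rank M
  open Rigidity M unb c c-pos rigid
  open Pairs M unb c c-pos rigid I
  open Descent M unb c c-pos rigid I

  -- All edges between `c` vertices of each clique suffice: the chosen vertices of `U₁` are absorbed
  -- into `U₂`, and then every other vertex of `U₁` is absorbed through the chosen ones.
  join-cliques : ∀ {U₁ U₂ Z} → Unique U₁ → Unique U₂ → (∀ {x} → x ∈ U₁ → x ∈ U₂ → ⊥) →
    c ≤ length U₁ → c ≤ length U₂ → K U₁ ⊆ Z → K U₂ ⊆ Z → ρ (K (U₁ ++ U₂)) ≤ c * c + ρ Z
  join-cliques {U₁} {U₂} {Z} uq₁ uq₂ disj l₁ l₂ s₁ s₂ = begin
      ρ (K (U₁ ++ U₂))   ≤⟨ Spans⇒ρ {L ++ Z} {U₁ ++ U₂} all ⟩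
      ρ (L ++ Z)         ≤⟨ ρ-++-≤ L Z ⟩
      length L + ρ Z     ≤⟨ +-monoˡ-≤ (ρ Z) L-small ⟩
      c * c + ρ Z        ∎
    where
    open ≤-Reasoning
    T₁ = take c U₁
    T₂ = take c U₂
    len : ∀ (U : List ℕ) → c ≤ length U → length (take c U) ≡ c
    len U l = trans (length-take c U) (m≤n⇒m⊓n≡m l)
    star : ℕ → List Edge
    star t = map (mk t) T₂
    L = concatMap star T₁
    L-small : length L ≤ c * c
    L-small = ≤-trans (length-concatMap-≤ c star (λ t → ≤-reflexive (trans (length-map (mk t) T₂) (len U₂ l₂))) T₁)
      (≤-reflexive (cong (_* c) (len U₁ l₁)))
    ∈L : ∀ {t z} → t ∈ T₁ → z ∈ T₂ → mk t z ∈ L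
    ∈L {t} t∈ z∈ = ∈-concatMap⁺ star (lose t∈ (∈-map⁺ (mk t) z∈))
    apart : ∀ {x z} → x ∈ U₁ → z ∈ U₂ → x ≢ z
    apart x∈ z∈ refl = disj x∈ z∈
    span₂ : Spans (L ++ Z) U₂
    span₂ = spans-K (∈-++⁺ʳ L ∘ s₂)
    span₁ : Spans (L ++ Z) U₁
    span₁ = spans-K (∈-++⁺ʳ L ∘ s₁)
    short : ∀ {n} U → n < c → c ≤ length U → n < length (take c U)
    short U l lU = ≤-trans l (≤-reflexive (sym (len U lU)))
    spanT : ∀ {t} → t ∈ T₁ → Spans (L ++ Z) (t ∷ U₂)
    spanT t∈ = absorb span₂ λ B l →
      let (z , z∈ , z∉) = fresh (take⁺ c uq₂) (short U₂ l l₂)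
          z∈U = take-⊆ c U₂ z∈
      in z , z∈U , z∉   , apart (take-⊆ c U₁ t∈) z∈U , ∈-++⁺ˡ (∈L t∈ z∈)
    spanT₂ : Spans (L ++ Z) (T₁ ++ U₂)
    spanT₂ {p} {r} p∈ r∈ ne with ∈-++⁻ T₁ p∈ | ∈-++⁻ T₁ r∈
    ... | inj₁ x | inj₁ y = span₁ (take-⊆ c U₁ x) (take-⊆ c U₁ y) ne
    ... | inj₁ x | inj₂ y = spanT x (here refl) (there y) ne
    ... | inj₂ x | inj₁ y = spanT y (there x) (here refl) ne
    ... | inj₂ x | inj₂ y = span₂ x y ne
    cross : ∀ {w z} → w ∈ U₁ → z ∈ U₂ → mk w z ∈cl L ++ Z
    cross {w} {z} w∈ z∈ with w ∈? T₁
    ... | yes t∈ = spanT t∈ (here refl) (there z∈) (apart w∈ z∈)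
    ... | no t∉ = absorb spanT₂ nbrs (here refl) (there (∈-++⁺ʳ T₁ z∈)) (apart w∈ z∈)
      where
      nbrs : ∀ B → length B < c → ∃[ x ] (x ∈ T₁ ++ U₂ × x ∉ B × w ≢ x × mk w x ∈ L ++ Z)
      nbrs B l =
        let (t , t∈ , ∉B) = fresh (take⁺ c uq₁) (short U₁ l l₁)
            w≢t = λ eq → t∉ (subst (_∈ T₁) (sym eq) t∈)
        in t , ∈-++⁺ˡ t∈ , ∉B , w≢t , ∈-++⁺ʳ L (s₁ (∈K⁺ w∈ (take-⊆ c U₁ t∈) w≢t))
    all : Spans (L ++ Z) (U₁ ++ U₂)
    all {p} {r} p∈ r∈ ne with ∈-++⁻ U₁ p∈ | ∈-++⁻ U₁ r∈
    ... | inj₁ x | inj₁ y = span₁ x y ne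
    ... | inj₁ x | inj₂ y = cross x y
    ... | inj₂ x | inj₁ y = subst (_∈cl L ++ Z) (mk-comm r p) (cross y x)
    ... | inj₂ x | inj₂ y = span₂ x y ne

  module _ {b : I → Edge} {Y : List I} (prb : Pr (map b Y)) (S : Separation (map b Y) c) where

    open Separation S

    Red : I → Set
    Red i = Inner (proj₁ (b i)) ⊎ Inner (proj₂ (b i))

    red? : Decidable Red
    red? i = inner? (proj₁ (b i)) ⊎-dec inner? (proj₂ (b i))

    notInner? : Decidable (λ z → ¬ Inner z)
    notInner? z = ¬? (inner? z)

    U₁ U₂ : List ℕ
    U₁ = inner S
    U₂ = filter notInner? (V (map b Y))

    red-ends : ∀ {i x} → i ∈ Y → Red i → Inc x (b i) → Inner x ⊎ x ∈ sep
    red-ends {i} {x} i∈ r ix = [ at (inj₁ refl) , at (inj₂ refl) ]′ r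
      where
      at : ∀ {w} → Inc w (b i) → Inner w → Inner x ⊎ x ∈ sep
      at {w} iw Iw with w ≟ x
      ... | yes refl = inj₁ Iw
      ... | no ne = inner-nbr Iw (subst (_∈ map b Y) (mk-of-Inc (prb (∈-map⁺ b i∈)) ne iw ix) (∈-map⁺ b i∈))

    red-K : ∀ {i} → i ∈ Y → Red i → b i ∈ K (U₁ ++ sep)
    red-K {i} i∈ r = ∈K-of-Inc (prb (∈-map⁺ b i∈)) λ ix →
      [ (λ Ix → ∈-++⁺ˡ (∈-filter⁺ inner? {xs = V (map b Y)} (∈V⁺ (∈-map⁺ b i∈) ix) Ix)) , ∈-++⁺ʳ U₁ ]′ (red-ends i∈ r ix)

    blue-K : ∀ {i} → i ∈ Y → ¬ Red i → b i ∈ K U₂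
    blue-K {i} i∈ r = ∈K-of-Inc (prb (∈-map⁺ b i∈)) λ ix →
      ∈-filter⁺ notInner? {xs = V (map b Y)} (∈V⁺ (∈-map⁺ b i∈) ix) (notI ix)
      where
      notI : ∀ {x} → Inc x (b i) → ¬ Inner x
      notI (inj₁ refl) Ix = r (inj₁ Ix)
      notI (inj₂ refl) Ix = r (inj₂ Ix)

    -- Contracting a clique on P inside the first side, red and blue contribute to the rank
    -- independently up to a bounded error, because F is linear from length P on.
    excess-≤ : ∀ {d Y′ P Y₁ Y₂} → c ≤ length U₁ → c ≤ length U₂ → Lev d (nv (map b Y)) →
      Y′ ⊆ Y → Unique P → P ⊆ V (map b Y) → (∀ {z} → z ∈ P → Inner z ⊎ z ∈ sep) → Spans (map b Y′) P →
      c ≤ length P → ¬ Lev (suc d) (length P) →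
      Y₁ ⊆ Y → (∀ {i} → i ∈ Y₁ → Red i ⊎ i ∈ Y′) → Y₂ ⊆ Y → (∀ {i} → i ∈ Y₂ → ¬ Red i ⊎ i ∈ Y′) →
      ρ (map b Y₁) + ρ (map b Y₂) ≤ (c * c + d * c) + (ρ (map b Y) + ρ (map b Y′))
    excess-≤ {d} {Y′} {P} {Y₁} {Y₂} l₁ l₂ lev Y′⊆ uqP P⊆V P-in spanP cP ¬lev Y₁⊆ Y₁-or Y₂⊆ Y₂-or =
      arith (ρ (map b Y₁)) (ρ (map b Y₂)) (ρ (map b Y)) (ρ (map b Y′)) (ρ (K P ++ bR)) (ρ (K P ++ bR′))
        (ρ (K P ++ (bR ++ K₂))) (ρ (K P ++ (bR′ ++ K₂))) (ρ (K₁ ++ K₂)) (ρ K₁) (ρ (K P)) (ρ (K P ++ K₂))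
        (F N) (F p) (F (pu + length U₂)) (d * (n₁ ∸ pu)) step₁ step₂ step₃ step₄ bound₁ (F≤K uqP) bound₂ bound₃ bound₄
      where
      R R′ : List I
      R = filter red? Y
      R′ = filter red? Y′
      bR bR′ K₁ K₂ : List Edge
      bR = map b R
      bR′ = map b R′
      K₁ = K (U₁ ++ sep)
      K₂ = K U₂
      p n₁ pu N : ℕ
      p = length P
      n₁ = length U₁
      PU : List ℕ
      PU = filter inner? P
      pu = length PU
      N = nv (map b Y)
      R′⊆R : bR′ ⊆ bR
      R′⊆R = map-⊆ b λ i∈ → let (q , r) = ∈-filter⁻ red? {xs = Y′} i∈ in ∈-filter⁺ red? {xs = Y} (Y′⊆ q) r
      R⊆Y : bR ⊆ map b Y
      R⊆Y = map-⊆ b (proj₁ ∘ ∈-filter⁻ red? {xs = Y})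
      R′⊆Y′ : bR′ ⊆ map b Y′
      R′⊆Y′ = map-⊆ b (proj₁ ∘ ∈-filter⁻ red? {xs = Y′})
      R⊆K₁ : bR ⊆ K₁
      R⊆K₁ e∈ with ∈-map⁻ b e∈
      ... | i , i∈ , refl with ∈-filter⁻ red? {xs = Y} i∈
      ... | q , r = red-K q r
      P⊆U : P ⊆ U₁ ++ sep
      P⊆U z∈ = [ (λ Iz → ∈-++⁺ˡ (∈-filter⁺ inner? {xs = V (map b Y)} (P⊆V z∈) Iz)) , ∈-++⁺ʳ U₁ ]′ (P-in z∈)
      clP : ∀ {W} → map b Y′ ⊆ W → ρ (K P ++ W) ≤ ρ W
      clP {W} s = ρ-cl-++ (K P) λ e∈ → ∈cl-mono s (Spans-K {map b Y′} {P} spanP e∈)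
      assoc⊆ : ∀ {B} → K P ++ B ⊆ K P ++ (B ++ K₂)
      assoc⊆ {B} e∈ = [ ∈-++⁺ˡ , ∈-++⁺ʳ (K P) ∘ ∈-++⁺ˡ ]′ (∈-++⁻ (K P) e∈)

      -- Adding the four submodular inequalities cancels all terms with red edges. What remains
      -- compares `ρ K₁ + ρ (K P ++ K₂)` with `ρ (K₁ ++ K₂) + ρ (K P)`, and the four bounds express
      -- these through `F`.
      step₁ : ρ (map b Y₁) + ρ (K P ++ bR′) ≤ ρ (map b Y′) + ρ (K P ++ bR)
      step₁ = ≤-trans (ρ-submod {X = K P ++ map b Y′} {Y = K P ++ bR} cover
          (λ e∈ → [ ∈-++⁺ˡ , ∈-++⁺ʳ (K P) ∘ R′⊆Y′ ]′ (∈-++⁻ (K P) e∈))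
          (λ e∈ → [ ∈-++⁺ˡ , ∈-++⁺ʳ (K P) ∘ R′⊆R ]′ (∈-++⁻ (K P) e∈)))
        (+-monoˡ-≤ (ρ (K P ++ bR)) (clP {map b Y′} id))
        where
        cover : ∀ {e} → e ∈ map b Y₁ → e ∈ K P ++ map b Y′ ⊎ e ∈ K P ++ bR
        cover e∈ with ∈-map⁻ b e∈
        ... | i , i∈ , refl with Y₁-or i∈
        ... | inj₁ r = inj₂ (∈-++⁺ʳ (K P) (∈-map⁺ b (∈-filter⁺ red? {xs = Y} (Y₁⊆ i∈) r)))
        ... | inj₂ i∈′ = inj₁ (∈-++⁺ʳ (K P) (∈-map⁺ b i∈′))

      step₂ : ρ (K P ++ (bR ++ K₂)) + ρ (map b Y₂) ≤ ρ (map b Y) + ρ (K P ++ (bR′ ++ K₂))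
      step₂ = ≤-trans (ρ-submod {X = K P ++ map b Y} {Y = K P ++ (bR′ ++ K₂)} cover
          (∈-++⁺ʳ (K P) ∘ map-⊆ b Y₂⊆) sub)
        (+-monoˡ-≤ (ρ (K P ++ (bR′ ++ K₂))) (clP {map b Y} (map-⊆ b Y′⊆)))
        where
        cover : ∀ {e} → e ∈ K P ++ (bR ++ K₂) → e ∈ K P ++ map b Y ⊎ e ∈ K P ++ (bR′ ++ K₂)
        cover e∈ with ∈-++⁻ (K P) e∈
        ... | inj₁ q = inj₁ (∈-++⁺ˡ q)
        ... | inj₂ q with ∈-++⁻ bR q
        ... | inj₁ r = inj₁ (∈-++⁺ʳ (K P) (R⊆Y r))
        ... | inj₂ r = inj₂ (∈-++⁺ʳ (K P) (∈-++⁺ʳ bR′ r))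
        sub : map b Y₂ ⊆ K P ++ (bR′ ++ K₂)
        sub e∈ with ∈-map⁻ b e∈
        ... | i , i∈ , refl with red? i | Y₂-or i∈
        ... | no r | _ = ∈-++⁺ʳ (K P) (∈-++⁺ʳ bR′ (blue-K (Y₂⊆ i∈) r))
        ... | yes r | inj₁ ¬r = ⊥-elim (¬r r)
        ... | yes r | inj₂ i∈′ = ∈-++⁺ʳ (K P) (∈-++⁺ˡ (∈-map⁺ b (∈-filter⁺ red? {xs = Y′} i∈′ r)))

      step₃ : ρ (K₁ ++ K₂) + ρ (K P ++ bR) ≤ ρ K₁ + ρ (K P ++ (bR ++ K₂))
      step₃ = ρ-submod {X = K₁} {Y = K P ++ (bR ++ K₂)}
        (λ e∈ → [ inj₁ , (λ q → inj₂ (∈-++⁺ʳ (K P) (∈-++⁺ʳ bR q))) ]′ (∈-++⁻ K₁ e∈))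
        (λ e∈ → [ K-mono P⊆U , R⊆K₁ ]′ (∈-++⁻ (K P) e∈)) (assoc⊆ {bR})

      step₄ : ρ (K P ++ (bR′ ++ K₂)) + ρ (K P) ≤ ρ (K P ++ bR′) + ρ (K P ++ K₂)
      step₄ = ρ-submod {X = K P ++ bR′} {Y = K P ++ K₂} cover ∈-++⁺ˡ ∈-++⁺ˡ
        where
        cover : ∀ {e} → e ∈ K P ++ (bR′ ++ K₂) → e ∈ K P ++ bR′ ⊎ e ∈ K P ++ K₂
        cover e∈ with ∈-++⁻ (K P) e∈
        ... | inj₁ q = inj₁ (∈-++⁺ˡ q)
        ... | inj₂ q = [ inj₁ ∘ ∈-++⁺ʳ (K P) , inj₂ ∘ ∈-++⁺ʳ (K P) ]′ (∈-++⁻ bR′ q)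

      bound₁ : F N ≤ c * c + ρ (K₁ ++ K₂)
      bound₁ = ≤-trans (F≤K (V-unique (map b Y))) (≤-trans (ρ-mono (K-mono cover))
        (join-cliques (filter⁺ inner? (V-unique (map b Y))) (filter⁺ notInner? (V-unique (map b Y)))
          (λ q r → proj₂ (∈-filter⁻ notInner? {xs = V (map b Y)} r) (proj₂ (∈-filter⁻ inner? {xs = V (map b Y)} q)))
          l₁ l₂ (∈-++⁺ˡ ∘ K-mono ∈-++⁺ˡ) (∈-++⁺ʳ K₁)))
        where
        cover : V (map b Y) ⊆ U₁ ++ U₂
        cover {z} z∈ with inner? z
        ... | yes r = ∈-++⁺ˡ (∈-filter⁺ inner? {xs = V (map b Y)} z∈ r)
        ... | no r = ∈-++⁺ʳ U₁ (∈-filter⁺ notInner? {xs = V (map b Y)} z∈ r)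

      pu≤n₁ : pu ≤ n₁
      pu≤n₁ = length-⊆ (filter⁺ inner? uqP) λ z∈ → let (q , r) = ∈-filter⁻ inner? {xs = P} z∈ in
        ∈-filter⁺ inner? {xs = V (map b Y)} (P⊆V q) r

      -- From size `p` on each vertex adds at most `d`; the separator accounts for `d * c`. In
      -- `bound₄` each of the same `n₁ ∸ pu` vertices adds at least `d`, so these terms cancel.
      bound₂ : ρ K₁ ≤ (d * (n₁ ∸ pu) + d * c) + F p
      bound₂ = begin
        ρ K₁                                  ≤⟨ K≤F (U₁ ++ sep) ⟩
        F (length (U₁ ++ sep))                ≤⟨ F-mono size ⟩
        F (((n₁ ∸ pu) + c) + p)               ≤⟨ F-linear-≤ ((n₁ ∸ pu) + c) cP ¬lev ⟩
        d * ((n₁ ∸ pu) + c) + F p             ≡⟨ cong (_+ F p) (*-distribˡ-+ d (n₁ ∸ pu) c) ⟩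
        (d * (n₁ ∸ pu) + d * c) + F p         ∎
        where
        open ≤-Reasoning
        size : length (U₁ ++ sep) ≤ ((n₁ ∸ pu) + c) + p
        size = begin
          length (U₁ ++ sep)      ≡⟨ length-++ U₁ ⟩
          n₁ + length sep         ≤⟨ +-monoʳ-≤ n₁ sep-small ⟩
          n₁ + c                  ≡⟨ cong (_+ c) (sym (m∸n+n≡m pu≤n₁)) ⟩
          ((n₁ ∸ pu) + pu) + c    ≤⟨ +-monoˡ-≤ c (+-monoʳ-≤ (n₁ ∸ pu) (length-filter inner? P)) ⟩
          ((n₁ ∸ pu) + p) + c     ≡⟨ trans (+-assoc (n₁ ∸ pu) p c) (trans (cong ((n₁ ∸ pu) +_) (+-comm p c)) (sym (+-assoc (n₁ ∸ pu) c p))) ⟩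
          ((n₁ ∸ pu) + c) + p     ∎

      bound₃ : ρ (K P ++ K₂) ≤ F (pu + length U₂)
      bound₃ = ≤-trans (ρ-mono sub) (≤-trans (K≤F (PU ++ U₂)) (≤-reflexive (cong F (length-++ PU))))
        where
        P⊆ : P ⊆ PU ++ U₂
        P⊆ {z} z∈ with inner? z
        ... | yes r = ∈-++⁺ˡ (∈-filter⁺ inner? {xs = P} z∈ r)
        ... | no r = ∈-++⁺ʳ PU (∈-filter⁺ notInner? {xs = V (map b Y)} (P⊆V z∈) r)
        sub : K P ++ K₂ ⊆ K (PU ++ U₂)
        sub e∈ = [ K-mono P⊆ , K-mono (∈-++⁺ʳ PU) ]′ (∈-++⁻ (K P) e∈)

      total : (n₁ ∸ pu) + (pu + length U₂) ≡ N
      total = trans (sym (+-assoc (n₁ ∸ pu) pu (length U₂))) (trans (cong (_+ length U₂) (m∸n+n≡m pu≤n₁))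
        (sym (length-filter-split inner? (V (map b Y)))))

      bound₄ : d * (n₁ ∸ pu) + F (pu + length U₂) ≤ F N
      bound₄ = ≤-trans (F-linear-≥ (n₁ ∸ pu) (≤-trans l₂ (m≤n+m _ pu)) (subst (Lev d) (sym total) lev))
        (≤-reflexive (cong F total))

      arith : ∀ y₁ y₂ y y′ r r′ s s′ k₁₂ k₁ kp kp₂ fN fp f₂ m →
        y₁ + r′ ≤ y′ + r → s + y₂ ≤ y + s′ → k₁₂ + r ≤ k₁ + s → s′ + kp ≤ r′ + kp₂ →
        fN ≤ c * c + k₁₂ → fp ≤ kp → k₁ ≤ (m + d * c) + fp → kp₂ ≤ f₂ → m + f₂ ≤ fN →
        y₁ + y₂ ≤ (c * c + d * c) + (y + y′)
      arith y₁ y₂ y y′ r r′ s s′ k₁₂ k₁ kp kp₂ fN fp f₂ m h₁ h₂ h₃ h₄ h₅ h₆ h₇ h₈ h₉ =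
        +-cancelʳ-≤ (fN + fp + (r + r′ + s + s′)) _ _ (begin
          (y₁ + y₂) + (fN + fp + (r + r′ + s + s′))
            ≤⟨ +-monoʳ-≤ (y₁ + y₂) (+-monoˡ-≤ _ (+-mono-≤ h₅ h₆)) ⟩
          (y₁ + y₂) + ((C + k₁₂) + kp + (r + r′ + s + s′))
            ≡⟨ solve 9 (λ y₁ y₂ C k₁₂ kp r r′ s s′ → (y₁ :+ y₂) :+ ((C :+ k₁₂) :+ kp :+ (r :+ r′ :+ s :+ s′)) :=
                 C :+ ((y₁ :+ r′) :+ (s :+ y₂) :+ (k₁₂ :+ r) :+ (s′ :+ kp))) refl y₁ y₂ C k₁₂ kp r r′ s s′ ⟩
          C + ((y₁ + r′) + (s + y₂) + (k₁₂ + r) + (s′ + kp))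
            ≤⟨ +-monoʳ-≤ C (+-mono-≤ (+-mono-≤ (+-mono-≤ h₁ h₂) h₃) h₄) ⟩
          C + ((y′ + r) + (y + s′) + (k₁ + s) + (r′ + kp₂))
            ≤⟨ +-monoʳ-≤ C (+-mono-≤ (+-monoʳ-≤ ((y′ + r) + (y + s′)) (+-monoˡ-≤ s h₇)) (+-monoʳ-≤ r′ h₈)) ⟩
          C + ((y′ + r) + (y + s′) + (((m + D) + fp) + s) + (r′ + f₂))
            ≡⟨ solve 11 (λ C y′ r y s′ m D fp s r′ f₂ →
                 C :+ ((y′ :+ r) :+ (y :+ s′) :+ (((m :+ D) :+ fp) :+ s) :+ (r′ :+ f₂)) :=
                 (C :+ D) :+ (y :+ y′) :+ ((m :+ f₂) :+ fp :+ (r :+ r′ :+ s :+ s′))) refl C y′ r y s′ m D fp s r′ f₂ ⟩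
          (C + D) + (y + y′) + ((m + f₂) + fp + (r + r′ + s + s′))
            ≤⟨ +-monoʳ-≤ ((C + D) + (y + y′)) (+-monoˡ-≤ _ (+-monoˡ-≤ fp h₉)) ⟩
          (C + D) + (y + y′) + (fN + fp + (r + r′ + s + s′)) ∎)
        where
        open ≤-Reasoning
        open +-*-Solver
        C = c * c
        D = d * c

-- Descending induction on the increment.

module Induction (M : GraphMatroidFamily) (unb : Unbounded M) (c : ℕ) (c-pos : 1 ≤ c)
  (rigid : ∀ {X} → Pr X → Conn c X → Rank.Spans M X (V X)) (I : Set) where

  open Rank M
  open Rigidity M unb c c-pos rigid
  open Pairs M unb c c-pos rigid I
  open Twins M unb c c-pos rigid I
  open Descent M unb c c-pos rigid I
  open Excess M unb c c-pos rigid I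
  open Bounds M unb c c-pos rigid I

  -- Let the excess grow to `t` and take a fragment of what is left. If the increment at its size is
  -- at least `suc d`, then `at`, with the roles exchanged, gives the counts that `twins` refutes.
  -- Otherwise `F` has slope exactly `d` from there up to the size of `map b Y`, and `excess-≤`
  -- forbids an excess of `t`.
  at⇒below : ∀ {d κ} → CountsAt (suc d) κ → ∃[ κ′ ] CountsBelow d κ′
  at⇒below {d} {κ} at = κ′ , λ P h lev → unseparated⇒nv P h lκ₄ (contra P h lev)
    where
    t y k₀ κ′ : ℕ
    -- One more than the error in `excess-≤`. The degree `k₀` serves `survive` after `t` deletions
    -- and makes both sides of the separation have at least `c` vertices.
    t = suc (c * c + d * c)
    y = suc (suc κ) + (suc c * 2 + c)
    k₀ = (suc (c * t) + c) + (c + c)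
    κ′ = (t + κOf y) + ((k₀ * 2 + c) + (suc (t + (c + c)) + (suc c * 2 + c)))
    lκ₁ : t + κOf y ≤ κ′
    lκ₁ = m≤m+n _ _
    lκ₂ : k₀ * 2 + c ≤ κ′
    lκ₂ = ≤-trans (m≤m+n (k₀ * 2 + c) (suc (t + (c + c)) + (suc c * 2 + c))) (m≤n+m _ (t + κOf y))
    lκ₃₄ : suc (t + (c + c)) + (suc c * 2 + c) ≤ κ′
    lκ₃₄ = ≤-trans (m≤n+m _ (k₀ * 2 + c)) (m≤n+m _ (t + κOf y))
    lκ₃ : t + (c + c) < κ′
    lκ₃ = ≤-trans (m≤m+n (suc (t + (c + c))) (suc c * 2 + c)) lκ₃₄
    lκ₄ : suc c * 2 + c ≤ κ′
    lκ₄ = ≤-trans (m≤n+m _ (suc (t + (c + c)))) lκ₃₄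
    κOf-pos : 1 ≤ κOf y
    κOf-pos = ≤-trans (s≤s z≤n) (m≤n+m (suc (suc (qOf y)) + c) (kOf y * 2 + c))
    c≤y : suc c ≤ y
    c≤y = ≤-trans (s≤s (m≤n+m c (suc κ))) (+-monoʳ-≤ (suc (suc κ)) (m≤n+m c (suc c * 2)))

    module _ {a b : I → Edge} {Y : List I} (P : Pair a b Y) (h : Conn κ′ (map a Y))
             (lev : Lev d (nv (map b Y))) (S : Separation (map b Y) c) where

      open Separation S

      deg : ∀ {w} → w ∈ V (map b Y) → Deg k₀ w (map b Y)
      deg = minDeg P lκ₂ h

      col? : Decidable (Red {b} {Y} (Prʳ P) S)
      col? = red? (Prʳ P) S

      sz₁ : ∀ (A : List ℕ) → length A ≤ t → length A + c ≤ κ′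
      sz₁ A l = ≤-trans (+-mono-≤ l (m≤m+n c c)) (<⇒≤ lκ₃)

      sz₂ : ∀ (A : List ℕ) → length A ≤ t → suc (c * length A) + length sep ≤ k₀
      sz₂ A l = ≤-trans (+-mono-≤ (s≤s (*-monoʳ-≤ c l)) sep-small) (m≤m+n _ (c + c))

      reds : ∀ A → length A ≤ t → ∃[ i ] (i ∈ Y × Avoid A (a i) × Red {b} {Y} (Prʳ P) S i)
      reds A l = survive P h inner? sep A (deg u∈) (inner-nbr (side-u , u∉)) (sz₁ A l) (sz₂ A l)

      outers : ∀ A → length A ≤ t → ∃[ i ] (i ∈ Y × Avoid A (a i) × (Outer (proj₁ (b i)) ⊎ Outer (proj₂ (b i))))
      outers A l = survive P h outer? sep A (deg v∈) (outer-nbr (side-v , v∉)) (sz₁ A l) (sz₂ A l)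

      outer⇒blue : ∀ {i} → i ∈ Y → Outer (proj₁ (b i)) ⊎ Outer (proj₂ (b i)) → ¬ Red {b} {Y} (Prʳ P) S i
      outer⇒blue i∈ out r = [ end (inj₁ refl) , end (inj₂ refl) ]′ out
        where
        end : ∀ {x} → Inc x (b _) → Outer x → ⊥
        end ix o = [ (λ q → exclusive q o) , proj₂ o ]′ (red-ends (Prʳ P) S i∈ r ix)

      blues : ∀ A → length A ≤ t → ∃[ i ] (i ∈ Y × Avoid A (a i) × ¬ Red {b} {Y} (Prʳ P) S i)
      blues A l = let (i , i∈ , iA , out) = outers A l in i , i∈ , iA , outer⇒blue i∈ out

      open TwoColours (Prˡ P) h col?

      module _ (A : List ℕ) (len : length A ≡ t) (ex : Exceeds t A) where

        Y′ : List I
        Y′ = del a A Y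

        Y′⊆ : Y′ ⊆ Y
        Y′⊆ = del⊆ a A Y

        P′ : Pair a b Y′
        P′ = Pair-⊆ Y′⊆ P

        h′ : Conn (κOf y) (map a Y′)
        h′ = proj₂ (del-Conn (Prˡ P) A (≤-trans (≤-reflexive (cong (_+ κOf y) len)) lκ₁) κOf-pos h)

        witness : ∀ {R : ℕ → Set} → ∃[ i ] (i ∈ Y × Avoid A (a i) × (R (proj₁ (b i)) ⊎ R (proj₂ (b i)))) →
                  ∃[ z ] (z ∈ V (map b Y′) × R z)
        witness (i , i∈ , iA , inj₁ r) = _ , ∈V⁺ (∈-map⁺ b (del⁺ a A i∈ iA)) (inj₁ refl) , r
        witness (i , i∈ , iA , inj₂ r) = _ , ∈V⁺ (∈-map⁺ b (del⁺ a A i∈ iA)) (inj₂ refl) , r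

        inside-vertex : ∃[ z ] (z ∈ V (map b Y′) × Inner z)
        inside-vertex = witness (reds A (≤-reflexive len))

        outside-vertex : ∃[ z ] (z ∈ V (map b Y′) × Outer z)
        outside-vertex = witness (outers A (≤-reflexive len))

        -- The fragment is sought after deleting `A`, so that its clique is spanned by `Y′`, which
        -- both kept lists contain. The separation persists because `survive` leaves a vertex
        -- strictly on either side.
        S′ : Separation (map b Y′) c
        S′ = record
          { side = side ; sep = sep ; sep-small = sep-small
          ; u = proj₁ inside-vertex ; v = proj₁ outside-vertex
          ; u∈ = proj₁ (proj₂ inside-vertex) ; v∈ = proj₁ (proj₂ outside-vertex)
          ; u∉ = proj₂ (proj₂ (proj₂ inside-vertex)) ; v∉ = proj₂ (proj₂ (proj₂ outside-vertex))
          ; side-u = proj₁ (proj₂ (proj₂ inside-vertex)) ; side-v = proj₁ (proj₂ (proj₂ outside-vertex))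
          ; separated = λ e → separated (map-⊆ b Y′⊆ e) }

        c≤inner : c ≤ length (U₁ (Prʳ P) S)
        c≤inner = ≮⇒≥ λ lt →
          let (z , z∉ , e) = deg u∈ (U₁ (Prʳ P) S ++ sep) (short (U₁ (Prʳ P) S) lt)
          in [ (λ Iz → proj₁ (∉-++ z∉) (∈-filter⁺ inner? {xs = V (map b Y)} (∈V⁺ e (Inc-mkʳ _ z)) Iz))
             , proj₂ (∉-++ {A = U₁ (Prʳ P) S} z∉) ]′ (inner-nbr (side-u , u∉) e)
          where
          short : ∀ U → length U < c → length (U ++ sep) < k₀
          short U lt = ≤-trans (s≤s (≤-trans (≤-reflexive (length-++ U)) (+-mono-≤ (<⇒≤ lt) sep-small)))
            (≤-trans (s≤s (m≤n+m (c + c) (c * t + c))) ≤-refl)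

        c≤outer : c ≤ length (U₂ (Prʳ P) S)
        c≤outer = ≮⇒≥ λ lt →
          let (z , z∉ , e) = deg v∈ (U₂ (Prʳ P) S ++ sep) (short (U₂ (Prʳ P) S) lt)
          in [ (λ Oz → proj₁ (∉-++ z∉) (∈-filter⁺ (notInner? (Prʳ P) S) {xs = V (map b Y)} (∈V⁺ e (Inc-mkʳ _ z))
                         (λ Iz → exclusive Iz Oz)))
             , proj₂ (∉-++ {A = U₂ (Prʳ P) S} z∉) ]′ (outer-nbr (side-v , v∉) e)
          where
          short : ∀ U → length U < c → length (U ++ sep) < k₀
          short U lt = ≤-trans (s≤s (≤-trans (≤-reflexive (length-++ U)) (+-mono-≤ (<⇒≤ lt) sep-small)))
            (≤-trans (s≤s (m≤n+m (c + c) (c * t + c))) ≤-refl)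

        module _ (f : Fragment (map b Y′) y (qOf y) (inner S′)) where

          open Fragment f using (W; near) renaming (conn to connW)

          Z : List I
          Z = induced b Y′ W

          Z⊆ : Z ⊆ Y′
          Z⊆ = induced-⊆ b Y′ W

          PZ : Pair a b Z
          PZ = Pair-⊆ Z⊆ P′

          connZ : Conn y (map b Z)
          connZ = induced-Conn {b} {Y′} connW

          connZ-c : Conn c (map b Z)
          connZ-c = Conn-mono (<⇒≤ c≤y) connZ

          counts : Lev (suc d) (nv (map b Z)) → EqualCounts b a Z
          counts lv = record
            { whole = at (Pair-swap PZ) (Conn-mono (≤-trans (m≤n+m κ 2) (m≤m+n _ _)) connZ) lv
            ; minus = λ {w} _ → at (Pair-swap (Pair-⊆ (del⊆ b (w ∷ []) Z) PZ))
                (Conn-mono (n≤1+n κ) (proj₂ (del-Conn (Prʳ PZ) (w ∷ []) (m≤m+n (suc (suc κ)) _) (s≤s z≤n) connZ)))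
                (Lev-≤ (<⇒≤ (Conn-nv (proj₂ (del-Conn (Prʳ PZ) (w ∷ []) c≤y c-pos connZ))))
                  (length-⊆ (V-unique _) (V-mono (map-⊆ b (del⊆ b (w ∷ []) Z)))) lv) }

          P-in : ∀ {z} → z ∈ V (map b Z) → Inner z ⊎ z ∈ sep
          P-in z∈ with ∈V⁻ {map b Z} z∈
          ... | e , e∈ , iz with ∈-map⁻ b e∈
          ... | i , i∈ , refl with near (K-Inc (induced-K b Y′ W i∈) iz)
          ... | inj₁ q = inj₁ (proj₂ (∈-filter⁻ inner? {xs = V (map b Y′)} q))
          ... | inj₂ (w , w∈ , e) = inner-nbr (proj₂ (∈-filter⁻ inner? {xs = V (map b Y′)} w∈)) (map-⊆ b Y′⊆ e)

          kept : ∀ {Col : I → Set} (col? : Decidable Col) {i} → i ∈ keep a col? A Y → i ∈ Y × (Col i ⊎ i ∈ Y′)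
          kept col? i∈ with ∈-filter⁻ (λ i → col? i ⊎-dec avoid? A (a i)) {xs = Y} i∈
          ... | i∈Y , inj₁ q = i∈Y , inj₁ q
          ... | i∈Y , inj₂ q = i∈Y , inj₂ (del⁺ a A i∈Y q)

          linear : ¬ Lev (suc d) (nv (map b Z)) → ⊥
          linear ¬lv = <-irrefl refl (begin-strict
              (c * c + d * c) + (ρ (map b Y) + ρ (map b Y′))   <⟨ ≤-refl ⟩
              t + (ρ (map b Y) + ρ (map b Y′))
                ≡⟨ cong (t +_) (cong₂ _+_ (sym (ρ-eq P {Y} id)) (sym (ρ-eq P {Y′} Y′⊆))) ⟩
              t + (ρ (map a Y) + ρ (map a Y′))                 ≤⟨ ex ⟩
              ρ (map a Y₁) + ρ (map a Y₂)
                ≡⟨ cong₂ _+_ (ρ-eq P {Y₁} (proj₁ ∘ kept col?)) (ρ-eq P {Y₂} (proj₁ ∘ kept blue?)) ⟩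
              ρ (map b Y₁) + ρ (map b Y₂)
                ≤⟨ excess-≤ (Prʳ P) S {d} {Y′} {V (map b Z)} {Y₁} {Y₂} c≤inner c≤outer lev Y′⊆ (V-unique (map b Z))
                     (V-mono (map-⊆ b (Y′⊆ ∘ Z⊆))) P-in
                     (λ p∈ q∈ ne → ∈cl-mono (map-⊆ b Z⊆) (rigid (Prʳ PZ) connZ-c p∈ q∈ ne))
                     (<⇒≤ (Conn-nv connZ-c)) ¬lv
                     (proj₁ ∘ kept col?) (proj₂ ∘ kept col?) (proj₁ ∘ kept blue?) (proj₂ ∘ kept blue?) ⟩
              (c * c + d * c) + (ρ (map b Y) + ρ (map b Y′))   ∎)
            where
            open ≤-Reasoning
            Y₁ Y₂ : List I
            Y₁ = keep a col? A Y
            Y₂ = keep a blue? A Y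

          handler : (EqualCounts b a Z → ⊥) → ⊥
          -- Comparing two values of `F` at the size of this one fragment replaces any knowledge of
          -- where the increments settle.
          handler k with (suc d + F (nv (map b Z))) ≤? F (suc (nv (map b Z)))
          ... | yes lv = k (counts lv)
          ... | no ¬lv = linear ¬lv

        fragmented : ⊥
        fragmented = fragment-⊥ P′ h′ S′ (m≤n+m _ (suc (suc κ))) ≤-refl handler

      contra : ⊥
      contra = let (A , len , ex) = exceeds t lκ₃ reds blues t ≤-refl in fragmented A len ex

  abstract
    countsAt : ∀ j d → j + d ≡ suc c → ∃[ κ ] CountsAt d κ
    countsAt zero d refl = c , λ P h lev → ⊥-elim (¬Lev-suc-c (<⇒≤ (Conn-nv h)) lev)
    countsAt (suc j) d eq =
      below⇒at (proj₂ (at⇒below (proj₂ (countsAt j (suc d) (trans (+-suc j d) eq)))))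

-- From matched stars to a graph isomorphism.

module Reconstruction (M : GraphMatroidFamily) (unb : Unbounded M) where

  open Rank M

  starMap⇒iso : ∀ G H ψ → IsMatroidIso M G H ψ → ∀ φ →
    (∀ {w} → InV G w → ∀ {e} → e ∈ E G → (Inc w e → Inc (φ w) (ψ e)) × (Inc (φ w) (ψ e) → Inc w e)) →
    (∀ {u v} → InV G u → InV G v → φ u ≡ φ v → u ≡ v) →
    (∀ {e} → e ∈ E G → ψ e ≡ mk (φ (proj₁ e)) (φ (proj₂ e))) →
    IsGraphIso G H φ × InducedBy G φ ψ
  starMap⇒iso G H ψ iso φ match inj ends = record
      { maps-into = λ u iu@(e , e∈ , i) → ψ e , maps-into e e∈ , proj₁ (match iu e∈) i
      ; injective = λ u v → inj
      ; onto = onto′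
      ; adj = λ u v iu iv → mk⇔ (to u v) (from u v iu iv) } ,
      λ e e∈ → subst (λ f → Joins f (φ (proj₁ e)) (φ (proj₂ e))) (sym (ends e∈)) (mk-Joins _ _)
    where
    open IsMatroidIso iso
    onto′ : ∀ w → InV H w → ∃[ u ] (InV G u × φ u ≡ w)
    onto′ w (f , f∈ , i) with onto f f∈
    ... | e , e∈ , refl with Inc-mk⁻ _ _ (subst (Inc w) (ends e∈) i)
    ... | inj₁ eq = proj₁ e , (e , e∈ , inj₁ refl) , sym eq
    ... | inj₂ eq = proj₂ e , (e , e∈ , inj₂ refl) , sym eq
    to : ∀ u v → Adj G u v → Adj H (φ u) (φ v)
    to u v (e , e∈ , j) = ψ e , maps-into e e∈ ,
      subst (λ f → Joins f (φ u) (φ v)) (sym (trans (ends e∈) (rename-Joins φ j))) (mk-Joins _ _)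
    from : ∀ u v → InV G u → InV G v → Adj H (φ u) (φ v) → Adj G u v
    from u v iu iv (f , f∈ , j) with onto f f∈
    ... | e , e∈ , refl = e , e∈ , subst (λ x → Joins x u v) (sym e≡) (mk-Joins u v)
      where
      f≡ : ψ e ≡ mk (φ u) (φ v)
      f≡ = Joins⇒mk (E-proper H f∈) j
      u≢v : u ≢ v
      u≢v eq = Proper-mk⁻ (subst Proper f≡ (E-proper H f∈)) (cong φ eq)
      e≡ : e ≡ mk u v
      e≡ = mk-of-Inc (E-proper G e∈) u≢v
        (proj₂ (match iu e∈) (subst (Inc (φ u)) (sym f≡) (Inc-mkˡ _ _)))
        (proj₂ (match iv e∈) (subst (Inc (φ v)) (sym f≡) (Inc-mkʳ _ _)))

  module _ (c₀ : ℕ) (ly : ∀ G → Connected c₀ G → Rigid M G) where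

    -- The successor makes `c` positive, so that graphs left after deletions still have positive
    -- connectivity and no isolated vertices.
    c : ℕ
    c = suc c₀

    spanning : ∀ {X} → Pr X → Conn c X → Spans X (V X)
    spanning {X} pr conn {u} {v} u∈ v∈ ne = begin
        ρ (mk u v ∷ X)  ≤⟨ ρ-mono (λ { (here refl) → ∈K⁺ u∈ v∈ ne ; (there p) → ⊆K-V pr p }) ⟩
        ρ (K (V X))     ≡⟨ trans (sym (rk≡ρ H id)) (trans (sym (ly G connected H complete)) (rk≡ρ G id)) ⟩
        ρ X             ∎
      where
      open ≤-Reasoning
      G H : Graph
      G = mkGraph X (All.tabulate pr)
      H = mkGraph (K (V X)) (All.tabulate (K-Pr (V X)))
      connected : Connected c₀ G
      connected = Conn⇒Connected G (Conn-mono (n≤1+n c₀) conn)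
      complete : IsCompleteOn H G
      complete p q p<q = mk⇔ (λ e∈ → ∈V⁻ (K-Inc e∈ (inj₁ refl)) , ∈V⁻ (K-Inc e∈ (inj₂ refl)))
        λ { ((e , e∈ , i) , (f , f∈ , j)) → ∈K-end p<q (∈V⁺ e∈ i) (∈V⁺ f∈ j) }

    open Rigidity M unb c (s≤s z≤n) spanning
    open Pairs M unb c (s≤s z≤n) spanning Edge
    open Descent M unb c (s≤s z≤n) spanning Edge
    open Induction M unb c (s≤s z≤n) spanning Edge

    at : ∃[ κ ] CountsAt 1 κ
    at = countsAt c 1 (+-comm c 1)

    κ : ℕ
    κ = proj₁ at

    equal : ∀ {a b Y} → Pair a b Y → Conn κ (map a Y) → Conn c (map a Y) → nv (map b Y) ≡ nv (map a Y)
    equal {a} {b} {Y} P h hc with nv (map a Y) in eq | Conn-nv hc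
    -- `Lev 1` fails at size `0`, as the complete graphs on no vertex and on one vertex both have
    -- rank zero; hence the successor.
    ... | suc n | _ = trans (proj₂ at P h (subst (Lev 1) (sym eq) (Lev-1 n))) eq

    -- Enough that deleting one vertex still leaves connectivity `suc κ` for the counts and `c` for
    -- rigidity.
    connectivity : ℕ
    connectivity = suc (suc κ) + suc c

    reconstructible : ∀ G → Connected connectivity G → Reconstructible M G
    reconstructible G conn H ψ iso = φ , starMap⇒iso G H ψ iso φ (match ∘ inV)
        (λ iu iv → proj₁ (proj₂ (proj₂ stars)) (inV iu) (inV iv)) ends
      where
      open IsMatroidIso iso
      Y : List Edge
      Y = E G
      Y≡ : map id Y ≡ Y
      Y≡ = map-id Y
      h : Conn connectivity (map id Y)
      h = subst (Conn connectivity) (sym Y≡) (Connected⇒Conn G conn)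
      into : ∀ {e} → e ∈ Y → ψ e ∈ E H
      into {e} = maps-into e
      P : Pair id ψ Y
      P = record
        { ρ-eq = λ {Z} s → trans (cong ρ (map-id Z)) (trans (sym (rk≡ρ G s)) (trans (sym (rank-pres Z s))
            (rk≡ρ H λ e∈ → let (f , f∈ , eq) = ∈-map⁻ ψ e∈ in subst (_∈ E H) (sym eq) (into (s f∈)))))
        ; properˡ = E-proper G ; properʳ = λ e∈ → E-proper H (into e∈)
        ; injectiveˡ = λ _ _ eq → eq ; injectiveʳ = λ {e} {f} e∈ f∈ → injective e f e∈ f∈ }
      counts : EqualCounts id ψ Y
      counts = record
        { whole = equal P (Conn-mono (≤-trans (m≤n+m κ 2) (m≤m+n _ (suc c))) h)
                          (Conn-mono (≤-trans (n≤1+n c) (m≤n+m (suc c) (suc (suc κ)))) h)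
        ; minus = λ {w} _ → equal (Pair-⊆ (del⊆ id (w ∷ []) Y) P)
            (Conn-mono (n≤1+n κ) (proj₂ (del-Conn (Prˡ P) (w ∷ []) (m≤m+n (suc (suc κ)) _) (s≤s z≤n) h)))
            (proj₂ (del-Conn (Prˡ P) (w ∷ []) (m≤n+m (suc c) (suc (suc κ))) (s≤s z≤n) h)) }
      stars = starMap P h (m≤n+m (suc c) (suc (suc κ))) counts
      φ : ℕ → ℕ
      φ = proj₁ stars
      match : ∀ {w} → w ∈ V (map id Y) → StarsMatch id ψ Y w (φ w)
      match = proj₁ (proj₂ stars)
      ends : ∀ {e} → e ∈ Y → ψ e ≡ mk (φ (proj₁ e)) (φ (proj₂ e))
      ends = proj₂ (proj₂ (proj₂ stars))
      inV : ∀ {u} → InV G u → u ∈ V (map id Y)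
      inV {u} (e , e∈ , i) = subst (λ X → u ∈ V X) (sym Y≡) (∈V⁺ e∈ i)
  lovaszYemini⇒whitney : LovaszYeminiProperty M → WhitneyProperty M
  lovaszYemini⇒whitney (c₀ , ly) = connectivity c₀ ly , reconstructible c₀ ly

theorem1p1 : (M : GraphMatroidFamily) → Unbounded M →
    WhitneyProperty M ⇔ LovaszYeminiProperty M
theorem1p1 M unb = mk⇔ (NewVertex.whitney⇒lovaszYemini M unb) (Reconstruction.lovaszYemini⇒whitney M unb)
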